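{- There exist absolute constants $\epsilon>0$ and $C\ge c>0$ such that for all integers $d\ge 0$, $n\ge 1$ and every function $f:\mathbb{F}_2^n\to\mathbb{F}_2$: if $\|f\|_{U^{d+1}}\ge 1-\epsilon/2^d$, then $\delta_d(f)=\Theta(1-\|f\|_{U^{d+1}})$, i.e. $$c\,(1-\|f\|_{U^{d+1}})\ \le\ \delta_d(f)\ \le\ C\,(1-\|f\|_{U^{d+1}}).$$
   Context: Every function $f:\mathbb{F}_2^n\to\mathbb{F}_2$ is uniquely a multilinear polynomial over $\mathbb{F}_2$; $\deg f$ is its degree. $\delta_d(f)=\min\{\Pr_{x\in\mathbb{F}_2^n}[f(x)\ne g(x)] : g:\mathbb{F}_2^n\to\mathbb{F}_2,\ \deg g\le d\}$, with $x$ uniform. The $k$th Gowers norm test $T_{\mathrm{GN}(k)}^f$ picks $x,a_1,\dots,a_k\in\mathbb{F}_2^n$ uniformly and independently and accepts if and only if the $k$-fold derivative vanishes, i.e. $\sum_{J\subseteq[k]} f(x+\sum_{j\in J}a_j)=0$ in $\mathbb{F}_2$ (equivalently, iff $f$ restricted to $x+\mathrm{span}(a_1,\dots,a_k)$ has degree at most $k-1$). The $k$th Gowers norm of $f$ is $$\|f\|_{U^k}=\left(\Pr[T_{\mathrm{GN}(k)}^f\text{ accepts}]-\Pr[T_{\mathrm{GN}(k)}^f\text{ rejects}]\right)^{1/2^k}.$$ -}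

module Defs where

open import Data.Bool.Base using (Bool; true; false; if_then_else_; _∧_; _xor_)
import Data.Bool.Properties as Bool
open import Data.Empty using (⊥-elim)
open import Data.Fin.Subset using (Subset; ∣_∣)
open import Data.Integer.Base as ℤ using (+_)
import Data.Integer.Properties as ℤ
open import Data.List.Base using (List; []; _∷_; _++_; foldr; map; filter; length; cartesianProductWith)
open import Data.List.NonEmpty as List⁺ using (List⁺; _∷_; toList)
import Data.List.Properties as List
import Data.List.Relation.Unary.All as All
import Data.List.Relation.Unary.All.Properties as All
open import Data.List.Relation.Unary.Any as Any using (Any; here; there)
import Data.List.Relation.Unary.Any.Properties as Any
open import Data.Nat.Base as ℕ using (ℕ; zero; suc)
import Data.Nat.Coprimality as Coprime
import Data.Nat.Properties as ℕ
open import Data.Product.Base using (∃-syntax; _×_; _,_)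
open import Data.Rational.Base as ℚ using (ℚ; 0ℚ; 1ℚ; ½)
import Data.Rational.Properties as ℚ
open import Data.Rational.Solver using (module +-*-Solver)
import Data.Rational.Unnormalised.Base as ℚᵘ
import Data.Rational.Unnormalised.Properties as ℚᵘ
open import Data.Sum.Base using (inj₁; inj₂)
open import Data.Vec.Base as Vec using (Vec; []; _∷_)
open import Function.Base using (_∘_; const)
open import Level using (0ℓ)
open import Relation.Binary.Bundles using (DecTotalOrder)
open import Relation.Binary.PropositionalEquality
open import Relation.Nullary using (yes; no; ¬?)
open import Relation.Unary using (Pred; Decidable; _≐_)

open import Algebra.Definitions.RawSemiring ℚ.+-*-rawSemiring public using (_^_)
open import Data.List.Extrema (DecTotalOrder.totalOrder ℚ.≤-decTotalOrder)
  using (min; min≤v⁺; argmin-all)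
open +-*-Solver using (solve; _:=_; _:+_; _:*_; _:-_; :-_; con)

-- Reals are Cauchy sequences of rationals, not quotiented: x and y denote the
-- same real when x ≤ y and y ≤ x.

record ℝ : Set where
  constructor mkℝ
  field
    seq    : ℕ → ℚ
    cauchy : ∀ {e} → 0ℚ ℚ.< e →
             ∃[ N ] (∀ m n → N ℕ.≤ m → N ℕ.≤ n → ℚ.∣ seq m ℚ.- seq n ∣ ℚ.< e)

open ℝ public

infix 4 _≤_ _<_

_≤_ : ℝ → ℝ → Set
x ≤ y = ∀ {e} → 0ℚ ℚ.< e → ∃[ N ] (∀ n → N ℕ.≤ n → seq x n ℚ.≤ seq y n ℚ.+ e)

_<_ : ℝ → ℝ → Set
x < y = ∃[ e ] (0ℚ ℚ.< e × ∃[ N ] (∀ n → N ℕ.≤ n → seq x n ℚ.+ e ℚ.≤ seq y n))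

fromℚ : ℚ → ℝ
fromℚ q .seq _ = q
fromℚ q .cauchy 0<e = zero , λ _ _ _ _ →
  subst (ℚ._< _) (sym (cong ℚ.∣_∣ (ℚ.+-inverseʳ q))) 0<e

0ℝ 1ℝ : ℝ
0ℝ = fromℚ 0ℚ
1ℝ = fromℚ 1ℚ

private
  half+half : ∀ e → ½ ℚ.* e ℚ.+ ½ ℚ.* e ≡ e
  half+half e = trans (sym (ℚ.*-distribʳ-+ e ½ ½)) (ℚ.*-identityˡ e)

  half-pos : ∀ {e} → 0ℚ ℚ.< e → 0ℚ ℚ.< ½ ℚ.* e
  half-pos {e} 0<e = subst (ℚ._< ½ ℚ.* e) (ℚ.*-zeroʳ ½) (ℚ.*-monoʳ-<-pos ½ 0<e)

  p≤p+q : ∀ {p q} → 0ℚ ℚ.≤ q → p ℚ.≤ p ℚ.+ q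
  p≤p+q {p} {q} 0≤q = subst (ℚ._≤ p ℚ.+ q) (ℚ.+-identityʳ p) (ℚ.+-monoʳ-≤ p 0≤q)

infixl 6 _+_ _-_
infixl 7 _*_
infix  8 -_

_+_ : ℝ → ℝ → ℝ
(x + y) .seq n = seq x n ℚ.+ seq y n
(x + y) .cauchy {e} 0<e =
  let N₁ , p₁ = cauchy x (half-pos 0<e)
      N₂ , p₂ = cauchy y (half-pos 0<e)
  in N₁ ℕ.⊔ N₂ , λ m n m≥ n≥ → begin-strict
    ℚ.∣ (seq x m ℚ.+ seq y m) ℚ.- (seq x n ℚ.+ seq y n) ∣
      ≡⟨ cong ℚ.∣_∣ (regroup (seq x m) (seq y m) (seq x n) (seq y n)) ⟩
    ℚ.∣ (seq x m ℚ.- seq x n) ℚ.+ (seq y m ℚ.- seq y n) ∣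
      ≤⟨ ℚ.∣p+q∣≤∣p∣+∣q∣ (seq x m ℚ.- seq x n) (seq y m ℚ.- seq y n) ⟩
    ℚ.∣ seq x m ℚ.- seq x n ∣ ℚ.+ ℚ.∣ seq y m ℚ.- seq y n ∣
      <⟨ ℚ.+-mono-< (p₁ m n (ℕ.m⊔n≤o⇒m≤o N₁ N₂ m≥) (ℕ.m⊔n≤o⇒m≤o N₁ N₂ n≥))
                    (p₂ m n (ℕ.m⊔n≤o⇒n≤o N₁ N₂ m≥) (ℕ.m⊔n≤o⇒n≤o N₁ N₂ n≥)) ⟩
    ½ ℚ.* e ℚ.+ ½ ℚ.* e
      ≡⟨ half+half e ⟩
    e ∎
  where
  open ℚ.≤-Reasoning
  regroup : ∀ a b c d → (a ℚ.+ b) ℚ.- (c ℚ.+ d) ≡ (a ℚ.- c) ℚ.+ (b ℚ.- d)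
  regroup = solve 4 (λ a b c d → (a :+ b) :- (c :+ d) := (a :- c) :+ (b :- d)) refl

-_ : ℝ → ℝ
(- x) .seq n = ℚ.- seq x n
(- x) .cauchy {e} 0<e =
  let N , p = cauchy x 0<e
  in N , λ m n m≥ n≥ → subst (ℚ._< e) (flip (seq x m) (seq x n)) (p m n m≥ n≥)
  where
  flip : ∀ a b → ℚ.∣ a ℚ.- b ∣ ≡ ℚ.∣ ℚ.- a ℚ.- ℚ.- b ∣
  flip a b = trans (sym (ℚ.∣-p∣≡∣p∣ (a ℚ.- b)))
    (cong ℚ.∣_∣ (solve 2 (λ a b → :- (a :- b) := :- a :- :- b) refl a b))

_-_ : ℝ → ℝ → ℝ
x - y = x + (- y)

private
  eventually-bounded : ∀ x → ∃[ K ] (0ℚ ℚ.< K × ∃[ N ] (∀ n → N ℕ.≤ n → ℚ.∣ seq x n ∣ ℚ.≤ K))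
  eventually-bounded x =
    let N , p = cauchy x {1ℚ} (ℚ.positive⁻¹ 1ℚ)
        a = seq x N
    in 1ℚ ℚ.+ ℚ.∣ a ∣
     , ℚ.<-≤-trans (ℚ.positive⁻¹ 1ℚ) (p≤p+q (ℚ.0≤∣p∣ a))
     , N , λ n n≥ → begin
      ℚ.∣ seq x n ∣                     ≡⟨ cong ℚ.∣_∣ (split (seq x n) a) ⟩
      ℚ.∣ (seq x n ℚ.- a) ℚ.+ a ∣       ≤⟨ ℚ.∣p+q∣≤∣p∣+∣q∣ (seq x n ℚ.- a) a ⟩
      ℚ.∣ seq x n ℚ.- a ∣ ℚ.+ ℚ.∣ a ∣   ≤⟨ ℚ.+-monoˡ-≤ ℚ.∣ a ∣ (ℚ.<⇒≤ (p n N n≥ ℕ.≤-refl)) ⟩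
      1ℚ ℚ.+ ℚ.∣ a ∣                    ∎
    where
    open ℚ.≤-Reasoning
    split : ∀ b a → b ≡ (b ℚ.- a) ℚ.+ a
    split = solve 2 (λ b a → b := (b :- a) :+ a) refl

  divide : ∀ {e K} → 0ℚ ℚ.< e → 0ℚ ℚ.< K → ∃[ h ] (0ℚ ℚ.< h × K ℚ.* h ≡ e)
  divide {e} {K} 0<e 0<K = ℚ.1/ K ℚ.* e , pos , inv
    where
    instance
      _ = ℚ.positive 0<K
      _ = ℚ.pos⇒nonZero K
      _ = ℚ.1/pos⇒pos K
    pos : 0ℚ ℚ.< ℚ.1/ K ℚ.* e
    pos = subst (ℚ._< ℚ.1/ K ℚ.* e) (ℚ.*-zeroʳ (ℚ.1/ K)) (ℚ.*-monoʳ-<-pos (ℚ.1/ K) 0<e)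
    inv : K ℚ.* (ℚ.1/ K ℚ.* e) ≡ e
    inv = trans (sym (ℚ.*-assoc K (ℚ.1/ K) e))
            (trans (cong (ℚ._* e) (ℚ.*-inverseʳ K)) (ℚ.*-identityˡ e))

_*_ : ℝ → ℝ → ℝ
(x * y) .seq n = seq x n ℚ.* seq y n
(x * y) .cauchy {e} 0<e =
  let K₁ , 0<K₁ , M₁ , b₁ = eventually-bounded x
      K₂ , 0<K₂ , M₂ , b₂ = eventually-bounded y
      h , 0<h , Kh≡e = divide {e} {K₁ ℚ.+ K₂} 0<e (ℚ.+-mono-< 0<K₁ 0<K₂)
      N₁ , p₁ = cauchy x 0<h
      N₂ , p₂ = cauchy y 0<h
      M = M₁ ℕ.⊔ M₂
      N = N₁ ℕ.⊔ N₂
  in M ℕ.⊔ N , λ m n m≥ n≥ →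
    let Mm = ℕ.m⊔n≤o⇒m≤o M N m≥
        Mn = ℕ.m⊔n≤o⇒m≤o M N n≥
        Nm = ℕ.m⊔n≤o⇒n≤o M N m≥
        Nn = ℕ.m⊔n≤o⇒n≤o M N n≥
        a = seq x m ; b = seq y m ; c = seq x n ; d = seq y n
        instance
          _ = ℚ.positive 0<K₁
          _ = ℚ.positive 0<K₂
    in begin-strict
    ℚ.∣ a ℚ.* b ℚ.- c ℚ.* d ∣
      ≡⟨ cong ℚ.∣_∣ (regroup a b c d) ⟩
    ℚ.∣ a ℚ.* (b ℚ.- d) ℚ.+ d ℚ.* (a ℚ.- c) ∣
      ≤⟨ ℚ.∣p+q∣≤∣p∣+∣q∣ (a ℚ.* (b ℚ.- d)) (d ℚ.* (a ℚ.- c)) ⟩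
    ℚ.∣ a ℚ.* (b ℚ.- d) ∣ ℚ.+ ℚ.∣ d ℚ.* (a ℚ.- c) ∣
      ≡⟨ cong₂ ℚ._+_ (ℚ.∣p*q∣≡∣p∣*∣q∣ a (b ℚ.- d)) (ℚ.∣p*q∣≡∣p∣*∣q∣ d (a ℚ.- c)) ⟩
    ℚ.∣ a ∣ ℚ.* ℚ.∣ b ℚ.- d ∣ ℚ.+ ℚ.∣ d ∣ ℚ.* ℚ.∣ a ℚ.- c ∣
      ≤⟨ ℚ.+-mono-≤
           (ℚ.*-monoʳ-≤-nonNeg ℚ.∣ b ℚ.- d ∣ {{ℚ.∣-∣-nonNeg (b ℚ.- d)}}
              (b₁ m (ℕ.m⊔n≤o⇒m≤o M₁ M₂ Mm)))
           (ℚ.*-monoʳ-≤-nonNeg ℚ.∣ a ℚ.- c ∣ {{ℚ.∣-∣-nonNeg (a ℚ.- c)}}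
              (b₂ n (ℕ.m⊔n≤o⇒n≤o M₁ M₂ Mn))) ⟩
    K₁ ℚ.* ℚ.∣ b ℚ.- d ∣ ℚ.+ K₂ ℚ.* ℚ.∣ a ℚ.- c ∣
      <⟨ ℚ.+-mono-<
           (ℚ.*-monoʳ-<-pos K₁ (p₂ m n (ℕ.m⊔n≤o⇒n≤o N₁ N₂ Nm) (ℕ.m⊔n≤o⇒n≤o N₁ N₂ Nn)))
           (ℚ.*-monoʳ-<-pos K₂ (p₁ m n (ℕ.m⊔n≤o⇒m≤o N₁ N₂ Nm) (ℕ.m⊔n≤o⇒m≤o N₁ N₂ Nn))) ⟩
    K₁ ℚ.* h ℚ.+ K₂ ℚ.* h
      ≡⟨ ℚ.*-distribʳ-+ h K₁ K₂ ⟨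
    (K₁ ℚ.+ K₂) ℚ.* h
      ≡⟨ Kh≡e ⟩
    e ∎
  where
  open ℚ.≤-Reasoning
  regroup : ∀ a b c d → a ℚ.* b ℚ.- c ℚ.* d ≡ a ℚ.* (b ℚ.- d) ℚ.+ d ℚ.* (a ℚ.- c)
  regroup = solve 4 (λ a b c d → a :* b :- c :* d := a :* (b :- d) :+ d :* (a :- c)) refl

-- Bisection: for p ≥ 0 and m ≥ 1 the m-th root of p lies in
-- [ lower m p n , lower m p n + width p n ].

width : ℚ → ℕ → ℚ
width p n = (1ℚ ℚ.+ ℚ.∣ p ∣) ℚ.* ½ ^ n

lower : ℕ → ℚ → ℕ → ℚ
lower m p zero    = 0ℚ
lower m p (suc n) with (lower m p n ℚ.+ width p (suc n)) ^ m ℚ.≤? p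
... | yes _ = lower m p n ℚ.+ width p (suc n)
... | no  _ = lower m p n

private
  ½^-pos : ∀ n → 0ℚ ℚ.< ½ ^ n
  ½^-pos zero    = ℚ.positive⁻¹ 1ℚ
  ½^-pos (suc n) = half-pos (½^-pos n)

  half≤ : ∀ {e} → 0ℚ ℚ.≤ e → ½ ℚ.* e ℚ.≤ e
  half≤ {e} 0≤e = subst (½ ℚ.* e ℚ.≤_) (half+half e)
    (p≤p+q (subst (ℚ._≤ ½ ℚ.* e) (ℚ.*-zeroʳ ½) (ℚ.*-monoˡ-≤-nonNeg ½ 0≤e)))

  ½^≤1 : ∀ n → ½ ^ n ℚ.≤ 1ℚ
  ½^≤1 zero    = ℚ.≤-refl
  ½^≤1 (suc n) = ℚ.≤-trans (half≤ (ℚ.<⇒≤ (½^-pos n))) (½^≤1 n)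

  fromℕ : ℕ → ℚ
  fromℕ n = ℚ.mkℚ (+ n) 0 (Coprime.sym (Coprime.1-coprimeTo n))

  fromℕ-suc : ∀ n → fromℕ (suc n) ≡ 1ℚ ℚ.+ fromℕ n
  fromℕ-suc n = ℚ.toℚᵘ-injective (ℚᵘ.≃-sym (ℚᵘ.≃-trans (ℚ.toℚᵘ-homo-+ 1ℚ (fromℕ n))
    (ℚᵘ.*≡* (cong (λ k → (+ 1 ℤ.+ k) ℤ.* + 1) (ℤ.*-identityʳ (+ n))))))

  ½^n*n<1 : ∀ n → ½ ^ n ℚ.* fromℕ n ℚ.< 1ℚ
  ½^n*n<1 zero    = ℚ.positive⁻¹ 1ℚ
  ½^n*n<1 (suc n) = begin-strict
    (½ ℚ.* ½ ^ n) ℚ.* fromℕ (suc n)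
      ≡⟨ cong ((½ ℚ.* ½ ^ n) ℚ.*_) (fromℕ-suc n) ⟩
    (½ ℚ.* ½ ^ n) ℚ.* (1ℚ ℚ.+ fromℕ n)
      ≡⟨ solve 3 (λ h a k → (h :* a) :* (con 1ℚ :+ k) := h :* (a :+ a :* k)) refl ½ (½ ^ n) (fromℕ n) ⟩
    ½ ℚ.* (½ ^ n ℚ.+ ½ ^ n ℚ.* fromℕ n)
      <⟨ ℚ.*-monoʳ-<-pos ½ (ℚ.+-mono-≤-< (½^≤1 n) (½^n*n<1 n)) ⟩
    ½ ℚ.* (1ℚ ℚ.+ 1ℚ)
      ≡⟨⟩
    1ℚ ∎
    where open ℚ.≤-Reasoning

  1≤h*den : ∀ h → 0ℚ ℚ.< h → 1ℚ ℚ.≤ h ℚ.* fromℕ (ℚ.↧ₙ h)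
  1≤h*den h@(ℚ.mkℚ (+ suc a) b _) 0<h = ℚ.toℚᵘ-cancel-≤
    (ℚᵘ.≤-trans (ℚᵘ.*≤* (ℤ.+≤+ le)) (ℚᵘ.≤-reflexive (ℚᵘ.≃-sym (ℚ.toℚᵘ-homo-* h (fromℕ (suc b))))))
    where
    le : 1 ℕ.* (suc b ℕ.* 1) ℕ.≤ suc a ℕ.* suc b ℕ.* 1
    le = ℕ.≤-trans (ℕ.≤-reflexive (ℕ.+-identityʳ (suc b ℕ.* 1)))
           (ℕ.*-monoˡ-≤ 1 (ℕ.m≤m+n (suc b) (a ℕ.* suc b)))
  1≤h*den h@(ℚ.mkℚ (+ zero) _ _) (ℚ.*<* (ℤ.+<+ ()))
  1≤h*den h@(ℚ.mkℚ (ℤ.-[1+ _ ]) _ _) (ℚ.*<* ())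

  ½^-vanishes : ∀ {h} → 0ℚ ℚ.< h → ∃[ N ] ½ ^ N ℚ.< h
  ½^-vanishes {h} 0<h = N , ℚ.*-cancelʳ-<-nonNeg (fromℕ N)
    (ℚ.<-≤-trans (½^n*n<1 N) (1≤h*den h 0<h))
    where N = ℚ.↧ₙ h

  0<1+∣_∣ : ∀ p → 0ℚ ℚ.< 1ℚ ℚ.+ ℚ.∣ p ∣
  0<1+∣ p ∣ = ℚ.<-≤-trans (ℚ.positive⁻¹ 1ℚ) (p≤p+q (ℚ.0≤∣p∣ p))

  width-pos : ∀ p n → 0ℚ ℚ.< width p n
  width-pos p n = subst (ℚ._< width p n) (ℚ.*-zeroʳ B) (ℚ.*-monoʳ-<-pos B {{ℚ.positive 0<1+∣ p ∣}} (½^-pos n))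
    where B = 1ℚ ℚ.+ ℚ.∣ p ∣

  width-double : ∀ p n → width p (suc n) ℚ.+ width p (suc n) ≡ width p n
  width-double p n = trans (sym (ℚ.*-distribˡ-+ (1ℚ ℚ.+ ℚ.∣ p ∣) (½ ^ suc n) (½ ^ suc n)))
                           (cong ((1ℚ ℚ.+ ℚ.∣ p ∣) ℚ.*_) (half+half (½ ^ n)))

  width-vanishes : ∀ p {e} → 0ℚ ℚ.< e → ∃[ N ] width p N ℚ.< e
  width-vanishes p 0<e =
    let h , 0<h , Bh≡e = divide 0<e 0<1+∣ p ∣
        N , lt = ½^-vanishes 0<h
    in N , subst (width p N ℚ.<_) Bh≡e (ℚ.*-monoʳ-<-pos (1ℚ ℚ.+ ℚ.∣ p ∣) {{ℚ.positive 0<1+∣ p ∣}} lt)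

  upper : ℕ → ℚ → ℕ → ℚ
  upper m p n = lower m p n ℚ.+ width p n

  lower≤lower : ∀ m p n → lower m p n ℚ.≤ lower m p (suc n)
  lower≤lower m p n with (lower m p n ℚ.+ width p (suc n)) ^ m ℚ.≤? p
  ... | yes _ = p≤p+q (ℚ.<⇒≤ (width-pos p (suc n)))
  ... | no  _ = ℚ.≤-refl

  upper-split : ∀ m p n → lower m p n ℚ.+ width p (suc n) ℚ.+ width p (suc n) ≡ upper m p n
  upper-split m p n = trans (ℚ.+-assoc (lower m p n) (width p (suc n)) (width p (suc n)))
                            (cong (lower m p n ℚ.+_) (width-double p n))

  upper≤upper : ∀ m p n → upper m p (suc n) ℚ.≤ upper m p n
  upper≤upper m p n with (lower m p n ℚ.+ width p (suc n)) ^ m ℚ.≤? p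
  ... | yes _ = ℚ.≤-reflexive (upper-split m p n)
  ... | no  _ = ℚ.≤-trans (p≤p+q (ℚ.<⇒≤ (width-pos p (suc n)))) (ℚ.≤-reflexive (upper-split m p n))

  lower-mono : ∀ m p {N n} → N ℕ.≤′ n → lower m p N ℚ.≤ lower m p n
  lower-mono m p ℕ.≤′-refl            = ℚ.≤-refl
  lower-mono m p (ℕ.≤′-step {n} N≤n)  = ℚ.≤-trans (lower-mono m p N≤n) (lower≤lower m p n)

  upper-mono : ∀ m p {N n} → N ℕ.≤′ n → upper m p n ℚ.≤ upper m p N
  upper-mono m p ℕ.≤′-refl            = ℚ.≤-refl
  upper-mono m p (ℕ.≤′-step {n} N≤n)  = ℚ.≤-trans (upper≤upper m p n) (upper-mono m p N≤n)

  lower≤upper : ∀ m p n → lower m p n ℚ.≤ upper m p n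
  lower≤upper m p n = p≤p+q (ℚ.<⇒≤ (width-pos p n))

  within : ∀ {l w a b} → l ℚ.≤ a → a ℚ.≤ l ℚ.+ w → l ℚ.≤ b → b ℚ.≤ l ℚ.+ w → ℚ.∣ a ℚ.- b ∣ ℚ.≤ w
  within {l} {w} {a} {b} l≤a a≤u l≤b b≤u with ℚ.∣p∣≡p∨∣p∣≡-p (a ℚ.- b)
  ... | inj₁ eq = subst (ℚ._≤ w) (sym eq) (sub a≤u l≤b)
    where
    sub : ∀ {x y} → x ℚ.≤ l ℚ.+ w → l ℚ.≤ y → x ℚ.- y ℚ.≤ w
    sub {x} {y} x≤u l≤y = subst (x ℚ.- y ℚ.≤_) (solve 2 (λ l w → (l :+ w) :- l := w) refl l w)
                            (ℚ.+-mono-≤ x≤u (ℚ.neg-antimono-≤ l≤y))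
  ... | inj₂ eq = subst (ℚ._≤ w) (sym (trans eq (solve 2 (λ a b → :- (a :- b) := b :- a) refl a b)))
    (subst (b ℚ.- a ℚ.≤_) (solve 2 (λ l w → (l :+ w) :- l := w) refl l w)
       (ℚ.+-mono-≤ b≤u (ℚ.neg-antimono-≤ l≤a)))

-- This is 0 when p is negative, and meaningless when m is 0; otherwise root-nonneg
-- and root-power show that it is the nonnegative real whose m-th power is p.

root : ℕ → ℚ → ℝ
root m p .seq = lower m p
root m p .cauchy 0<e =
  let N , w<e = width-vanishes p 0<e
      above = λ k k≥ → lower-mono m p (ℕ.≤⇒≤′ k≥)
      below = λ k k≥ → ℚ.≤-trans (lower≤upper m p k) (upper-mono m p (ℕ.≤⇒≤′ k≥))
  in N , λ i j i≥ j≥ → ℚ.≤-<-trans (within (above i i≥) (below i i≥) (above j j≥) (below j j≥)) w<e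

root-nonneg : ∀ m p n → 0ℚ ℚ.≤ seq (root m p) n
root-nonneg m p n = lower-mono m p (ℕ.≤⇒≤′ (ℕ.z≤n {n}))

private
  *-nonneg : ∀ {a b} → 0ℚ ℚ.≤ a → 0ℚ ℚ.≤ b → 0ℚ ℚ.≤ a ℚ.* b
  *-nonneg {a} {b} 0≤a 0≤b = subst (ℚ._≤ a ℚ.* b) (ℚ.*-zeroˡ b) (ℚ.*-monoʳ-≤-nonNeg b {{ℚ.nonNegative 0≤b}} 0≤a)

  *-mono : ∀ {a b c d} → 0ℚ ℚ.≤ a → a ℚ.≤ b → 0ℚ ℚ.≤ c → c ℚ.≤ d → a ℚ.* c ℚ.≤ b ℚ.* d
  *-mono {a} {b} {c} {d} 0≤a a≤b 0≤c c≤d = ℚ.≤-trans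
    (ℚ.*-monoʳ-≤-nonNeg c {{ℚ.nonNegative 0≤c}} a≤b)
    (ℚ.*-monoˡ-≤-nonNeg b {{ℚ.nonNegative (ℚ.≤-trans 0≤a a≤b)}} c≤d)

  ^-nonneg : ∀ {a} → 0ℚ ℚ.≤ a → ∀ m → 0ℚ ℚ.≤ a ^ m
  ^-nonneg 0≤a zero    = ℚ.nonNegative⁻¹ 1ℚ
  ^-nonneg 0≤a (suc m) = *-nonneg 0≤a (^-nonneg 0≤a m)

  ^-mono : ∀ {a b} → 0ℚ ℚ.≤ a → a ℚ.≤ b → ∀ m → a ^ m ℚ.≤ b ^ m
  ^-mono 0≤a a≤b zero    = ℚ.≤-refl
  ^-mono 0≤a a≤b (suc m) = *-mono 0≤a a≤b (^-nonneg 0≤a m) (^-mono 0≤a a≤b m)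

  1≤^ : ∀ {a} → 1ℚ ℚ.≤ a → ∀ m → 1ℚ ℚ.≤ a ^ m
  1≤^ 1≤a zero    = ℚ.≤-refl
  1≤^ 1≤a (suc m) = *-mono (ℚ.nonNegative⁻¹ 1ℚ) 1≤a (ℚ.nonNegative⁻¹ 1ℚ) (1≤^ 1≤a m)

  p≤∣p∣ : ∀ p → p ℚ.≤ ℚ.∣ p ∣
  p≤∣p∣ p with ℚ.≤-total 0ℚ p
  ... | inj₁ 0≤p = ℚ.≤-reflexive (sym (ℚ.0≤p⇒∣p∣≡p 0≤p))
  ... | inj₂ p≤0 = ℚ.≤-trans p≤0 (ℚ.0≤∣p∣ p)

  lower^≤p : ∀ m p → 0ℚ ℚ.≤ p → ∀ n → lower (suc m) p n ^ suc m ℚ.≤ p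
  lower^≤p m p 0≤p zero = subst (ℚ._≤ p) (sym (ℚ.*-zeroˡ (0ℚ ^ m))) 0≤p
  lower^≤p m p 0≤p (suc n) with (lower (suc m) p n ℚ.+ width p (suc n)) ^ suc m ℚ.≤? p
  ... | yes le = le
  ... | no  _  = lower^≤p m p 0≤p n

  p<upper^ : ∀ m p n → p ℚ.< upper (suc m) p n ^ suc m
  p<upper^ m p zero = subst (λ b → p ℚ.< b ^ suc m) (sym B≡) (ℚ.<-≤-trans p<B B≤B^)
    where
    B = 1ℚ ℚ.+ ℚ.∣ p ∣
    B≡ : upper (suc m) p zero ≡ B
    B≡ = trans (ℚ.+-identityˡ _) (ℚ.*-identityʳ B)
    p<B : p ℚ.< B
    p<B = subst (ℚ._< B) (ℚ.+-identityˡ p) (ℚ.+-mono-<-≤ (ℚ.positive⁻¹ 1ℚ) (p≤∣p∣ p))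
    B≤B^ : B ℚ.≤ B ^ suc m
    B≤B^ = subst (ℚ._≤ B ^ suc m) (ℚ.*-identityʳ B)
      (*-mono (ℚ.<⇒≤ 0<1+∣ p ∣) ℚ.≤-refl (ℚ.nonNegative⁻¹ 1ℚ) (1≤^ (p≤p+q (ℚ.0≤∣p∣ p)) m))
  p<upper^ m p (suc n) with (lower (suc m) p n ℚ.+ width p (suc n)) ^ suc m ℚ.≤? p
  ... | yes _  = subst (λ b → p ℚ.< b ^ suc m) (sym (upper-split (suc m) p n)) (p<upper^ m p n)
  ... | no gt  = ℚ.≰⇒> gt

  lip : ℚ → ℕ → ℚ
  lip B zero    = 1ℚ
  lip B (suc m) = B ℚ.* lip B m ℚ.+ B ^ m

  lip-pos : ∀ {B} → 1ℚ ℚ.≤ B → ∀ m → 0ℚ ℚ.< lip B m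
  lip-pos 1≤B zero    = ℚ.positive⁻¹ 1ℚ
  lip-pos 1≤B (suc m) = ℚ.+-mono-≤-< (*-nonneg 0≤B (ℚ.<⇒≤ (lip-pos 1≤B m)))
                                     (ℚ.<-≤-trans (ℚ.positive⁻¹ 1ℚ) (1≤^ 1≤B m))
    where 0≤B = ℚ.≤-trans (ℚ.nonNegative⁻¹ 1ℚ) 1≤B

  lipschitz : ∀ {B s w} → 0ℚ ℚ.≤ s → 0ℚ ℚ.≤ w → s ℚ.+ w ℚ.≤ B →
              ∀ m → (s ℚ.+ w) ^ m ℚ.≤ s ^ m ℚ.+ w ℚ.* lip B m
  lipschitz {B} {s} {w} 0≤s 0≤w u≤B zero = p≤p+q (subst (0ℚ ℚ.≤_) (sym (ℚ.*-identityʳ w)) 0≤w)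
  lipschitz {B} {s} {w} 0≤s 0≤w u≤B (suc m) = begin
    u ℚ.* u ^ m
      ≤⟨ *-mono 0≤u ℚ.≤-refl (^-nonneg 0≤u m) (lipschitz 0≤s 0≤w u≤B m) ⟩
    u ℚ.* (s ^ m ℚ.+ w ℚ.* L)
      ≡⟨ solve 4 (λ s w a l → (s :+ w) :* (a :+ w :* l) := s :* a :+ w :* ((s :+ w) :* l :+ a)) refl s w (s ^ m) L ⟩
    s ℚ.* s ^ m ℚ.+ w ℚ.* (u ℚ.* L ℚ.+ s ^ m)
      ≤⟨ ℚ.+-monoʳ-≤ (s ℚ.* s ^ m) (*-mono 0≤w ℚ.≤-refl 0≤uL+s^ (ℚ.+-mono-≤
           (*-mono 0≤u u≤B 0≤L ℚ.≤-refl) (^-mono 0≤s s≤B m))) ⟩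
    s ℚ.* s ^ m ℚ.+ w ℚ.* (B ℚ.* L ℚ.+ B ^ m) ∎
    where
    open ℚ.≤-Reasoning
    u = s ℚ.+ w
    L = lip B m
    s≤u = p≤p+q {s} 0≤w
    s≤B = ℚ.≤-trans s≤u u≤B
    0≤u = ℚ.≤-trans 0≤s s≤u
    lip-nonneg : ∀ m → 0ℚ ℚ.≤ lip B m
    lip-nonneg zero    = ℚ.nonNegative⁻¹ 1ℚ
    lip-nonneg (suc m) = ℚ.+-mono-≤ (*-nonneg (ℚ.≤-trans 0≤s s≤B) (lip-nonneg m)) (^-nonneg (ℚ.≤-trans 0≤s s≤B) m)
    0≤L = lip-nonneg m
    0≤uL+s^ = ℚ.+-mono-≤ (*-nonneg 0≤u 0≤L) (^-nonneg 0≤s m)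

root-power : ∀ m p → m ℕ.≥ 1 → 0ℚ ℚ.≤ p → ∀ {e} → 0ℚ ℚ.< e →
             ∃[ N ] (∀ n → N ℕ.≤ n → ℚ.∣ seq (root m p) n ^ m ℚ.- p ∣ ℚ.< e)
root-power (suc m) p _ 0≤p {e} 0<e =
  let h , 0<h , Lh≡e = divide 0<e (lip-pos 1≤B (suc m))
      N , w<h = width-vanishes p 0<h
  in N , λ n n≥ →
    let s = lower (suc m) p n
        u = upper (suc m) p n
        w≤ = width-mono (ℕ.≤⇒≤′ n≥)
        u^≤ = lipschitz (root-nonneg (suc m) p n) (ℚ.<⇒≤ (width-pos p n)) (upper≤B n) (suc m)
    in ℚ.≤-<-trans
        (within ℚ.≤-refl (p≤p+q (*-nonneg (ℚ.<⇒≤ (width-pos p n)) (ℚ.<⇒≤ (lip-pos 1≤B (suc m)))))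
           (lower^≤p m p 0≤p n) (ℚ.≤-trans (ℚ.<⇒≤ (p<upper^ m p n)) u^≤))
        (subst (width p n ℚ.* L ℚ.<_) (trans (ℚ.*-comm h L) Lh≡e)
          (ℚ.*-monoˡ-<-pos L {{ℚ.positive (lip-pos 1≤B (suc m))}} (ℚ.≤-<-trans w≤ w<h)))
  where
  B = 1ℚ ℚ.+ ℚ.∣ p ∣
  L = lip B (suc m)
  1≤B : 1ℚ ℚ.≤ B
  1≤B = p≤p+q (ℚ.0≤∣p∣ p)
  upper≤B : ∀ n → upper (suc m) p n ℚ.≤ B
  upper≤B n = subst (upper (suc m) p n ℚ.≤_) (trans (ℚ.+-identityˡ _) (ℚ.*-identityʳ B))
    (upper-mono (suc m) p (ℕ.≤⇒≤′ (ℕ.z≤n {n})))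
  width-mono : ∀ {N n} → N ℕ.≤′ n → width p n ℚ.≤ width p N
  width-mono ℕ.≤′-refl = ℚ.≤-refl
  width-mono (ℕ.≤′-step {n} le) = ℚ.≤-trans
    (subst (width p (suc n) ℚ.≤_) (width-double p n) (p≤p+q (ℚ.<⇒≤ (width-pos p (suc n)))))
    (width-mono le)

-- The field 𝔽₂, with _xor_ as addition and _∧_ as multiplication.

𝔽₂ : Set
𝔽₂ = Bool

infix 9 𝔽₂^_

𝔽₂^_ : ℕ → Set
𝔽₂^ n = Vec 𝔽₂ n

tuples : ∀ {A : Set} → List⁺ A → ∀ k → List⁺ (Vec A k)
tuples as zero    = List⁺.[ [] ]
tuples as (suc k) = List⁺.concatMap (λ a → List⁺.map (a ∷_) (tuples as k)) as

-- All points of 𝔽₂ⁿ; equally, all subsets of Fin n, since Subset n = Vec Bool n.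

cube : ∀ n → List⁺ (𝔽₂^ n)
cube = tuples (false ∷ true ∷ [])

⨁ : ∀ {A : Set} → List⁺ A → (A → 𝔽₂) → 𝔽₂
⨁ xs f = foldr _xor_ false (map f (toList xs))

-- A multilinear polynomial assigns a coefficient to each monomial ∏_{i ∈ S} xᵢ.

Poly : ℕ → Set
Poly n = Subset n → 𝔽₂

monomial : ∀ {n} → Subset n → 𝔽₂^ n → 𝔽₂
monomial []          []      = true
monomial (true  ∷ S) (b ∷ x) = b ∧ monomial S x
monomial (false ∷ S) (b ∷ x) = monomial S x

eval : ∀ {n} → Poly n → 𝔽₂^ n → 𝔽₂
eval {n} p x = ⨁ (cube n) (λ S → p S ∧ monomial S x)

-- The zero polynomial is given degree 0.

degree : ∀ {n} → Poly n → ℕ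
degree {n} p = foldr ℕ._⊔_ 0 (map (λ S → if p S then ∣ S ∣ else 0) (toList (cube n)))

-- The polynomial representing f, from f (b , x) = f (0 , x) + b (f (0 , x) + f (1 , x));
-- eval-anf and anf-unique show that it is the only one.

anf : ∀ {n} → (𝔽₂^ n → 𝔽₂) → Poly n
anf f []          = f []
anf f (false ∷ S) = anf (λ x → f (false ∷ x)) S
anf f (true  ∷ S) = anf (λ x → f (false ∷ x) xor f (true ∷ x)) S

deg : ∀ {n} → (𝔽₂^ n → 𝔽₂) → ℕ
deg f = degree (anf f)

private
  toList-cube : ∀ n → toList (cube (suc n)) ≡
    map (false ∷_) (toList (cube n)) ++ map (true ∷_) (toList (cube n))
  toList-cube n = cong (map (false ∷_) (toList (cube n)) ++_) (List.++-identityʳ _)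

  ⨁ᴸ : ∀ {A : Set} → List A → (A → 𝔽₂) → 𝔽₂
  ⨁ᴸ xs f = foldr _xor_ false (map f xs)

  ⨁ᴸ-cong : ∀ {A : Set} (xs : List A) {f g : A → 𝔽₂} → f ≗ g → ⨁ᴸ xs f ≡ ⨁ᴸ xs g
  ⨁ᴸ-cong xs f≗g = cong (foldr _xor_ false) (List.map-cong f≗g xs)

  ⨁ᴸ-++ : ∀ {A : Set} (xs ys : List A) f → ⨁ᴸ (xs ++ ys) f ≡ ⨁ᴸ xs f xor ⨁ᴸ ys f
  ⨁ᴸ-++ []       ys f = refl
  ⨁ᴸ-++ (x ∷ xs) ys f = trans (cong (f x xor_) (⨁ᴸ-++ xs ys f))
                              (sym (Bool.xor-assoc (f x) (⨁ᴸ xs f) (⨁ᴸ ys f)))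

  ⨁ᴸ-map : ∀ {A B : Set} (g : A → B) xs f → ⨁ᴸ (map g xs) f ≡ ⨁ᴸ xs (f ∘ g)
  ⨁ᴸ-map g xs f = cong (foldr _xor_ false) (sym (List.map-∘ xs))

  ⨁ᴸ-false : ∀ {A : Set} (xs : List A) → ⨁ᴸ xs (λ _ → false) ≡ false
  ⨁ᴸ-false []       = refl
  ⨁ᴸ-false (x ∷ xs) = ⨁ᴸ-false xs

  tail-coefficients : ∀ {n} (p : Poly (suc n)) b x →
    ⨁ᴸ (toList (cube n)) (λ S → p (true ∷ S) ∧ (b ∧ monomial S x)) ≡ b ∧ eval (λ S → p (true ∷ S)) x
  tail-coefficients     p true  x = refl
  tail-coefficients {n} p false x = trans
    (⨁ᴸ-cong (toList (cube n)) (λ S → Bool.∧-zeroʳ (p (true ∷ S))))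
    (⨁ᴸ-false (toList (cube n)))

  eval-∷ : ∀ {n} (p : Poly (suc n)) b x →
           eval p (b ∷ x) ≡ eval (λ S → p (false ∷ S)) x xor (b ∧ eval (λ S → p (true ∷ S)) x)
  eval-∷ {n} p b x = begin
    ⨁ᴸ (toList (cube (suc n))) h
      ≡⟨ cong (λ ss → ⨁ᴸ ss h) (toList-cube n) ⟩
    ⨁ᴸ (map (false ∷_) ss ++ map (true ∷_) ss) h
      ≡⟨ ⨁ᴸ-++ (map (false ∷_) ss) (map (true ∷_) ss) h ⟩
    ⨁ᴸ (map (false ∷_) ss) h xor ⨁ᴸ (map (true ∷_) ss) h
      ≡⟨ cong₂ _xor_ (⨁ᴸ-map (false ∷_) ss h) (⨁ᴸ-map (true ∷_) ss h) ⟩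
    eval (λ S → p (false ∷ S)) x xor ⨁ᴸ ss (h ∘ (true ∷_))
      ≡⟨ cong (eval (λ S → p (false ∷ S)) x xor_) (tail-coefficients p b x) ⟩
    eval (λ S → p (false ∷ S)) x xor (b ∧ eval (λ S → p (true ∷ S)) x) ∎
    where
    open ≡-Reasoning
    ss = toList (cube n)
    h : Subset (suc n) → 𝔽₂
    h S = p S ∧ monomial S (b ∷ x)

  xor-cancelˡ : ∀ a {b c} → a xor b ≡ a xor c → b ≡ c
  xor-cancelˡ false eq = eq
  xor-cancelˡ true  eq = Bool.not-injective eq

eval-anf : ∀ {n} (f : 𝔽₂^ n → 𝔽₂) → eval (anf f) ≗ f
eval-anf f []      = trans (Bool.xor-identityʳ _) (Bool.∧-identityʳ (f []))
eval-anf f (b ∷ x) = trans (eval-∷ (anf f) b x)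
  (trans (cong₂ (λ u v → u xor (b ∧ v)) (eval-anf (λ x → f (false ∷ x)) x)
                                        (eval-anf (λ x → f (false ∷ x) xor f (true ∷ x)) x))
         (interpolate b (f (false ∷ x)) (f (true ∷ x)) refl refl))
  where
  interpolate : ∀ b u v → f (false ∷ x) ≡ u → f (true ∷ x) ≡ v → u xor (b ∧ (u xor v)) ≡ f (b ∷ x)
  interpolate false u     v eu ev = trans (Bool.xor-identityʳ u) (sym eu)
  interpolate true  false v eu ev = sym ev
  interpolate true  true  v eu ev = trans (Bool.not-involutive v) (sym ev)

private
  eval-injective : ∀ {n} (p q : Poly n) → eval p ≗ eval q → p ≗ q
  eval-injective p q eq [] = trans (sym (coeff p)) (trans (eq []) (coeff q))
    where
    coeff : ∀ (p : Poly 0) → eval p [] ≡ p []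
    coeff p = trans (Bool.xor-identityʳ _) (Bool.∧-identityʳ (p []))
  eval-injective {suc n} p q eq = go
    where
    at : ∀ b x → eval (λ S → p (false ∷ S)) x xor (b ∧ eval (λ S → p (true ∷ S)) x)
               ≡ eval (λ S → q (false ∷ S)) x xor (b ∧ eval (λ S → q (true ∷ S)) x)
    at b x = trans (sym (eval-∷ p b x)) (trans (eq (b ∷ x)) (eval-∷ q b x))
    eq₀ : eval (λ S → p (false ∷ S)) ≗ eval (λ S → q (false ∷ S))
    eq₀ x = trans (sym (Bool.xor-identityʳ _)) (trans (at false x) (Bool.xor-identityʳ _))
    eq₁ : eval (λ S → p (true ∷ S)) ≗ eval (λ S → q (true ∷ S))
    eq₁ x = xor-cancelˡ (eval (λ S → p (false ∷ S)) x)
              (trans (at true x) (cong (_xor eval (λ S → q (true ∷ S)) x) (sym (eq₀ x))))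
    go : p ≗ q
    go (false ∷ S) = eval-injective (λ S → p (false ∷ S)) (λ S → q (false ∷ S)) eq₀ S
    go (true  ∷ S) = eval-injective (λ S → p (true ∷ S)) (λ S → q (true ∷ S)) eq₁ S

anf-unique : ∀ {n} (f : 𝔽₂^ n → 𝔽₂) (p : Poly n) → eval p ≗ f → p ≗ anf f
anf-unique f p eq = eval-injective p (anf f) (λ x → trans (eq x) (sym (eval-anf f x)))

deg-cong : ∀ {n} {f g : 𝔽₂^ n → 𝔽₂} → f ≗ g → deg f ≡ deg g
deg-cong {n} {f} {g} f≗g = cong (foldr ℕ._⊔_ 0) (List.map-cong
  (λ S → cong (if_then ∣ S ∣ else 0) (anf-unique g (anf f) (λ x → trans (eval-anf f x) (f≗g x)) S))
  (toList (cube n)))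

Pr : ∀ {Ω : Set} {P : Pred Ω 0ℓ} → List⁺ Ω → Decidable P → ℚ
Pr ω@(_ ∷ _) P? = + length (filter P? (toList ω)) ℚ./ List⁺.length ω

-- functions-complete: every function occurs, up to pointwise equality.

functions : ∀ n → List (𝔽₂^ n → 𝔽₂)
functions zero    = const false ∷ const true ∷ []
functions (suc n) = cartesianProductWith glue (functions n) (functions n)
  where
  glue : (𝔽₂^ n → 𝔽₂) → (𝔽₂^ n → 𝔽₂) → 𝔽₂^ (suc n) → 𝔽₂
  glue f₀ f₁ (b ∷ x) = if b then f₁ x else f₀ x

dist : ∀ {n} → (𝔽₂^ n → 𝔽₂) → (𝔽₂^ n → 𝔽₂) → ℚ
dist {n} f g = Pr (cube n) (λ x → ¬? (f x Bool.≟ g x))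

-- The zero function, having degree 0, is always one of the candidates, so it
-- can also serve as the starting value of min.

δ : ∀ {n} → ℕ → (𝔽₂^ n → 𝔽₂) → ℚ
δ {n} d f = min (dist f (const false))
                (map (dist f) (filter (λ g → deg g ℕ.≤? d) (functions n)))

functions-complete : ∀ {n} (f : 𝔽₂^ n → 𝔽₂) → Any (f ≗_) (functions n)
functions-complete {zero} f with f [] in eq
... | false = here  (λ { [] → eq })
... | true  = there (here (λ { [] → eq }))
functions-complete {suc n} f = Any.cartesianProductWith⁺ _
  (λ f₀≗ f₁≗ → λ { (false ∷ x) → f₀≗ x ; (true ∷ x) → f₁≗ x })
  (functions-complete (λ x → f (false ∷ x)))
  (functions-complete (λ x → f (true ∷ x)))

private
  Pr-≐ : ∀ {Ω : Set} {P Q : Pred Ω 0ℓ} (ω : List⁺ Ω) (P? : Decidable P) (Q? : Decidable Q) →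
         P ≐ Q → Pr ω P? ≡ Pr ω Q?
  Pr-≐ ω@(_ ∷ xs) P? Q? P≐Q =
    cong (λ ys → + length ys ℚ./ suc (length xs)) (List.filter-≐ P? Q? P≐Q (toList ω))

  dist-congʳ : ∀ {n} (f : 𝔽₂^ n → 𝔽₂) {g h} → g ≗ h → dist f g ≡ dist f h
  dist-congʳ {n} f {g} {h} g≗h = Pr-≐ (cube n) (λ x → ¬? (f x Bool.≟ g x)) (λ x → ¬? (f x Bool.≟ h x))
    ( (λ {x} f≢g f≡h → f≢g (trans f≡h (sym (g≗h x))))
    , (λ {x} f≢h f≡g → f≢h (trans f≡g (g≗h x))))

  anf-false : ∀ {n} → anf {n} (const false) ≗ const false
  anf-false []          = refl
  anf-false (false ∷ S) = anf-false S
  anf-false (true  ∷ S) = anf-false S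

  deg-false : ∀ n → deg {n} (const false) ≡ 0
  deg-false n = trans
    (cong (foldr ℕ._⊔_ 0) (List.map-cong (λ S → cong (if_then ∣ S ∣ else 0) (anf-false S)) (toList (cube n))))
    (max-zeros (toList (cube n)))
    where
    max-zeros : ∀ (ss : List (Subset n)) → foldr ℕ._⊔_ 0 (map (const 0) ss) ≡ 0
    max-zeros []       = refl
    max-zeros (_ ∷ ss) = max-zeros ss

δ-attained : ∀ {n} d (f : 𝔽₂^ n → 𝔽₂) → ∃[ g ] (deg g ℕ.≤ d × δ d f ≡ dist f g)
δ-attained {n} d f = argmin-all (λ q → q) {P = λ q → ∃[ g ] (deg g ℕ.≤ d × q ≡ dist f g)}
  (const false , subst (ℕ._≤ d) (sym (deg-false n)) ℕ.z≤n , refl)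
  (All.map⁺ (All.map (λ {g} deg≤d → g , deg≤d , refl) (All.all-filter (λ g → deg g ℕ.≤? d) (functions n))))

δ-minimal : ∀ {n} d (f g : 𝔽₂^ n → 𝔽₂) → deg g ℕ.≤ d → δ d f ℚ.≤ dist f g
δ-minimal {n} d f g deg≤d = min≤v⁺ (dist f (const false)) _ (inj₂ (Any.map⁺ found))
  where
  near : ∀ {h} → g ≗ h → dist f h ℚ.≤ dist f g
  near g≗h = ℚ.≤-reflexive (sym (dist-congʳ f g≗h))
  found : Any (λ h → dist f h ℚ.≤ dist f g) (filter (λ h → deg h ℕ.≤? d) (functions n))
  found with Any.filter⁺ (λ h → deg h ℕ.≤? d) (functions-complete g)
  ... | inj₁ any = Any.map near any
  ... | inj₂ deg≰d = ⊥-elim (deg≰d (subst (ℕ._≤ d)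
    (deg-cong (Any.lookup-result (functions-complete g))) deg≤d))

infixl 6 _⊕_

_⊕_ : ∀ {n} → 𝔽₂^ n → 𝔽₂^ n → 𝔽₂^ n
_⊕_ = Vec.zipWith _xor_

subsetSum : ∀ {n k} → Subset k → Vec (𝔽₂^ n) k → 𝔽₂^ n
subsetSum []          []       = Vec.replicate _ false
subsetSum (true  ∷ J) (a ∷ as) = a ⊕ subsetSum J as
subsetSum (false ∷ J) (a ∷ as) = subsetSum J as

derivative : ∀ {n k} → (𝔽₂^ n → 𝔽₂) → Vec (𝔽₂^ n) k → 𝔽₂^ n → 𝔽₂
derivative {k = k} f as x = ⨁ (cube k) (λ J → f (x ⊕ subsetSum J as))

-- The random choices of the test are a point x and directions a₁ , … , aₖ.

Accepts : ∀ {n} k → (𝔽₂^ n → 𝔽₂) → Pred (Vec (𝔽₂^ n) (suc k)) 0ℓ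
Accepts k f (x ∷ as) = derivative f as x ≡ false

accepts? : ∀ {n} k (f : 𝔽₂^ n → 𝔽₂) → Decidable (Accepts k f)
accepts? k f (x ∷ as) = derivative f as x Bool.≟ false

Pr[accepts] Pr[rejects] : ∀ {n} → ℕ → (𝔽₂^ n → 𝔽₂) → ℚ
Pr[accepts] {n} k f = Pr (tuples (cube n) (suc k)) (accepts? k f)
Pr[rejects] {n} k f = Pr (tuples (cube n) (suc k)) (¬? ∘ accepts? k f)

-- For k ≥ 1 the difference is nonnegative, being an average of squares.

‖_‖U^_ : ∀ {n} → (𝔽₂^ n → 𝔽₂) → ℕ → ℝ
‖ f ‖U^ k = root (2 ℕ.^ k) (Pr[accepts] k f ℚ.- Pr[rejects] k f)

module Submission where

-- A function has degree at most d exactly when its k-fold derivatives vanish, k = d + 1, and a set of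
-- density δ meets a random k-dimensional parallelepiped with odd multiplicity with probability about
-- 2ᵏ δ as long as δ is below 2⁻ᵏ. So it suffices to show that a function rejected with probability below
-- an absolute constant is that close to degree d. This goes by induction on n. The rejection probability is
-- at least its average over hyperplanes. If few restrictions to hyperplanes are close to degree d, the
-- average loses only a factor 1 - O (2ᵏ⁻ⁿ), and these factors have a convergent product. If many are, then the
-- nearby polynomials agree on intersections, glue to one global polynomial along k independent
-- hyperplanes, and by Parseval that polynomial is close to f. The induction starts at n = k + O (1), where any
-- function of degree above d is rejected with constant probability. Finally, 1 - 2 ρ = ‖ f ‖^(2ᵏ), so
-- Bernoulli's inequality compares 2ᵏ (1 - ‖ f ‖) with the rejection probability ρ.

open import Data.Bool.Base using (Bool; true; false; not; _∧_; _∨_; _xor_; if_then_else_)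
import Data.Bool.Properties as Bool
open import Data.Bool.Solver using (module xor-∧-Solver)
open import Data.Empty using (⊥-elim)
import Data.Integer.Base as ℤ
import Data.Integer.Properties as ℤ
open import Data.List.Base using (List; []; _∷_; _++_; map; filter; foldr; length; concat)
open import Data.List.Membership.Propositional using (_∈_)
open import Data.List.Membership.Propositional.Properties
open import Data.List.NonEmpty as List⁺ using (List⁺; _∷_; toList)
import Data.List.Properties as List
open import Data.List.Relation.Unary.All as All using (All; []; _∷_)
open import Data.List.Relation.Unary.Any using (here; there)
open import Data.Nat.Base as ℕ using (ℕ; zero; suc)
import Data.Nat.Properties as ℕ
open import Data.Nat.Tactic.RingSolver using (solve-∀)
open import Data.Product using (∃-syntax; _×_; _,_; proj₁; proj₂; ∃)
import Data.Rational.Base as ℚ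
import Data.Rational.Properties as ℚ
open import Data.Rational.Base using (ℚ; 0ℚ; 1ℚ; ½)
open import Data.Rational.Solver using (module +-*-Solver)
import Data.Rational.Unnormalised.Base as ℚᵘ
import Data.Rational.Unnormalised.Properties as ℚᵘ
open import Data.Sum.Base using (_⊎_; inj₁; inj₂)
open import Data.Vec.Base as Vec using (Vec; []; _∷_)
import Data.Vec.Properties as Vec
open import Function.Base using (_∘_; const)
open import Level using (0ℓ)
open import Relation.Binary.PropositionalEquality
open import Relation.Nullary using (Dec; yes; no; does; ¬_; ¬?)
open import Relation.Nullary.Decidable using (from-yes)
open import Relation.Unary using (Pred; Decidable)

-- The difficulty is uniformity in `d`: distance and norm deficit have to be compared up to
-- constants that do not see 2ᵏ. The hypothesis keeps 2ᵏ (1 - ‖ f ‖) below a constant, and in that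
-- range Bernoulli's inequality can be reversed up to a factor 2. In the induction, closeness is
-- measured in units of 2⁻ᵏ with two thresholds: `closeᵇ` demands distance at most 2⁻ᵏ / 4, while
-- the second-moment bound `#≤R` works up to 2⁻ᵏ / 2. Gluing may therefore lose a factor 2 without
-- harm, because a function between the thresholds is rejected with constant probability outright;
-- the loss never accumulates over the dimensions. Degree enters only through vanishing derivatives,
-- a notion invariant under affine substitution, so that restricting to a hyperplane and projecting
-- onto it cost nothing. Counts are natural numbers with denominators cleared and negative terms
-- moved across.

module Combinatorics where

  open import Data.Fin.Subset using (Subset; ∣_∣)
  open import Data.Nat.Base using (_+_; _*_; _∸_; _^_; _⊔_; _≤_; _<_; z≤n; s≤s; NonZero; ≢-nonZero)
  open import Data.Nat.Properties
  open xor-∧-Solver using (solve; _:=_; _:+_; _:*_; con)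
  open import Defs using (𝔽₂; 𝔽₂^_; _⊕_; cube; anf; deg; tuples; subsetSum; derivative; Pr; Pr[accepts]; Pr[rejects]; accepts?; dist; δ; δ-attained; δ-minimal)

  -- Sums over the cube

  𝟎 : ∀ {n} → 𝔽₂^ n
  𝟎 = Vec.replicate _ false

  ⊕-assoc : ∀ {n} (x y z : 𝔽₂^ n) → (x ⊕ y) ⊕ z ≡ x ⊕ (y ⊕ z)
  ⊕-assoc = Vec.zipWith-assoc Bool.xor-assoc

  ⊕-comm : ∀ {n} (x y : 𝔽₂^ n) → x ⊕ y ≡ y ⊕ x
  ⊕-comm = Vec.zipWith-comm Bool.xor-comm

  ⊕-identityʳ : ∀ {n} (x : 𝔽₂^ n) → x ⊕ 𝟎 ≡ x
  ⊕-identityʳ = Vec.zipWith-identityʳ Bool.xor-identityʳ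

  ⊕-identityˡ : ∀ {n} (x : 𝔽₂^ n) → 𝟎 ⊕ x ≡ x
  ⊕-identityˡ = Vec.zipWith-identityˡ Bool.xor-identityˡ

  ⊕-same : ∀ {n} (x : 𝔽₂^ n) → x ⊕ x ≡ 𝟎
  ⊕-same []      = refl
  ⊕-same (b ∷ x) = cong₂ _∷_ (Bool.xor-same b) (⊕-same x)

  ⊕-cancelʳ : ∀ {n} (x y : 𝔽₂^ n) → (x ⊕ y) ⊕ y ≡ x
  ⊕-cancelʳ x y = trans (⊕-assoc x y y) (trans (cong (x ⊕_) (⊕-same y)) (⊕-identityʳ x))

  ⊕-swapʳ : ∀ {n} (x y z : 𝔽₂^ n) → (x ⊕ y) ⊕ z ≡ (x ⊕ z) ⊕ y
  ⊕-swapʳ x y z = trans (⊕-assoc x y z) (trans (cong (x ⊕_) (⊕-comm y z)) (sym (⊕-assoc x z y)))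

  ⊕-medial : ∀ {n} (x y z w : 𝔽₂^ n) → (x ⊕ y) ⊕ (z ⊕ w) ≡ (x ⊕ z) ⊕ (y ⊕ w)
  ⊕-medial x y z w = trans (sym (⊕-assoc (x ⊕ y) z w))
    (trans (cong (_⊕ w) (⊕-swapʳ x y z)) (⊕-assoc (x ⊕ z) y w))

  ⟦_⟧ : Bool → ℕ
  ⟦ true  ⟧ = 1
  ⟦ false ⟧ = 0

  ∑ : ∀ {n} → (𝔽₂^ n → ℕ) → ℕ
  ∑ {zero}  φ = φ []
  ∑ {suc n} φ = ∑ (λ x → φ (false ∷ x)) + ∑ (λ x → φ (true ∷ x))

  # : ∀ {n} → (𝔽₂^ n → 𝔽₂) → ℕ
  # f = ∑ (λ x → ⟦ f x ⟧)

  -- Reduces a polynomial consequence of l ≤ r to a semiring identity with slack σ.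
  ≤-cert : ∀ {l r A B} σ → l ≤ r → B + l ≡ A + r + σ → A ≤ B
  ≤-cert {l} {r} {A} {B} σ l≤r eq = +-cancelʳ-≤ r A B (begin
    A + r      ≤⟨ m≤m+n (A + r) σ ⟩
    A + r + σ  ≡⟨ sym eq ⟩
    B + l      ≤⟨ +-monoʳ-≤ B l≤r ⟩
    B + r      ∎)
    where open ≤-Reasoning

  ∑-cong : ∀ {n} {φ ψ : 𝔽₂^ n → ℕ} → (∀ x → φ x ≡ ψ x) → ∑ φ ≡ ∑ ψ
  ∑-cong {zero}  eq = eq []
  ∑-cong {suc n} eq = cong₂ _+_ (∑-cong (λ x → eq (false ∷ x))) (∑-cong (λ x → eq (true ∷ x)))

  ∑-mono : ∀ {n} {φ ψ : 𝔽₂^ n → ℕ} → (∀ x → φ x ≤ ψ x) → ∑ φ ≤ ∑ ψ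
  ∑-mono {zero}  le = le []
  ∑-mono {suc n} le = +-mono-≤ (∑-mono (λ x → le (false ∷ x))) (∑-mono (λ x → le (true ∷ x)))

  ∑-+ : ∀ {n} (φ ψ : 𝔽₂^ n → ℕ) → ∑ (λ x → φ x + ψ x) ≡ ∑ φ + ∑ ψ
  ∑-+ {zero}  φ ψ = refl
  ∑-+ {suc n} φ ψ = trans
    (cong₂ _+_ (∑-+ (λ x → φ (false ∷ x)) (λ x → ψ (false ∷ x))) (∑-+ (λ x → φ (true ∷ x)) (λ x → ψ (true ∷ x))))
    (medial (∑ (λ x → φ (false ∷ x))) (∑ (λ x → ψ (false ∷ x))) (∑ (λ x → φ (true ∷ x))) (∑ (λ x → ψ (true ∷ x))))
    where
    medial : ∀ a b c d → a + b + (c + d) ≡ a + c + (b + d)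
    medial = solve-∀

  ∑-* : ∀ {n} c (φ : 𝔽₂^ n → ℕ) → ∑ (λ x → c * φ x) ≡ c * ∑ φ
  ∑-* {zero}  c φ = refl
  ∑-* {suc n} c φ = trans (cong₂ _+_ (∑-* c (λ x → φ (false ∷ x))) (∑-* c (λ x → φ (true ∷ x))))
    (sym (*-distribˡ-+ c (∑ (λ x → φ (false ∷ x))) (∑ (λ x → φ (true ∷ x)))))

  ∑-const : ∀ n c → ∑ {n} (const c) ≡ 2 ^ n * c
  ∑-const zero    c = sym (+-identityʳ c)
  ∑-const (suc n) c = trans (cong₂ _+_ (∑-const n c) (∑-const n c)) (double (2 ^ n) c)
    where
    double : ∀ a c → a * c + a * c ≡ 2 * a * c
    double = solve-∀

  ∑-swap : ∀ {m n} (φ : 𝔽₂^ m → 𝔽₂^ n → ℕ) → ∑ (λ x → ∑ (λ y → φ x y)) ≡ ∑ (λ y → ∑ (λ x → φ x y))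
  ∑-swap {zero}  φ = refl
  ∑-swap {suc m} φ = trans
    (cong₂ _+_ (∑-swap (λ x → φ (false ∷ x))) (∑-swap (λ x → φ (true ∷ x))))
    (sym (∑-+ (λ y → ∑ (λ x → φ (false ∷ x) y)) (λ y → ∑ (λ x → φ (true ∷ x) y))))

  ∑-translate : ∀ {n} (a : 𝔽₂^ n) (φ : 𝔽₂^ n → ℕ) → ∑ (λ x → φ (x ⊕ a)) ≡ ∑ φ
  ∑-translate []          φ = refl
  ∑-translate (false ∷ a) φ = cong₂ _+_ (∑-translate a (λ x → φ (false ∷ x))) (∑-translate a (λ x → φ (true ∷ x)))
  ∑-translate (true  ∷ a) φ = trans
    (cong₂ _+_ (∑-translate a (λ x → φ (true ∷ x))) (∑-translate a (λ x → φ (false ∷ x))))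
    (+-comm (∑ (λ x → φ (true ∷ x))) (∑ (λ x → φ (false ∷ x))))

  ⟦⟧² : ∀ b → ⟦ b ⟧ * ⟦ b ⟧ ≡ ⟦ b ⟧
  ⟦⟧² true  = refl
  ⟦⟧² false = refl

  ∧-right : ∀ p {q} → p ∧ q ≡ true → q ≡ true
  ∧-right true eq = eq

  #-true : ∀ n → # {n} (const true) ≡ 2 ^ n
  #-true n = trans (∑-const n 1) (*-identityʳ (2 ^ n))

  -- `Q` need not be the negation of `P`: a failing universal statement yields explicit evidence,
  -- which is how nonvanishing derivatives come with their directions.
  search : ∀ {n} {P Q : 𝔽₂^ n → Set} → (∀ x → P x ⊎ Q x) → (∀ x → P x) ⊎ ∃ Q
  search {zero} d with d []
  ... | inj₁ p = inj₁ (λ { [] → p })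
  ... | inj₂ q = inj₂ ([] , q)
  search {suc n} d with search (λ x → d (false ∷ x)) | search (λ x → d (true ∷ x))
  ... | inj₂ (x , q) | _            = inj₂ (false ∷ x , q)
  ... | inj₁ _       | inj₂ (x , q) = inj₂ (true ∷ x , q)
  ... | inj₁ p       | inj₁ p′      = inj₁ (λ { (false ∷ x) → p x ; (true ∷ x) → p′ x })

  true? : ∀ b → b ≡ false ⊎ b ≡ true
  true? false = inj₁ refl
  true? true  = inj₂ refl

  #-positive : ∀ {n} (f : 𝔽₂^ n → 𝔽₂) → 0 < # f → ∃[ x ] f x ≡ true
  #-positive {n} f 0<#f with search (λ x → true? (f x))
  ... | inj₂ found = found
  ... | inj₁ f≡0   = ⊥-elim (<-irrefl refl (begin-strict
    0                  <⟨ 0<#f ⟩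
    # f                ≡⟨ ∑-cong (λ x → cong ⟦_⟧ (f≡0 x)) ⟩
    ∑ {n} (const 0)    ≡⟨ ∑-const n 0 ⟩
    2 ^ n * 0          ≡⟨ *-zeroʳ (2 ^ n) ⟩
    0                  ∎))
    where open ≤-Reasoning

  -- Derivatives

  D : ∀ {n} → 𝔽₂^ n → (𝔽₂^ n → 𝔽₂) → 𝔽₂^ n → 𝔽₂
  D a f x = f x xor f (x ⊕ a)

  D* : ∀ {n k} → Vec (𝔽₂^ n) k → (𝔽₂^ n → 𝔽₂) → 𝔽₂^ n → 𝔽₂
  D* []       f = f
  D* (a ∷ as) f = D* as (D a f)

  -- Null (suc d) f says that f has degree at most d.
  data Null {n} : ℕ → (𝔽₂^ n → 𝔽₂) → Set where
    zero : ∀ {f} → (∀ x → f x ≡ false) → Null zero f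
    suc  : ∀ {k f} → (∀ a → Null k (D a f)) → Null (suc k) f

  vanishes : ∀ {n} {f : 𝔽₂^ n → 𝔽₂} → Null zero f → ∀ x → f x ≡ false
  vanishes (zero f≡0) = f≡0

  D-null : ∀ {n k} {f : 𝔽₂^ n → 𝔽₂} → Null (suc k) f → ∀ a → Null k (D a f)
  D-null (suc null) = null

  -- The k-th Gowers norm test rejects f with probability R k f / 2 ^ (n * (k + 1)).
  R : ∀ {n} → ℕ → (𝔽₂^ n → 𝔽₂) → ℕ
  R zero    f = # f
  R (suc k) f = ∑ (λ a → R k (D a f))

  _⊞_ : ∀ {n} → (𝔽₂^ n → 𝔽₂) → (𝔽₂^ n → 𝔽₂) → 𝔽₂^ n → 𝔽₂
  (f ⊞ g) x = f x xor g x

  D-cong : ∀ {n} (a : 𝔽₂^ n) {f g : 𝔽₂^ n → 𝔽₂} → f ≗ g → D a f ≗ D a g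
  D-cong a f≗g x = cong₂ _xor_ (f≗g x) (f≗g (x ⊕ a))

  D-⊞ : ∀ {n} (a : 𝔽₂^ n) (f g : 𝔽₂^ n → 𝔽₂) → D a (f ⊞ g) ≗ D a f ⊞ D a g
  D-⊞ a f g x = solve 4 (λ p q r s → (p :+ q) :+ (r :+ s) := (p :+ r) :+ (q :+ s)) refl
    (f x) (g x) (f (x ⊕ a)) (g (x ⊕ a))

  D-comm : ∀ {n} (a b : 𝔽₂^ n) (f : 𝔽₂^ n → 𝔽₂) → D a (D b f) ≗ D b (D a f)
  D-comm a b f x = trans
    (cong (λ y → D b f x xor (f (x ⊕ a) xor f y)) (⊕-swapʳ x a b))
    (solve 4 (λ p q r s → (p :+ q) :+ (r :+ s) := (p :+ r) :+ (q :+ s)) refl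
      (f x) (f (x ⊕ b)) (f (x ⊕ a)) (f ((x ⊕ b) ⊕ a)))

  -- The cocycle identity: it extends invariance under single directions to invariance under their
  -- span.
  D-⊕ : ∀ {n} (a b : 𝔽₂^ n) (f : 𝔽₂^ n → 𝔽₂) x → D (a ⊕ b) f x ≡ D a f x xor D b f (x ⊕ a)
  D-⊕ a b f x = trans (cong (λ y → f x xor f y) (sym (⊕-assoc x a b)))
    (solve 3 (λ p q r → p :+ r := (p :+ q) :+ (q :+ r)) refl (f x) (f (x ⊕ a)) (f ((x ⊕ a) ⊕ b)))

  D-𝟎 : ∀ {n} (f : 𝔽₂^ n → 𝔽₂) x → D 𝟎 f x ≡ false
  D-𝟎 f x = trans (cong (λ y → f x xor f y) (⊕-identityʳ x)) (Bool.xor-same (f x))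

  D-D : ∀ {n} (a : 𝔽₂^ n) (f : 𝔽₂^ n → 𝔽₂) x → D a (D a f) x ≡ false
  D-D a f x = trans (cong (λ y → (f x xor f (x ⊕ a)) xor (f (x ⊕ a) xor f y)) (⊕-cancelʳ x a))
    (solve 2 (λ p q → (p :+ q) :+ (q :+ p) := con false) refl (f x) (f (x ⊕ a)))

  R-cong : ∀ {n} k {f g : 𝔽₂^ n → 𝔽₂} → f ≗ g → R k f ≡ R k g
  R-cong zero    f≗g = ∑-cong (λ x → cong ⟦_⟧ (f≗g x))
  R-cong (suc k) f≗g = ∑-cong (λ a → R-cong k (D-cong a f≗g))

  Null-cong : ∀ {n k} {f g : 𝔽₂^ n → 𝔽₂} → f ≗ g → Null k f → Null k g
  Null-cong f≗g (zero nf) = zero (λ x → trans (sym (f≗g x)) (nf x))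
  Null-cong f≗g (suc nf)  = suc (λ a → Null-cong (D-cong a f≗g) (nf a))

  Null-⊞ : ∀ {n k} {f g : 𝔽₂^ n → 𝔽₂} → Null k f → Null k g → Null k (f ⊞ g)
  Null-⊞ (zero nf) (zero ng) = zero (λ x → cong₂ _xor_ (nf x) (ng x))
  Null-⊞ {f = f} {g} (suc nf) (suc ng) = suc (λ a → Null-cong (λ x → sym (D-⊞ a f g x)) (Null-⊞ (nf a) (ng a)))

  -- λ′ is the linear part of φ.
  Null-∘ : ∀ {m n k} {f : 𝔽₂^ n → 𝔽₂} (φ : 𝔽₂^ m → 𝔽₂^ n) (λ′ : 𝔽₂^ m → 𝔽₂^ n) →
           (∀ x a → φ (x ⊕ a) ≡ φ x ⊕ λ′ a) → Null k f → Null k (f ∘ φ)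
  Null-∘         φ λ′ affine (zero nf) = zero (λ x → nf (φ x))
  Null-∘ {f = f} φ λ′ affine (suc nf)  = suc (λ a → Null-cong
    (λ x → cong (λ y → f (φ x) xor f y) (sym (affine x a)))
    (Null-∘ φ λ′ affine (nf (λ′ a))))

  Null-translate : ∀ {n k} {f : 𝔽₂^ n → 𝔽₂} a → Null k f → Null k (λ x → f (x ⊕ a))
  Null-translate a = Null-∘ (_⊕ a) (λ b → b) (λ x b → ⊕-swapʳ x b a)

  Null-suc : ∀ {n k} {f : 𝔽₂^ n → 𝔽₂} → Null k f → Null (suc k) f
  Null-suc (zero nf) = suc (λ a → zero (λ x → cong₂ _xor_ (nf x) (nf (x ⊕ a))))
  Null-suc (suc nf)  = suc (λ a → Null-suc (nf a))

  Null-≤ : ∀ {n k l} {f : 𝔽₂^ n → 𝔽₂} → k ≤ l → Null k f → Null l f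
  Null-≤ {l = zero}  z≤n       null       = null
  Null-≤ {l = suc l} z≤n       null       = Null-suc (Null-≤ z≤n null)
  Null-≤             (s≤s k≤l) (suc null) = suc (λ a → Null-≤ k≤l (null a))

  Null-D* : ∀ {n k} (as : Vec (𝔽₂^ n) k) {f : 𝔽₂^ n → 𝔽₂} → Null k f → ∀ x → D* as f x ≡ false
  Null-D* []       (zero null) = null
  Null-D* (a ∷ as) (suc null)  = Null-D* as (null a)

  -- The positive form of failing `Null`; `#Flat≤` recurses along the witnessing directions.
  NonNull : ∀ {n} → ℕ → (𝔽₂^ n → 𝔽₂) → Set
  NonNull {n} k f = ∃[ as ] ∃[ x ] D* {n} {k} as f x ≡ true

  null-or-nonNull : ∀ {n} k (f : 𝔽₂^ n → 𝔽₂) → Null k f ⊎ NonNull k f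
  null-or-nonNull zero f with search (λ x → true? (f x))
  ... | inj₁ f≡0     = inj₁ (zero f≡0)
  ... | inj₂ (x , p) = inj₂ ([] , x , p)
  null-or-nonNull (suc k) f with search (λ a → null-or-nonNull k (D a f))
  ... | inj₁ null              = inj₁ (suc null)
  ... | inj₂ (a , as , x , p)  = inj₂ (a ∷ as , x , p)

  Null⇒¬NonNull : ∀ {n} k {f : 𝔽₂^ n → 𝔽₂} → Null k f → ¬ NonNull k f
  Null⇒¬NonNull k null (as , x , p) with trans (sym p) (Null-D* as null x)
  ... | ()

  null? : ∀ {n} k (f : 𝔽₂^ n → 𝔽₂) → Dec (Null k f)
  null? k f with null-or-nonNull k f
  ... | inj₁ null    = yes null
  ... | inj₂ nonNull = no (λ null → Null⇒¬NonNull k null nonNull)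

  xor≡false : ∀ {p q} → p xor q ≡ false → p ≡ q
  xor≡false {false} {false} _ = refl
  xor≡false {true}  {true}  _ = refl

  #D≤2# : ∀ {n} (a : 𝔽₂^ n) f → # (D a f) ≤ 2 * # f
  #D≤2# a f = begin
    # (D a f)                            ≤⟨ ∑-mono (λ x → subadditive (f x) (f (x ⊕ a))) ⟩
    ∑ (λ x → ⟦ f x ⟧ + ⟦ f (x ⊕ a) ⟧)    ≡⟨ ∑-+ (λ x → ⟦ f x ⟧) (λ x → ⟦ f (x ⊕ a) ⟧) ⟩
    # f + # (λ x → f (x ⊕ a))            ≡⟨ cong (# f +_) (∑-translate a (λ x → ⟦ f x ⟧)) ⟩
    # f + # f                            ≡⟨ cong (# f +_) (sym (+-identityʳ (# f))) ⟩
    2 * # f                              ∎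
    where
    open ≤-Reasoning
    subadditive : ∀ p q → ⟦ p xor q ⟧ ≤ ⟦ p ⟧ + ⟦ q ⟧
    subadditive false q     = ≤-refl
    subadditive true  false = ≤-refl
    subadditive true  true  = z≤n

  -- Minimum distance of Reed-Muller codes. A nonvanishing derivative has order one less and at most
  -- twice the support; if every derivative vanishes, `f` is constantly true.
  min-distance : ∀ {n} m (f : 𝔽₂^ n → 𝔽₂) → Null m f → ∀ x → f x ≡ true → 2 * 2 ^ n ≤ 2 ^ m * # f
  min-distance zero    f null x fx with trans (sym fx) (vanishes null x)
  ... | ()
  min-distance {n} (suc m) f null x fx with search (λ a → search (λ y → true? (D a f y)))
  ... | inj₂ (a , y , Dfy) = begin
    2 * 2 ^ n            ≤⟨ min-distance m (D a f) (D-null null a) y Dfy ⟩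
    2 ^ m * # (D a f)    ≤⟨ *-monoʳ-≤ (2 ^ m) (#D≤2# a f) ⟩
    2 ^ m * (2 * # f)    ≡⟨ trans (sym (*-assoc (2 ^ m) 2 (# f))) (cong (_* # f) (*-comm (2 ^ m) 2)) ⟩
    2 ^ suc m * # f      ∎
    where open ≤-Reasoning
  ... | inj₁ D≡0 = begin
    2 * 2 ^ n          ≤⟨ *-monoˡ-≤ (2 ^ n) (*-monoʳ-≤ 2 (m^n>0 2 m)) ⟩
    2 ^ suc m * 2 ^ n  ≡⟨ cong (2 ^ suc m *_) (sym (trans (∑-cong (λ y → cong ⟦_⟧ (f≡1 y))) (#-true n))) ⟩
    2 ^ suc m * # f    ∎
    where
    open ≤-Reasoning
    f≡1 : ∀ y → f y ≡ true
    f≡1 y = trans (cong f (sym cancel)) (trans (sym (xor≡false (D≡0 (x ⊕ y) x))) fx)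
      where
      cancel : x ⊕ (x ⊕ y) ≡ y
      cancel = trans (⊕-comm x (x ⊕ y)) (trans (cong (_⊕ x) (⊕-comm x y)) (⊕-cancelʳ y x))

  -- Functions close to low degree

  R-⊞ : ∀ {n k} (f : 𝔽₂^ n → 𝔽₂) {p} → Null k p → R k (f ⊞ p) ≡ R k f
  R-⊞ f (zero null)    = ∑-cong (λ x → cong ⟦_⟧ (trans (cong (f x xor_) (null x)) (Bool.xor-identityʳ (f x))))
  R-⊞ {k = suc k} f {p} (suc null) = ∑-cong (λ a → trans (R-cong k (D-⊞ a f p)) (R-⊞ (D a f) (null a)))

  -- A is the integer-valued counterpart of D: iterating it sums u over a parallelepiped, and
  -- M and Q are the first and second moments of these sums.
  A : ∀ {n} → 𝔽₂^ n → (𝔽₂^ n → ℕ) → 𝔽₂^ n → ℕ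
  A a u x = u x + u (x ⊕ a)

  M Q : ∀ {n} → ℕ → (𝔽₂^ n → ℕ) → ℕ
  M zero    u = ∑ u
  M (suc k) u = ∑ (λ a → M k (A a u))
  Q zero    u = ∑ (λ x → u x * u x)
  Q (suc k) u = ∑ (λ a → Q k (A a u))

  ∑-A : ∀ {n} (a : 𝔽₂^ n) u → ∑ (A a u) ≡ 2 * ∑ u
  ∑-A a u = trans (∑-+ u (λ x → u (x ⊕ a)))
    (cong (∑ u +_) (trans (∑-translate a u) (sym (+-identityʳ (∑ u)))))

  -- Each of the 2ᵏ vertices of a random parallelepiped is uniformly distributed.
  M≡ : ∀ {n} k (u : 𝔽₂^ n → ℕ) → M k u ≡ 2 ^ k * (2 ^ n) ^ k * ∑ u
  M≡     zero    u = sym (+-identityʳ (∑ u))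
  M≡ {n} (suc k) u = begin
    ∑ (λ a → M k (A a u))                                ≡⟨ ∑-cong (λ a → trans (M≡ k (A a u)) (cong (2 ^ k * (2 ^ n) ^ k *_) (∑-A a u))) ⟩
    ∑ {n} (λ _ → 2 ^ k * (2 ^ n) ^ k * (2 * ∑ u))        ≡⟨ ∑-const n _ ⟩
    2 ^ n * (2 ^ k * (2 ^ n) ^ k * (2 * ∑ u))            ≡⟨ arrange (2 ^ n) (2 ^ k) ((2 ^ n) ^ k) (∑ u) ⟩
    2 ^ suc k * (2 ^ n) ^ suc k * ∑ u                    ∎
    where
    open ≡-Reasoning
    arrange : ∀ v t w s → v * (t * w * (2 * s)) ≡ 2 * t * (v * w) * s
    arrange = solve-∀

  -- When the square is expanded, the two diagonal terms contribute equally, and the cross term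
  -- factorises because `x` and `x ⊕ a` are independent.
  ∑∑-A² : ∀ {n} (u : 𝔽₂^ n → ℕ) →
          ∑ (λ a → ∑ (λ x → A a u x * A a u x)) ≡ 2 * (2 ^ n * ∑ (λ x → u x * u x)) + 2 * (∑ u * ∑ u)
  ∑∑-A² {n} u = begin
    ∑ (λ a → ∑ (λ x → A a u x * A a u x))
      ≡⟨ ∑-cong (λ a → ∑-cong (λ x → square (u x) (u (x ⊕ a)))) ⟩
    ∑ (λ a → ∑ (λ x → u x * u x + u (x ⊕ a) * u (x ⊕ a) + 2 * (u x * u (x ⊕ a))))
      ≡⟨ ∑-cong (λ a → trans (∑-+ _ (λ x → 2 * (u x * u (x ⊕ a))))
           (cong₂ _+_ (∑-A a (λ x → u x * u x)) (∑-* 2 (λ x → u x * u (x ⊕ a))))) ⟩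
    ∑ (λ a → 2 * q + 2 * ∑ (λ x → u x * u (x ⊕ a)))
      ≡⟨ trans (∑-+ (λ _ → 2 * q) (λ a → 2 * ∑ (λ x → u x * u (x ⊕ a))))
           (cong₂ _+_ (trans (∑-const n (2 * q)) (swap (2 ^ n) q)) (∑-* 2 (λ a → ∑ (λ x → u x * u (x ⊕ a))))) ⟩
    2 * (2 ^ n * q) + 2 * ∑ (λ a → ∑ (λ x → u x * u (x ⊕ a)))
      ≡⟨ cong (λ t → 2 * (2 ^ n * q) + 2 * t) correlation ⟩
    2 * (2 ^ n * q) + 2 * (∑ u * ∑ u) ∎
    where
    open ≡-Reasoning
    q = ∑ (λ x → u x * u x)
    square : ∀ p r → (p + r) * (p + r) ≡ p * p + r * r + 2 * (p * r)
    square = solve-∀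
    swap : ∀ v q → v * (2 * q) ≡ 2 * (v * q)
    swap = solve-∀
    correlation : ∑ (λ a → ∑ (λ x → u x * u (x ⊕ a))) ≡ ∑ u * ∑ u
    correlation = begin
      ∑ (λ a → ∑ (λ x → u x * u (x ⊕ a)))    ≡⟨ ∑-swap (λ a x → u x * u (x ⊕ a)) ⟩
      ∑ (λ x → ∑ (λ a → u x * u (x ⊕ a)))    ≡⟨ ∑-cong (λ x → trans (∑-* (u x) (λ a → u (x ⊕ a)))
                                                  (cong (u x *_) (trans (∑-cong (λ a → cong u (⊕-comm x a))) (∑-translate x u)))) ⟩
      ∑ (λ x → u x * ∑ u)                    ≡⟨ ∑-cong (λ x → *-comm (u x) (∑ u)) ⟩
      ∑ (λ x → ∑ u * u x)                    ≡⟨ ∑-* (∑ u) u ⟩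
      ∑ u * ∑ u                              ∎

  -- Distinct vertices of a random parallelepiped are pairwise independent; the terms are moved
  -- across so that no subtraction occurs.
  Q≡ : ∀ {n} k (u : 𝔽₂^ n → ℕ) →
       2 ^ n * Q k u + 2 ^ k * (2 ^ n) ^ k * (∑ u * ∑ u) ≡
       2 ^ k * (2 ^ n) ^ k * (2 ^ n * ∑ (λ x → u x * u x)) + 2 ^ k * 2 ^ k * (2 ^ n) ^ k * (∑ u * ∑ u)
  Q≡ {n} zero u = cong (_+ 1 * (∑ u * ∑ u)) (sym (*-identityˡ (2 ^ n * ∑ (λ x → u x * u x))))
  Q≡ {n} (suc k) u = step (2 ^ n) (2 ^ k) ((2 ^ n) ^ k) (∑ (λ a → Q k (A a u))) (∑ (λ x → u x * u x)) (∑ u) (begin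
    v * ∑ (λ a → Q k (A a u)) + t * w * (v * (2 * ∑ u * (2 * ∑ u)))
      ≡⟨ sym (cong₂ _+_ (∑-* v (λ a → Q k (A a u)))
           (trans (∑-* (t * w) (λ a → ∑ (A a u) * ∑ (A a u)))
             (cong (t * w *_) (trans (∑-cong (λ a → cong₂ _*_ (∑-A a u) (∑-A a u))) (∑-const n _))))) ⟩
    ∑ (λ a → v * Q k (A a u)) + ∑ (λ a → t * w * (∑ (A a u) * ∑ (A a u)))
      ≡⟨ sym (∑-+ (λ a → v * Q k (A a u)) (λ a → t * w * (∑ (A a u) * ∑ (A a u)))) ⟩
    ∑ (λ a → v * Q k (A a u) + t * w * (∑ (A a u) * ∑ (A a u)))
      ≡⟨ ∑-cong (λ a → Q≡ k (A a u)) ⟩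
    ∑ (λ a → t * w * (v * ∑ (λ x → A a u x * A a u x)) + t * t * w * (∑ (A a u) * ∑ (A a u)))
      ≡⟨ ∑-+ (λ a → t * w * (v * ∑ (λ x → A a u x * A a u x))) _ ⟩
    ∑ (λ a → t * w * (v * ∑ (λ x → A a u x * A a u x))) + ∑ (λ a → t * t * w * (∑ (A a u) * ∑ (A a u)))
      ≡⟨ cong₂ _+_
           (trans (∑-* (t * w) (λ a → v * ∑ (λ x → A a u x * A a u x)))
             (cong (t * w *_) (trans (∑-* v (λ a → ∑ (λ x → A a u x * A a u x))) (cong (v *_) (∑∑-A² u)))))
           (trans (∑-* (t * t * w) (λ a → ∑ (A a u) * ∑ (A a u)))
             (cong (t * t * w *_) (trans (∑-cong (λ a → cong₂ _*_ (∑-A a u) (∑-A a u))) (∑-const n _)))) ⟩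
    t * w * (v * (2 * (v * q) + 2 * (∑ u * ∑ u))) + t * t * w * (v * (2 * ∑ u * (2 * ∑ u))) ∎)
    where
    open ≡-Reasoning
    v = 2 ^ n
    t = 2 ^ k
    w = (2 ^ n) ^ k
    q = ∑ (λ x → u x * u x)
    step : ∀ v t w Q q s →
      v * Q + t * w * (v * (2 * s * (2 * s))) ≡ t * w * (v * (2 * (v * q) + 2 * (s * s))) + t * t * w * (v * (2 * s * (2 * s))) →
      v * Q + 2 * t * (v * w) * (s * s) ≡ 2 * t * (v * w) * (v * q) + 2 * t * (2 * t) * (v * w) * (s * s)
    step v t w Q q s eq = +-cancelʳ-≡ (2 * (t * w * v * s * s)) _ _ (trans (lhs v t w Q s) (trans eq (rhs v t w q s)))
      where
      lhs : ∀ v t w Q s → v * Q + 2 * t * (v * w) * (s * s) + 2 * (t * w * v * s * s) ≡ v * Q + t * w * (v * (2 * s * (2 * s)))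
      lhs = solve-∀
      rhs : ∀ v t w q s → t * w * (v * (2 * (v * q) + 2 * (s * s))) + t * t * w * (v * (2 * s * (2 * s))) ≡
            2 * t * (v * w) * (v * q) + 2 * t * (2 * t) * (v * w) * (s * s) + 2 * (t * w * v * s * s)
      rhs = solve-∀

  odd : ℕ → Bool
  odd zero    = false
  odd (suc n) = not (odd n)

  odd-+ : ∀ m n → odd (m + n) ≡ odd m xor odd n
  odd-+ zero    n = refl
  odd-+ (suc m) n = trans (cong not (odd-+ m n)) (not-xor (odd m) (odd n))
    where
    not-xor : ∀ p q → not (p xor q) ≡ not p xor q
    not-xor false q = refl
    not-xor true  q = Bool.not-involutive q

  ⟦odd⟧≤ : ∀ n → ⟦ odd n ⟧ ≤ n
  ⟦odd⟧≤ zero    = z≤n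
  ⟦odd⟧≤ (suc n) = ≤-trans (⟦⟧≤1 (not (odd n))) (s≤s z≤n)
    where
    ⟦⟧≤1 : ∀ b → ⟦ b ⟧ ≤ 1
    ⟦⟧≤1 true  = ≤-refl
    ⟦⟧≤1 false = z≤n

  -- Bonferroni: the event "exactly one hit" is bounded below by 2S - S².
  2n≤n²+odd : ∀ n → 2 * n ≤ n * n + ⟦ odd n ⟧
  2n≤n²+odd zero          = z≤n
  2n≤n²+odd (suc zero)    = ≤-refl
  2n≤n²+odd (suc (suc n)) = ≤-trans (*-monoˡ-≤ (suc (suc n)) (s≤s (s≤s (z≤n {n})))) (m≤m+n _ _)

  odd-A : ∀ {n} (a : 𝔽₂^ n) {f} u → (∀ x → odd (u x) ≡ f x) → ∀ x → odd (A a u x) ≡ D a f x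
  odd-A a u eq x = trans (odd-+ (u x) (u (x ⊕ a))) (cong₂ _xor_ (eq x) (eq (x ⊕ a)))

  -- Union bound. As `u` lifts `f` to the natural numbers, the derivative of `f` is the parity of
  -- the sum of `u` over the parallelepiped, and a parity is at most the number itself.
  R≤M : ∀ {n} k {f : 𝔽₂^ n → 𝔽₂} {u} → (∀ x → odd (u x) ≡ f x) → R k f ≤ M k u
  R≤M zero    {u = u} eq = ∑-mono (λ x → subst (λ b → ⟦ b ⟧ ≤ u x) (eq x) (⟦odd⟧≤ (u x)))
  R≤M (suc k) {u = u} eq = ∑-mono (λ a → R≤M k (odd-A a u eq))

  2M≤Q+R : ∀ {n} k {f : 𝔽₂^ n → 𝔽₂} {u} → (∀ x → odd (u x) ≡ f x) → 2 * M k u ≤ Q k u + R k f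
  2M≤Q+R zero {f} {u} eq = begin
    2 * ∑ u                                ≡⟨ sym (∑-* 2 u) ⟩
    ∑ (λ x → 2 * u x)                      ≤⟨ ∑-mono (λ x → subst (λ b → 2 * u x ≤ u x * u x + ⟦ b ⟧) (eq x) (2n≤n²+odd (u x))) ⟩
    ∑ (λ x → u x * u x + ⟦ f x ⟧)          ≡⟨ ∑-+ (λ x → u x * u x) _ ⟩
    ∑ (λ x → u x * u x) + # f              ∎
    where open ≤-Reasoning
  2M≤Q+R (suc k) {f} {u} eq = begin
    2 * ∑ (λ a → M k (A a u))                     ≡⟨ sym (∑-* 2 (λ a → M k (A a u))) ⟩
    ∑ (λ a → 2 * M k (A a u))                     ≤⟨ ∑-mono (λ a → 2M≤Q+R k (odd-A a u eq)) ⟩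
    ∑ (λ a → Q k (A a u) + R k (D a f))           ≡⟨ ∑-+ (λ a → Q k (A a u)) _ ⟩
    ∑ (λ a → Q k (A a u)) + ∑ (λ a → R k (D a f)) ∎
    where open ≤-Reasoning

  odd-⟦⟧ : ∀ b → odd ⟦ b ⟧ ≡ b
  odd-⟦⟧ true  = refl
  odd-⟦⟧ false = refl

  R≤# : ∀ {n} k (f : 𝔽₂^ n → 𝔽₂) → R k f ≤ 2 ^ k * (2 ^ n) ^ k * # f
  R≤# k f = subst (R k f ≤_) (M≡ k (λ x → ⟦ f x ⟧)) (R≤M k (λ x → odd-⟦⟧ (f x)))

  -- Second moment: in the expectation of 2S - S² the diagonal leaves the mean, and the pairs of
  -- distinct vertices take away at most the mean times 2ᵏ times the density, which `small` keeps
  -- below half the mean.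
  #≤R : ∀ {n} k (f : 𝔽₂^ n → 𝔽₂) → 2 * (2 ^ k * # f) ≤ 2 ^ n → 2 ^ k * (2 ^ n) ^ k * # f ≤ 2 * R k f
  #≤R {n} k f small = *-cancelˡ-≤ (2 ^ n) {{m^n≢0 2 n}}
    (≤-cert (2 * (t * w * (e * e)))
      (+-mono-≤ (+-mono-≤
        (*-monoʳ-≤ (2 * v) (subst (λ m → 2 * m ≤ Q k u + R k f) (M≡ k u) (2M≤Q+R k (λ x → odd-⟦⟧ (f x)))))
        (*-monoʳ-≤ 2 (≤-reflexive Q′)))
        (*-monoʳ-≤ (t * w * e) small))
      (identity v t w e (Q k u) (R k f)))
    where
    u : 𝔽₂^ n → ℕ
    u x = ⟦ f x ⟧
    v = 2 ^ n
    t = 2 ^ k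
    w = (2 ^ n) ^ k
    e = # f
    Q′ : v * Q k u + t * w * (e * e) ≡ t * w * (v * e) + t * t * w * (e * e)
    Q′ = trans (Q≡ k u) (cong (λ q → t * w * (v * q) + t * t * w * (e * e)) (∑-cong (λ x → ⟦⟧² (f x))))
    identity : ∀ v t w e Q R →
      v * (2 * R) + (2 * v * (2 * (t * w * e)) + 2 * (v * Q + t * w * (e * e)) + t * w * e * (2 * (t * e))) ≡
      v * (t * w * e) + (2 * v * (Q + R) + 2 * (t * w * (v * e) + t * t * w * (e * e)) + t * w * e * v) + 2 * (t * w * (e * e))
    identity = solve-∀

  -- Degree and derivatives

  Null-0 : ∀ {n} k → Null {n} k (λ _ → false)
  Null-0 k = Null-≤ z≤n (zero (λ _ → refl))

  -- By the Leibniz rule a derivative of y h is y times a derivative of `h`, plus either zero or a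
  -- translate of `h`.
  Null-∧ : ∀ {n k} {h : 𝔽₂^ n → 𝔽₂} → Null k h → Null (suc k) (λ y → Vec.head y ∧ h (Vec.tail y))
  Null-∧ {h = h} (zero null) = Null-suc (zero (λ { (b ∷ x) → trans (cong (b ∧_) (null x)) (Bool.∧-zeroʳ b) }))
  Null-∧ {k = suc k} {h} (suc null) = suc λ { (β ∷ a) → Null-cong (λ { (b ∷ x) → leibniz b β (h x) (h (x ⊕ a)) })
    (Null-⊞ (Null-∧ (null a)) (scaled β a)) }
    where
    leibniz : ∀ b β p q → (b ∧ (p xor q)) xor (β ∧ q) ≡ (b ∧ p) xor ((b xor β) ∧ q)
    leibniz = solve 4 (λ b β p q → (b :* (p :+ q)) :+ (β :* q) := (b :* p) :+ ((b :+ β) :* q)) refl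
    scaled : ∀ β a → Null (suc k) (λ y → β ∧ h (Vec.tail y ⊕ a))
    scaled false a = Null-0 (suc k)
    scaled true  a = Null-∘ {f = h} (λ y → Vec.tail y ⊕ a) Vec.tail (λ { (_ ∷ x) (_ ∷ c) → ⊕-swapʳ x c a }) (suc null)

  -- Uses the decomposition f₀ + y (f₀ + f₁) from which `anf` is computed, so that orders and
  -- monomial sizes follow the same recursion.
  Null-split : ∀ {n k} {f : 𝔽₂^ (suc n) → 𝔽₂} → Null (suc k) (λ x → f (false ∷ x)) →
               Null k (λ x → f (false ∷ x) xor f (true ∷ x)) → Null (suc k) f
  Null-split {f = f} null₀ null₁ = Null-cong (λ { (b ∷ x) → expand b x })
    (Null-⊞ (Null-∘ Vec.tail Vec.tail (λ { (_ ∷ _) (_ ∷ _) → refl }) null₀) (Null-∧ null₁))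
    where
    expand : ∀ b x → f (false ∷ x) xor (b ∧ (f (false ∷ x) xor f (true ∷ x))) ≡ f (b ∷ x)
    expand false x = Bool.xor-identityʳ _
    expand true  x = trans (sym (Bool.xor-assoc (f (false ∷ x)) (f (false ∷ x)) (f (true ∷ x))))
      (cong (_xor f (true ∷ x)) (Bool.xor-same (f (false ∷ x))))

  Null-suc-dim : ∀ {n} (f : 𝔽₂^ n → 𝔽₂) → Null (suc n) f
  Null-suc-dim {zero}  f = suc (λ { [] → zero (λ { [] → Bool.xor-same (f []) }) })
  Null-suc-dim {suc n} f = Null-split (Null-suc (Null-suc-dim _)) (Null-suc-dim _)

  AnfBelow : ∀ {n} → ℕ → (𝔽₂^ n → 𝔽₂) → Set
  AnfBelow k f = ∀ S → anf f S ≡ true → ∣ S ∣ < k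

  AnfBelow⇒Null : ∀ {n k} {f : 𝔽₂^ n → 𝔽₂} → AnfBelow k f → Null k f
  AnfBelow⇒Null {zero}  {zero}  {f} below = zero vanish
    where
    vanish : ∀ x → f x ≡ false
    vanish [] with f [] in eq
    ... | false = refl
    ... | true  = ⊥-elim (n≮0 (below [] eq))
  AnfBelow⇒Null {zero}  {suc k} {f} below = Null-≤ (s≤s z≤n) (Null-suc-dim f)
  AnfBelow⇒Null {suc n} {zero}  {f} below = zero (λ { (b ∷ x) → vanish b (vanishes null₀ x) (vanishes null₁ x) })
    where
    null₀ = AnfBelow⇒Null {f = λ x → f (false ∷ x)} (λ S → below (false ∷ S))
    null₁ = AnfBelow⇒Null {f = λ x → f (false ∷ x) xor f (true ∷ x)} (λ S eq → <-trans (n<1+n _) (below (true ∷ S) eq))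
    vanish : ∀ {x} b → f (false ∷ x) ≡ false → f (false ∷ x) xor f (true ∷ x) ≡ false → f (b ∷ x) ≡ false
    vanish false eq _   = eq
    vanish true  eq eq′ = trans (sym (xor≡false eq′)) eq
  AnfBelow⇒Null {suc n} {suc k} {f} below = Null-split
    (AnfBelow⇒Null (λ S → below (false ∷ S)))
    (AnfBelow⇒Null (λ S eq → ≤-pred (below (true ∷ S) eq)))

  -- The coefficient at `true ∷ S` is the coefficient at `S` of a derivative: the one in the first
  -- coordinate direction, restricted to first coordinate 0.
  Null⇒AnfBelow : ∀ {n k} {f : 𝔽₂^ n → 𝔽₂} → Null k f → AnfBelow k f
  Null⇒AnfBelow (zero null) [] f[] with trans (sym f[]) (null [])
  ... | ()
  Null⇒AnfBelow (suc null) [] f[] = s≤s z≤n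
  Null⇒AnfBelow null (false ∷ S) = Null⇒AnfBelow (Null-∘ (false ∷_) (false ∷_) (λ _ _ → refl) null) S
  Null⇒AnfBelow (zero null) (true ∷ S) eq =
    ⊥-elim (n≮0 (Null⇒AnfBelow (zero (λ x → cong₂ _xor_ (null (false ∷ x)) (null (true ∷ x)))) S eq))
  Null⇒AnfBelow {f = f} (suc null) (true ∷ S) eq = s≤s (Null⇒AnfBelow
    (Null-cong (λ x → cong (λ y → f (false ∷ x) xor f (true ∷ y)) (⊕-identityʳ x))
      (Null-∘ (false ∷_) (false ∷_) (λ _ _ → refl) (null (true ∷ 𝟎)))) S eq)

  ∈-cube : ∀ {n} (S : 𝔽₂^ n) → S ∈ toList (cube n)
  ∈-cube []          = here refl
  ∈-cube {suc n} (false ∷ S) = ∈-++⁺ˡ (∈-map⁺ (false ∷_) (∈-cube S))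
  ∈-cube {suc n} (true  ∷ S) = ∈-++⁺ʳ (map (false ∷_) (toList (cube n))) (∈-++⁺ˡ (∈-map⁺ (true ∷_) (∈-cube S)))

  module _ {X : Set} (w : X → ℕ) where

    ≤-max : ∀ {x xs} → x ∈ xs → w x ≤ foldr _⊔_ 0 (map w xs)
    ≤-max (here refl)          = m≤m⊔n _ _
    ≤-max {xs = y ∷ _} (there x∈) = ≤-trans (≤-max x∈) (m≤n⊔m (w y) _)

    max-≤ : ∀ {b} xs → (∀ x → w x ≤ b) → foldr _⊔_ 0 (map w xs) ≤ b
    max-≤ []       le = z≤n
    max-≤ (x ∷ xs) le = ⊔-lub (le x) (max-≤ xs le)

  deg≤⇒Null : ∀ {n d} (f : 𝔽₂^ n → 𝔽₂) → deg f ≤ d → Null (suc d) f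
  deg≤⇒Null {d = d} f deg≤d = AnfBelow⇒Null λ S eq →
    s≤s (≤-trans (≤-reflexive (cong (λ b → if b then ∣ S ∣ else 0) (sym eq)))
      (≤-trans (≤-max (λ S → if anf f S then ∣ S ∣ else 0) (∈-cube S)) deg≤d))

  Null⇒deg≤ : ∀ {n d} (f : 𝔽₂^ n → 𝔽₂) → Null (suc d) f → deg f ≤ d
  Null⇒deg≤ {n} {d} f null = max-≤ (λ S → if anf f S then ∣ S ∣ else 0) (toList (cube n)) below
    where
    below : ∀ S → (if anf f S then ∣ S ∣ else 0) ≤ d
    below S with anf f S in eq
    ... | true  = ≤-pred (Null⇒AnfBelow null S eq)
    ... | false = z≤n

  -- Nonzero functions of small dimension

  Flat : ∀ {n} → ℕ → (𝔽₂^ n → 𝔽₂) → 𝔽₂^ n → 𝔽₂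
  Flat k f a = does (null? k (D a f))

  ⟦⟧-split : ∀ p → ⟦ p ⟧ + ⟦ not p ⟧ ≡ 1
  ⟦⟧-split true  = refl
  ⟦⟧-split false = refl

  -- Flat directions form a subgroup, so y and y ⊕ a are not both flat when a is not.
  Flat-pair : ∀ {n} k (f : 𝔽₂^ n → 𝔽₂) a → NonNull k (D a f) → ∀ y → ⟦ Flat k f y ⟧ + ⟦ Flat k f (y ⊕ a) ⟧ ≤ 1
  Flat-pair k f a (as , z , p) y with null? k (D y f) | null? k (D (y ⊕ a) f)
  ... | no _     | no _    = z≤n
  ... | no _     | yes _   = ≤-refl
  ... | yes _    | no _    = ≤-refl
  ... | yes null | yes null′ = ⊥-elim (Null⇒¬NonNull k
    (Null-cong eq (Null-⊞ (Null-translate y null) (Null-translate y null′))) (as , z , p))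
    where
    eq : ∀ x → D y f (x ⊕ y) xor D (y ⊕ a) f (x ⊕ y) ≡ D a f x
    eq x = trans (cong₂ (λ u v → (f (x ⊕ y) xor f u) xor (f (x ⊕ y) xor f v)) (⊕-cancelʳ x y)
                   (trans (⊕-assoc x y (y ⊕ a)) (cong (x ⊕_) (trans (sym (⊕-assoc y y a))
                     (trans (cong (_⊕ a) (⊕-same y)) (⊕-identityˡ a))))))
      (solve 3 (λ p q r → (p :+ q) :+ (p :+ r) := q :+ r) refl (f (x ⊕ y)) (f x) (f (x ⊕ a)))

  Flat-D : ∀ {n} k (f : 𝔽₂^ n → 𝔽₂) a y → Null (suc k) (D y f) → Null k (D y (D a f))
  Flat-D k f a y null = Null-cong (D-comm a y f) (D-null null a)

  Flat-D′ : ∀ {n} k (f : 𝔽₂^ n → 𝔽₂) a y → Null (suc k) (D (y ⊕ a) f) → Null k (D y (D a f))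
  Flat-D′ k f a y null = Null-cong eq (Flat-D k f a (y ⊕ a) null)
    where
    eq : D (y ⊕ a) (D a f) ≗ D y (D a f)
    eq x = cong (D a f x xor_) (trans (cong (λ z → f z xor f (z ⊕ a)) (sym (⊕-assoc x y a)))
      (trans (cong (λ z → f ((x ⊕ y) ⊕ a) xor f z) (⊕-cancelʳ (x ⊕ y) a)) (Bool.xor-comm (f ((x ⊕ y) ⊕ a)) (f (x ⊕ y)))))

  -- If `y` or `y ⊕ a` is flat for `f`, then `y` is flat for `D a f` one order lower, because
  -- `D a f` is invariant under translation by `a`; and at most one of the pair is flat.
  Flat-pair-suc : ∀ {n} k (f : 𝔽₂^ n → 𝔽₂) a → NonNull (suc k) (D a f) →
                  ∀ y → ⟦ Flat (suc k) f y ⟧ + ⟦ Flat (suc k) f (y ⊕ a) ⟧ ≤ ⟦ Flat k (D a f) y ⟧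
  Flat-pair-suc k f a nonNull y with null? k (D y (D a f))
  ... | yes _    = Flat-pair (suc k) f a nonNull y
  ... | no ¬null with null? (suc k) (D y f) | null? (suc k) (D (y ⊕ a) f)
  ...   | yes null | _        = ⊥-elim (¬null (Flat-D k f a y null))
  ...   | no _     | yes null = ⊥-elim (¬null (Flat-D′ k f a y null))
  ...   | no _     | no _     = z≤n

  #-double : ∀ {n} (f : 𝔽₂^ n → 𝔽₂) a → ∑ (λ y → ⟦ f y ⟧ + ⟦ f (y ⊕ a) ⟧) ≡ 2 * # f
  #-double f a = trans (∑-+ (λ y → ⟦ f y ⟧) (λ y → ⟦ f (y ⊕ a) ⟧))
    (cong (# f +_) (trans (∑-translate a (λ y → ⟦ f y ⟧)) (sym (+-identityʳ (# f)))))

  -- By the pairing of `y` with `y ⊕ a`, at most half as many directions are flat for `f` as for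
  -- `D a f` one order lower. The witness of nonvanishing supplies the `a` at every level.
  #Flat≤ : ∀ {n} k (f : 𝔽₂^ n → 𝔽₂) → NonNull (suc k) f → 2 ^ suc k * # (Flat k f) ≤ 2 ^ n
  #Flat≤ {n} zero f (a ∷ [] , x , p) = begin
    2 * # (Flat 0 f)                                     ≡⟨ sym (#-double (Flat 0 f) a) ⟩
    ∑ (λ y → ⟦ Flat 0 f y ⟧ + ⟦ Flat 0 f (y ⊕ a) ⟧)      ≤⟨ ∑-mono (Flat-pair 0 f a ([] , x , p)) ⟩
    # {n} (const true)                                   ≡⟨ #-true n ⟩
    2 ^ n                                                ∎
    where open ≤-Reasoning
  #Flat≤ {n} (suc k) f (a ∷ as , x , p) = begin
    2 ^ suc (suc k) * # (Flat (suc k) f)                 ≡⟨ trans (cong (_* # (Flat (suc k) f)) (*-comm 2 (2 ^ suc k))) (*-assoc (2 ^ suc k) 2 _) ⟩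
    2 ^ suc k * (2 * # (Flat (suc k) f))                 ≡⟨ cong (2 ^ suc k *_) (sym (#-double (Flat (suc k) f) a)) ⟩
    2 ^ suc k * ∑ (λ y → ⟦ Flat (suc k) f y ⟧ + ⟦ Flat (suc k) f (y ⊕ a) ⟧)
      ≤⟨ *-monoʳ-≤ (2 ^ suc k) (∑-mono (Flat-pair-suc k f a (as , x , p))) ⟩
    2 ^ suc k * # (Flat k (D a f))                       ≤⟨ #Flat≤ k (D a f) (as , x , p) ⟩
    2 ^ n                                                ∎
    where open ≤-Reasoning

  #-not : ∀ {n} (f : 𝔽₂^ n → 𝔽₂) → # f + # (not ∘ f) ≡ 2 ^ n
  #-not {n} f = trans (sym (∑-+ (λ x → ⟦ f x ⟧) (λ x → ⟦ not (f x) ⟧)))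
    (trans (∑-cong (λ x → ⟦⟧-split (f x))) (#-true n))

  ∑-nonFlat : ∀ {n} k (f : 𝔽₂^ n → 𝔽₂) c d → (∀ a → NonNull k (D a f) → c ≤ d * R k (D a f)) →
              # (not ∘ Flat k f) * c ≤ d * R (suc k) f
  ∑-nonFlat k f c d le = begin
    # (not ∘ Flat k f) * c                  ≡⟨ *-comm _ c ⟩
    c * # (not ∘ Flat k f)                  ≡⟨ sym (∑-* c (λ a → ⟦ not (Flat k f a) ⟧)) ⟩
    ∑ (λ a → c * ⟦ not (Flat k f a) ⟧)      ≤⟨ ∑-mono pointwise ⟩
    ∑ (λ a → d * R k (D a f))               ≡⟨ ∑-* d (λ a → R k (D a f)) ⟩
    d * R (suc k) f                         ∎
    where
    open ≤-Reasoning
    pointwise : ∀ a → c * ⟦ not (Flat k f a) ⟧ ≤ d * R k (D a f)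
    pointwise a with null-or-nonNull k (D a f)
    ... | inj₁ _  = ≤-trans (≤-reflexive (*-zeroʳ c)) z≤n
    ... | inj₂ nn = ≤-trans (≤-reflexive (*-identityʳ c)) (le a nn)

  -- The fraction ∏ (1 - 2⁻ⁱ) ≥ ¼ (1 + 2 · 2⁻ᵏ) of directions lowers the order of nonvanishing by one each
  -- time; what remains after k derivatives is a nonzero function of degree below m.
  R-lower : ∀ {n} k m (f : 𝔽₂^ n → 𝔽₂) → Null (suc k + m) f → NonNull (suc k) f →
            2 * (2 ^ suc k + 2) * (2 ^ n) ^ suc (suc k) ≤ 4 * 2 ^ suc k * 2 ^ m * R (suc k) f
  R-lower {n} zero m f null nonNull =
    arrange (2 ^ n) (2 ^ m) (# (Flat 0 f)) (# (not ∘ Flat 0 f)) (R 1 f)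
      (#Flat≤ 0 f nonNull) (#-not (Flat 0 f))
      (∑-nonFlat 0 f (2 * 2 ^ n) (2 ^ m) λ { a ([] , x , p) → min-distance m (D a f) (D-null null a) x p })
    where
    arrange : ∀ v t z w r → 2 * z ≤ v → z + w ≡ v → w * (2 * v) ≤ t * r → 8 * (v * (v * 1)) ≤ 8 * t * r
    arrange v t z w r 2z≤v refl le = ≤-cert 0 (+-mono-≤ (*-monoʳ-≤ 8 le) (*-monoʳ-≤ (8 * (z + w)) 2z≤v)) (identity z w t r)
      where
      identity : ∀ z w t r → 8 * t * r + (8 * (w * (2 * (z + w))) + 8 * (z + w) * (2 * z)) ≡
                             8 * ((z + w) * ((z + w) * 1)) + (8 * (t * r) + 8 * (z + w) * (z + w)) + 0
      identity = solve-∀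
  R-lower {n} (suc k) m f null nonNull =
    arrange (2 ^ n) (2 ^ k) (2 ^ m) ((2 ^ n) ^ suc (suc k)) (# (Flat (suc k) f)) (# (not ∘ Flat (suc k) f)) (R (suc (suc k)) f)
      (m^n>0 2 k) (#Flat≤ (suc k) f nonNull) (#-not (Flat (suc k) f))
      (∑-nonFlat (suc k) f (2 * (2 ^ suc k + 2) * (2 ^ n) ^ suc (suc k)) (4 * 2 ^ suc k * 2 ^ m) λ a → R-lower k m (D a f) (D-null null a))
    where
    -- The extra term makes the bound inductive: with x = 2⁻ᵏ / 4 at most a fraction x of the
    -- directions is flat, and (1 - x) (1 + 4 x) ≥ 1 + 2 x since x ≤ 1/4.
    arrange : ∀ v y t w z z′ r → 1 ≤ y → 2 * (2 * y) * z ≤ v → z + z′ ≡ v →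
              z′ * (2 * (2 * y + 2) * w) ≤ 4 * (2 * y) * t * r →
              2 * (2 * (2 * y) + 2) * (v * w) ≤ 4 * (2 * (2 * y)) * t * r
    arrange v (suc y) t w z z′ r _ small refl le =
      ≤-cert (8 * y * (w * z)) (+-mono-≤ (*-monoʳ-≤ 2 le) (*-monoʳ-≤ (4 * w) small)) (identity y t w z z′ r)
      where
      identity : ∀ y t w z z′ r →
        4 * (2 * (2 * suc y)) * t * r + (2 * (z′ * (2 * (2 * suc y + 2) * w)) + 4 * w * (2 * (2 * suc y) * z)) ≡
        2 * (2 * (2 * suc y) + 2) * ((z + z′) * w) + (2 * (4 * (2 * suc y) * t * r) + 4 * w * (z + z′)) + 8 * y * (w * z)
      identity = solve-∀

  -- Independent functionals

  infix 8 _·_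

  _·_ : ∀ {n} → 𝔽₂^ n → 𝔽₂^ n → 𝔽₂
  []      · []      = false
  (a ∷ x) · (b ∷ y) = (a ∧ b) xor (x · y)

  ·-⊕ʳ : ∀ {n} (b x y : 𝔽₂^ n) → b · (x ⊕ y) ≡ (b · x) xor (b · y)
  ·-⊕ʳ []      []      []      = refl
  ·-⊕ʳ (c ∷ b) (p ∷ x) (q ∷ y) = trans (cong ((c ∧ (p xor q)) xor_) (·-⊕ʳ b x y))
    (solve 5 (λ c p q r s → (c :* (p :+ q)) :+ (r :+ s) := ((c :* p) :+ r) :+ ((c :* q) :+ s)) refl c p q (b · x) (b · y))

  ·-comm : ∀ {n} (x y : 𝔽₂^ n) → x · y ≡ y · x
  ·-comm []      []      = refl
  ·-comm (a ∷ x) (b ∷ y) = cong₂ _xor_ (Bool.∧-comm a b) (·-comm x y)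

  ·-⊕ˡ : ∀ {n} (b c x : 𝔽₂^ n) → (b ⊕ c) · x ≡ (b · x) xor (c · x)
  ·-⊕ˡ b c x = trans (·-comm (b ⊕ c) x) (trans (·-⊕ʳ x b c) (cong₂ _xor_ (·-comm x b) (·-comm x c)))

  ·-𝟎ʳ : ∀ {n} (b : 𝔽₂^ n) → b · 𝟎 ≡ false
  ·-𝟎ʳ []      = refl
  ·-𝟎ʳ (a ∷ b) = cong₂ _xor_ (Bool.∧-zeroʳ a) (·-𝟎ʳ b)

  _⟂_ : ∀ {n} → List (𝔽₂^ n) → 𝔽₂^ n → Set
  bs ⟂ x = All (λ b → b · x ≡ false) bs

  ⟂-⊕ : ∀ {n} {bs} {x y : 𝔽₂^ n} → bs ⟂ x → bs ⟂ y → bs ⟂ (x ⊕ y)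
  ⟂-⊕ {x = x} {y} ⟂x ⟂y = All.map (λ {b} (p , q) → trans (·-⊕ʳ b x y) (cong₂ _xor_ p q)) (All.zip (⟂x , ⟂y))

  -- Independence is recorded by triangular dual vectors: `e` moves across the hyperplanes of `b`
  -- while staying parallel to those of the later functionals, which is the form that `rigid` and
  -- `glue` use.
  data Independent {n} : List (𝔽₂^ n) → Set where
    []      : Independent []
    extend : ∀ {b bs} e → b · e ≡ true → bs ⟂ e → Independent bs → Independent (b ∷ bs)

  span : ∀ {n} → List (𝔽₂^ n) → List (𝔽₂^ n)
  span []       = 𝟎 ∷ []
  span (b ∷ bs) = span bs ++ map (b ⊕_) (span bs)

  length-span : ∀ {n} (bs : List (𝔽₂^ n)) → length (span bs) ≡ 2 ^ length bs
  length-span []       = refl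
  length-span (b ∷ bs) = trans (List.length-++ (span bs))
    (trans (cong (length (span bs) +_) (List.length-map (b ⊕_) (span bs)))
      (trans (cong₂ _+_ (length-span bs) (length-span bs)) (cong (2 ^ length bs +_) (sym (+-identityʳ _)))))

  nonzero-dual : ∀ {n} (b : 𝔽₂^ n) → b ≡ 𝟎 ⊎ (∃[ e ] b · e ≡ true)
  nonzero-dual []          = inj₁ refl
  nonzero-dual (true  ∷ b) = inj₂ (true ∷ 𝟎 , cong not (·-𝟎ʳ b))
  nonzero-dual (false ∷ b) with nonzero-dual b
  ... | inj₁ refl    = inj₁ refl
  ... | inj₂ (e , p) = inj₂ (false ∷ e , p)

  -- Gaussian elimination. Whichever of `b` and `l ⊕ b` vanishes at `w` is tested against `bs`; the
  -- vector `e` found there is corrected by adding `w` when `l · e` is true.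
  dual : ∀ {n} {bs : List (𝔽₂^ n)} → Independent bs → ∀ b → b ∈ span bs ⊎ (∃[ e ] (b · e ≡ true × bs ⟂ e))
  dual [] b with nonzero-dual b
  ... | inj₁ b≡𝟎     = inj₁ (here b≡𝟎)
  ... | inj₂ (e , p) = inj₂ (e , p , [])
  dual {bs = l ∷ bs} (extend w lw ⟂w ind) b with b · w in bw
  ... | false with dual ind b
  ...   | inj₁ b∈ = inj₁ (∈-++⁺ˡ b∈)
  ...   | inj₂ (e , be , ⟂e) with l · e in le
  ...     | false = inj₂ (e , be , le ∷ ⟂e)
  ...     | true  = inj₂ (e ⊕ w , trans (·-⊕ʳ b e w) (cong₂ _xor_ be bw) ,
                         trans (·-⊕ʳ l e w) (cong₂ _xor_ le lw) ∷ ⟂-⊕ ⟂e ⟂w)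
  dual {bs = l ∷ bs} (extend w lw ⟂w ind) b | true with dual ind (l ⊕ b)
  ...   | inj₁ lb∈ = inj₁ (∈-++⁺ʳ (span bs) (subst (_∈ map (l ⊕_) (span bs))
                       (trans (⊕-comm l (l ⊕ b)) (trans (cong (_⊕ l) (⊕-comm l b)) (⊕-cancelʳ b l)))
                       (∈-map⁺ (l ⊕_) lb∈)))
  ...   | inj₂ (e , lbe , ⟂e) with l · e in le
  ...     | false = inj₂ (e , trans (cong (_xor (b · e)) (sym le)) (trans (sym (·-⊕ˡ l b e)) lbe) , le ∷ ⟂e)
  ...     | true  = inj₂ (e ⊕ w
                    , trans (·-⊕ʳ b e w) (trans (cong ((b · e) xor_) bw) (trans (Bool.xor-comm (b · e) true)
                        (trans (cong (_xor (b · e)) (sym le)) (trans (sym (·-⊕ˡ l b e)) lbe))))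
                    , trans (·-⊕ʳ l e w) (cong₂ _xor_ le lw) ∷ ⟂-⊕ ⟂e ⟂w)

  _≈ᵇ_ : ∀ {n} → 𝔽₂^ n → 𝔽₂^ n → Bool
  []      ≈ᵇ []      = true
  (a ∷ x) ≈ᵇ (b ∷ y) = not (a xor b) ∧ (x ≈ᵇ y)

  ≈ᵇ-refl : ∀ {n} (x : 𝔽₂^ n) → x ≈ᵇ x ≡ true
  ≈ᵇ-refl []      = refl
  ≈ᵇ-refl (a ∷ x) = cong₂ (λ p q → not p ∧ q) (Bool.xor-same a) (≈ᵇ-refl x)

  #-≈ᵇ : ∀ {n} (x : 𝔽₂^ n) → # (x ≈ᵇ_) ≡ 1
  #-≈ᵇ []          = refl
  #-≈ᵇ {suc n} (false ∷ x) = cong₂ _+_ (#-≈ᵇ x) (trans (∑-const n 0) (*-zeroʳ (2 ^ n)))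
  #-≈ᵇ {suc n} (true  ∷ x) = cong₂ _+_ (trans (∑-const n 0) (*-zeroʳ (2 ^ n))) (#-≈ᵇ x)

  #≤length : ∀ {n} (f : 𝔽₂^ n → 𝔽₂) xs → (∀ x → f x ≡ true → x ∈ xs) → # f ≤ length xs
  #≤length {n} f xs covers = ≤-trans (∑-mono pointwise) (≤-reflexive (∑-multiplicity xs))
    where
    multiplicity : List (𝔽₂^ n) → 𝔽₂^ n → ℕ
    multiplicity []       y = 0
    multiplicity (x ∷ xs) y = ⟦ x ≈ᵇ y ⟧ + multiplicity xs y
    ∑-multiplicity : ∀ xs → ∑ (multiplicity xs) ≡ length xs
    ∑-multiplicity []       = trans (∑-const n 0) (*-zeroʳ (2 ^ n))
    ∑-multiplicity (x ∷ xs) = trans (∑-+ (λ y → ⟦ x ≈ᵇ y ⟧) (multiplicity xs)) (cong₂ _+_ (#-≈ᵇ x) (∑-multiplicity xs))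
    occurs : ∀ {y xs} → y ∈ xs → 1 ≤ multiplicity xs y
    occurs {y} (here refl)         = ≤-trans (≤-reflexive (cong ⟦_⟧ (sym (≈ᵇ-refl y)))) (m≤m+n _ _)
    occurs {y} {x ∷ xs} (there y∈) = ≤-trans (occurs y∈) (m≤n+m _ ⟦ x ≈ᵇ y ⟧)
    pointwise : ∀ x → ⟦ f x ⟧ ≤ multiplicity xs x
    pointwise x with f x in fx
    ... | true  = occurs (covers x fx)
    ... | false = z≤n

  -- In its uses `as` are directions and `b` is the normal of a hyperplane parallel to all of them.
  annihilates : ∀ {n} → List (𝔽₂^ n) → 𝔽₂^ n → 𝔽₂
  annihilates []       b = true
  annihilates (a ∷ as) b = not (a · b) ∧ annihilates as b

  ⟂⇒annihilates-⊕ : ∀ {n} (as : List (𝔽₂^ n)) {e} → as ⟂ e → ∀ b → annihilates as (b ⊕ e) ≡ annihilates as b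
  ⟂⇒annihilates-⊕ []       []       b = refl
  ⟂⇒annihilates-⊕ (a ∷ as) {e} (p ∷ ⟂e) b = cong₂ (λ q r → not q ∧ r)
    (trans (·-⊕ʳ a b e) (trans (cong ((a · b) xor_) p) (Bool.xor-identityʳ _))) (⟂⇒annihilates-⊕ as ⟂e b)

  -- Translation by `e` flips `a · b` and leaves the other conditions alone.
  #-annihilates : ∀ {n} a (as : List (𝔽₂^ n)) {e} → a · e ≡ true → as ⟂ e →
                  2 * # (annihilates (a ∷ as)) ≡ # (annihilates as)
  #-annihilates a as {e} ae ⟂e = trans (sym (#-double (annihilates (a ∷ as)) e)) (∑-cong pointwise)
    where
    halves : ∀ p q → ⟦ not p ∧ q ⟧ + ⟦ not (not p) ∧ q ⟧ ≡ ⟦ q ⟧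
    halves true  q = refl
    halves false q = +-identityʳ ⟦ q ⟧
    pointwise : ∀ b → ⟦ annihilates (a ∷ as) b ⟧ + ⟦ annihilates (a ∷ as) (b ⊕ e) ⟧ ≡ ⟦ annihilates as b ⟧
    pointwise b = trans
      (cong₂ (λ p q → ⟦ annihilates (a ∷ as) b ⟧ + ⟦ not p ∧ q ⟧)
        (trans (·-⊕ʳ a b e) (trans (cong ((a · b) xor_) ae) (Bool.xor-comm (a · b) true)))
        (⟂⇒annihilates-⊕ as ⟂e b))
      (halves (a · b) (annihilates as b))

  -- R restricted to directions parallel to the hyperplanes b · x = c, summed over both c.
  R∥ : ∀ {n} → 𝔽₂^ n → ℕ → (𝔽₂^ n → 𝔽₂) → ℕ
  R∥ b zero    f = # f
  R∥ b (suc k) f = ∑ (λ a → ⟦ not (a · b) ⟧ * R∥ b k (D a f))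

  #-false : ∀ {n} {f : 𝔽₂^ n → 𝔽₂} → (∀ x → f x ≡ false) → # f ≡ 0
  #-false {n} f≡0 = trans (∑-cong (λ x → cong ⟦_⟧ (f≡0 x))) (trans (∑-const n 0) (*-zeroʳ (2 ^ n)))

  R∥-zero : ∀ {n} (b : 𝔽₂^ n) k {f} → (∀ x → f x ≡ false) → R∥ b k f ≡ 0
  R∥-zero b zero    f≡0 = #-false f≡0
  R∥-zero {n} b (suc k) f≡0 = trans
    (∑-cong (λ a → trans (cong (⟦ not (a · b) ⟧ *_) (R∥-zero b k (λ x → cong₂ _xor_ (f≡0 x) (f≡0 (x ⊕ a))))) (*-zeroʳ ⟦ not (a · b) ⟧)))
    (trans (∑-const n 0) (*-zeroʳ (2 ^ n)))

  -- Only independent directions contribute to R k f, and k independent directions are parallel to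
  -- a 2⁻ᵏ fraction of the hyperplanes.
  ∑-R∥-independent : ∀ {n} k (as : List (𝔽₂^ n)) f → Independent as → (∀ s → s ∈ span as → ∀ x → D s f x ≡ false) →
                     2 ^ k * ∑ (λ b → ⟦ annihilates as b ⟧ * R∥ b k f) ≤ # (annihilates as) * R k f
  ∑-R∥-independent zero as f ind killed = ≤-reflexive (begin
    1 * ∑ (λ b → ⟦ annihilates as b ⟧ * # f)   ≡⟨ *-identityˡ _ ⟩
    ∑ (λ b → ⟦ annihilates as b ⟧ * # f)       ≡⟨ ∑-cong (λ b → *-comm ⟦ annihilates as b ⟧ (# f)) ⟩
    ∑ (λ b → # f * ⟦ annihilates as b ⟧)       ≡⟨ ∑-* (# f) (λ b → ⟦ annihilates as b ⟧) ⟩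
    # f * # (annihilates as)                   ≡⟨ *-comm (# f) _ ⟩
    # (annihilates as) * # f                   ∎)
    where open ≡-Reasoning
  ∑-R∥-independent {n} (suc k) as f ind killed = begin
    2 ^ suc k * ∑ (λ b → ⟦ annihilates as b ⟧ * ∑ (λ a → ⟦ not (a · b) ⟧ * R∥ b k (D a f)))
      ≡⟨ cong (2 ^ suc k *_) (∑-cong (λ b → sym (∑-* ⟦ annihilates as b ⟧ (λ a → ⟦ not (a · b) ⟧ * R∥ b k (D a f))))) ⟩
    2 ^ suc k * ∑ (λ b → ∑ (λ a → ⟦ annihilates as b ⟧ * (⟦ not (a · b) ⟧ * R∥ b k (D a f))))
      ≡⟨ cong (2 ^ suc k *_) (∑-swap (λ b a → ⟦ annihilates as b ⟧ * (⟦ not (a · b) ⟧ * R∥ b k (D a f)))) ⟩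
    2 ^ suc k * ∑ (λ a → ∑ (λ b → ⟦ annihilates as b ⟧ * (⟦ not (a · b) ⟧ * R∥ b k (D a f))))
      ≡⟨ cong (2 ^ suc k *_) (∑-cong (λ a → ∑-cong (λ b → merge (annihilates as b) (not (a · b)) (R∥ b k (D a f))))) ⟩
    2 ^ suc k * ∑ (λ a → ∑ (λ b → ⟦ annihilates (a ∷ as) b ⟧ * R∥ b k (D a f)))
      ≡⟨ sym (∑-* (2 ^ suc k) (λ a → ∑ (λ b → ⟦ annihilates (a ∷ as) b ⟧ * R∥ b k (D a f)))) ⟩
    ∑ (λ a → 2 ^ suc k * ∑ (λ b → ⟦ annihilates (a ∷ as) b ⟧ * R∥ b k (D a f)))
      ≤⟨ ∑-mono direction ⟩
    ∑ (λ a → # (annihilates as) * R k (D a f))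
      ≡⟨ ∑-* (# (annihilates as)) (λ a → R k (D a f)) ⟩
    # (annihilates as) * R (suc k) f ∎
    where
    open ≤-Reasoning
    merge : ∀ p q r → ⟦ p ⟧ * (⟦ q ⟧ * r) ≡ ⟦ q ∧ p ⟧ * r
    merge true  true  r = +-identityʳ (1 * r)
    merge true  false r = refl
    merge false true  r = refl
    merge false false r = refl
    direction : ∀ a → 2 ^ suc k * ∑ (λ b → ⟦ annihilates (a ∷ as) b ⟧ * R∥ b k (D a f)) ≤ # (annihilates as) * R k (D a f)
    direction a with dual ind a
    -- A direction in the span contributes nothing to either side's lower bound: `D a f` vanishes
    -- identically.
    ... | inj₁ a∈ = ≤-trans (≤-reflexive (trans (cong (2 ^ suc k *_) (trans
            (∑-cong (λ b → trans (cong (⟦ annihilates (a ∷ as) b ⟧ *_) (R∥-zero b k (killed a a∈))) (*-zeroʳ ⟦ annihilates (a ∷ as) b ⟧)))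
            (trans (∑-const n 0) (*-zeroʳ (2 ^ n))))) (*-zeroʳ (2 ^ suc k)))) z≤n
    ... | inj₂ (e , ae , ⟂e) = begin
      2 ^ suc k * ∑ (λ b → ⟦ annihilates (a ∷ as) b ⟧ * R∥ b k (D a f))     ≡⟨ *-assoc 2 (2 ^ k) _ ⟩
      2 * (2 ^ k * ∑ (λ b → ⟦ annihilates (a ∷ as) b ⟧ * R∥ b k (D a f)))
        ≤⟨ *-monoʳ-≤ 2 (∑-R∥-independent k (a ∷ as) (D a f) (extend e ae ⟂e ind) killed′) ⟩
      2 * (# (annihilates (a ∷ as)) * R k (D a f))                          ≡⟨ sym (*-assoc 2 (# (annihilates (a ∷ as))) _) ⟩
      2 * # (annihilates (a ∷ as)) * R k (D a f)                            ≡⟨ cong (_* R k (D a f)) (#-annihilates a as ae ⟂e) ⟩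
      # (annihilates as) * R k (D a f)                                      ∎
      where
      D-killed : ∀ s → s ∈ span as → ∀ x → D s (D a f) x ≡ false
      D-killed s s∈ x = trans (D-comm s a f x) (cong₂ _xor_ (killed s s∈ x) (killed s s∈ (x ⊕ a)))
      -- The new derivative is also invariant under `a`, hence under the enlarged span.
      killed′ : ∀ s → s ∈ span (a ∷ as) → ∀ x → D s (D a f) x ≡ false
      killed′ s s∈ x with ∈-++⁻ (span as) s∈
      ... | inj₁ s∈as = D-killed s s∈as x
      ... | inj₂ s∈map with ∈-map⁻ (a ⊕_) s∈map
      ...   | s′ , s′∈ , refl = trans (D-⊕ a s′ (D a f) x) (cong₂ _xor_ (D-D a f x) (D-killed s′ s′∈ (x ⊕ a)))

  ∑-R∥ : ∀ {n} k (f : 𝔽₂^ n → 𝔽₂) → 2 ^ k * ∑ (λ b → R∥ b k f) ≤ 2 ^ n * R k f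
  ∑-R∥ {n} k f = subst₂ (λ p q → 2 ^ k * p ≤ q * R k f)
    (∑-cong (λ b → *-identityˡ (R∥ b k f))) (#-true n)
    (∑-R∥-independent k [] f [] λ { s (here refl) → D-𝟎 f })

  -- Restriction to hyperplanes

  on : ∀ {n} → 𝔽₂^ n → 𝔽₂ → 𝔽₂^ n → 𝔽₂
  on b c x = not (c xor (b · x))

  ∑-on : ∀ {n} b (g : 𝔽₂^ n → ℕ) → ∑ (λ x → ⟦ on b false x ⟧ * g x) + ∑ (λ x → ⟦ on b true x ⟧ * g x) ≡ ∑ g
  ∑-on b g = trans (sym (∑-+ (λ x → ⟦ on b false x ⟧ * g x) (λ x → ⟦ on b true x ⟧ * g x))) (∑-cong (λ x → either (b · x) (g x)))
    where
    either : ∀ s m → ⟦ not (false xor s) ⟧ * m + ⟦ not (true xor s) ⟧ * m ≡ m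
    either false m = trans (+-identityʳ (1 * m)) (+-identityʳ m)
    either true  m = +-identityʳ m

  -- embed b c parametrises the hyperplane b · x = c by the coordinates other than the first one
  -- at which b is nonzero; it is meaningless for b = 𝟎.
  embed : ∀ {n} → 𝔽₂^ (suc n) → 𝔽₂ → 𝔽₂^ n → 𝔽₂^ (suc n)
  embed         (true  ∷ b) c y       = (c xor (b · y)) ∷ y
  embed {zero}  (false ∷ b) c []      = c ∷ []
  embed {suc n} (false ∷ b) c (p ∷ y) = p ∷ embed b c y

  project : ∀ {n} → 𝔽₂^ (suc n) → 𝔽₂^ (suc n) → 𝔽₂^ n
  project         (true  ∷ b) (p ∷ x) = x
  project {zero}  (false ∷ b) (p ∷ x) = []
  project {suc n} (false ∷ b) (p ∷ x) = p ∷ project b x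

  project-embed : ∀ {n} (b : 𝔽₂^ (suc n)) c y → project b (embed b c y) ≡ y
  project-embed         (true  ∷ b) c y       = refl
  project-embed {zero}  (false ∷ b) c []      = refl
  project-embed {suc n} (false ∷ b) c (p ∷ y) = cong (p ∷_) (project-embed b c y)

  project-⊕ : ∀ {n} (b : 𝔽₂^ (suc n)) x y → project b (x ⊕ y) ≡ project b x ⊕ project b y
  project-⊕         (true  ∷ b) (p ∷ x) (q ∷ y) = refl
  project-⊕ {zero}  (false ∷ b) (p ∷ x) (q ∷ y) = refl
  project-⊕ {suc n} (false ∷ b) (p ∷ x) (q ∷ y) = cong ((p xor q) ∷_) (project-⊕ b x y)

  embed-⊕ : ∀ {n} (b : 𝔽₂^ (suc n)) c x y → embed b c (x ⊕ y) ≡ embed b c x ⊕ embed b false y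
  embed-⊕ (true ∷ b) c x y = cong (_∷ (x ⊕ y)) (trans (cong (c xor_) (·-⊕ʳ b x y)) (sym (Bool.xor-assoc c (b · x) (b · y))))
  embed-⊕ {zero}  (false ∷ []) c []      []      = cong (_∷ []) (sym (Bool.xor-identityʳ c))
  embed-⊕ {suc n} (false ∷ b)  c (p ∷ x) (q ∷ y) = cong ((p xor q) ∷_) (embed-⊕ b c x y)

  ∑-embed : ∀ {n} (b : 𝔽₂^ (suc n)) c → b ≢ 𝟎 → ∀ φ → ∑ (λ y → φ (embed b c y)) ≡ ∑ (λ x → ⟦ on b c x ⟧ * φ x)
  ∑-embed (true ∷ b) c b≢𝟎 φ = trans
    (∑-cong (λ y → choose c (b · y) (λ p → φ (p ∷ y))))
    (∑-+ (λ y → ⟦ on b c y ⟧ * φ (false ∷ y)) (λ y → ⟦ on (true ∷ b) c (true ∷ y) ⟧ * φ (true ∷ y)))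
    where
    choose : ∀ c s (ψ : Bool → ℕ) → ψ (c xor s) ≡ ⟦ not (c xor s) ⟧ * ψ false + ⟦ not (c xor not s) ⟧ * ψ true
    choose false false ψ = sym (trans (+-identityʳ _) (+-identityʳ _))
    choose false true  ψ = sym (+-identityʳ _)
    choose true  false ψ = sym (+-identityʳ _)
    choose true  true  ψ = sym (trans (+-identityʳ _) (+-identityʳ _))
  ∑-embed {zero}  (false ∷ []) c b≢𝟎 φ = ⊥-elim (b≢𝟎 refl)
  ∑-embed {suc n} (false ∷ b)  c b≢𝟎 φ = cong₂ _+_
    (∑-embed b c (b≢𝟎 ∘ cong (false ∷_)) (λ x → φ (false ∷ x)))
    (∑-embed b c (b≢𝟎 ∘ cong (false ∷_)) (λ x → φ (true ∷ x)))

  -- `embed b false` parametrises exactly the directions parallel to the hyperplanes, so a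
  -- derivative in such a direction restricts to either of them.
  R-embed : ∀ {n} (b : 𝔽₂^ (suc n)) → b ≢ 𝟎 → ∀ k f →
            R k (f ∘ embed b false) + R k (f ∘ embed b true) ≡ R∥ b k f
  R-embed b b≢𝟎 zero f = trans
    (cong₂ _+_ (∑-embed b false b≢𝟎 (λ x → ⟦ f x ⟧)) (∑-embed b true b≢𝟎 (λ x → ⟦ f x ⟧)))
    (∑-on b (λ x → ⟦ f x ⟧))
  R-embed b b≢𝟎 (suc k) f = begin
    ∑ (λ a → R k (D a (f ∘ embed b false))) + ∑ (λ a → R k (D a (f ∘ embed b true)))
      ≡⟨ sym (∑-+ (λ a → R k (D a (f ∘ embed b false))) _) ⟩
    ∑ (λ a → R k (D a (f ∘ embed b false)) + R k (D a (f ∘ embed b true)))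
      ≡⟨ ∑-cong (λ a → trans (cong₂ _+_ (R-cong k (D-embed false a)) (R-cong k (D-embed true a)))
                             (R-embed b b≢𝟎 k (D (embed b false a) f))) ⟩
    ∑ (λ a → R∥ b k (D (embed b false a) f))
      ≡⟨ ∑-embed b false b≢𝟎 (λ a → R∥ b k (D a f)) ⟩
    ∑ (λ a → ⟦ on b false a ⟧ * R∥ b k (D a f))
      ≡⟨ ∑-cong (λ a → cong (λ s → ⟦ not s ⟧ * R∥ b k (D a f)) (·-comm b a)) ⟩
    ∑ (λ a → ⟦ not (a · b) ⟧ * R∥ b k (D a f)) ∎
    where
    open ≡-Reasoning
    D-embed : ∀ c a → D a (f ∘ embed b c) ≗ D (embed b false a) f ∘ embed b c
    D-embed c a x = cong (λ y → f (embed b c x) xor f y) (embed-⊕ b c x a)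

  Null-project : ∀ {n k} (b : 𝔽₂^ (suc n)) {p} → Null k p → Null k (p ∘ project b)
  Null-project b = Null-∘ (project b) (project b) (project-⊕ b)

  #-project : ∀ {n} (b : 𝔽₂^ (suc n)) c → b ≢ 𝟎 → ∀ f p →
              ∑ (λ x → ⟦ on b c x ⟧ * ⟦ (f ⊞ (p ∘ project b)) x ⟧) ≡ # ((f ∘ embed b c) ⊞ p)
  #-project b c b≢𝟎 f p = trans (sym (∑-embed b c b≢𝟎 (λ x → ⟦ (f ⊞ (p ∘ project b)) x ⟧)))
    (∑-cong (λ y → cong (λ z → ⟦ f (embed b c y) xor p z ⟧) (project-embed b c y)))

  -- Stated for the squares of the sums over b · x = 0 and b · x = 1 instead of the square of their
  -- difference, the Fourier coefficient at b, so that no subtraction occurs.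
  parseval : ∀ {n} (g : 𝔽₂^ n → ℕ) →
    ∑ (λ b → 2 * (∑ (λ x → ⟦ on b false x ⟧ * g x) * ∑ (λ x → ⟦ on b false x ⟧ * g x)
                + ∑ (λ x → ⟦ on b true  x ⟧ * g x) * ∑ (λ x → ⟦ on b true  x ⟧ * g x)))
    ≡ 2 ^ n * (∑ g * ∑ g) + 2 ^ n * ∑ (λ x → g x * g x)
  parseval {zero} g = point (g [])
    where
    point : ∀ a → 2 * ((1 * a) * (1 * a) + (0 * a) * (0 * a)) ≡ 1 * (a * a) + 1 * (a * a)
    point = solve-∀
  parseval {suc n} g = begin
    ∑ (λ b → 2 * (sq (p₀ b + p₁ b) + sq (m₀ b + m₁ b))) + ∑ (λ b → 2 * (sq (p₀ b + m₁′ b) + sq (m₀ b + p₁′ b)))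
      ≡⟨ sym (∑-+ (λ b → 2 * (sq (p₀ b + p₁ b) + sq (m₀ b + m₁ b))) _) ⟩
    ∑ (λ b → 2 * (sq (p₀ b + p₁ b) + sq (m₀ b + m₁ b)) + 2 * (sq (p₀ b + m₁′ b) + sq (m₀ b + p₁′ b)))
      ≡⟨ ∑-cong (λ b → trans
           (cong₂ (λ u v → 2 * (sq (p₀ b + p₁ b) + sq (m₀ b + m₁ b)) + 2 * (sq (p₀ b + u) + sq (m₀ b + v)))
             (∑-cong (λ x → cong (λ s → ⟦ s ⟧ * g (true ∷ x)) (flip false (b · x))))
             (∑-cong (λ x → cong (λ s → ⟦ s ⟧ * g (true ∷ x)) (flip true (b · x)))))
           (trans (expand (p₀ b) (p₁ b) (m₀ b) (m₁ b))
             (cong₂ (λ s₀ s₁ → 2 * (2 * (sq (p₀ b) + sq (m₀ b))) + 2 * (2 * (sq (p₁ b) + sq (m₁ b))) + 4 * (s₀ * s₁))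
               (∑-on b g₀) (∑-on b g₁)))) ⟩
    ∑ (λ b → 2 * (2 * (sq (p₀ b) + sq (m₀ b))) + 2 * (2 * (sq (p₁ b) + sq (m₁ b))) + 4 * (∑ g₀ * ∑ g₁))
      ≡⟨ trans (∑-+ (λ b → 2 * (2 * (sq (p₀ b) + sq (m₀ b))) + 2 * (2 * (sq (p₁ b) + sq (m₁ b)))) _)
           (cong₂ _+_ (trans (∑-+ (λ b → 2 * (2 * (sq (p₀ b) + sq (m₀ b)))) _)
               (cong₂ _+_ (trans (∑-* 2 (λ b → 2 * (sq (p₀ b) + sq (m₀ b)))) (cong (2 *_) (parseval g₀)))
                          (trans (∑-* 2 (λ b → 2 * (sq (p₁ b) + sq (m₁ b)))) (cong (2 *_) (parseval g₁)))))
             (∑-const n (4 * (∑ g₀ * ∑ g₁)))) ⟩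
    2 * (v * sq (∑ g₀) + v * q₀) + 2 * (v * sq (∑ g₁) + v * q₁) + v * (4 * (∑ g₀ * ∑ g₁))
      ≡⟨ collect v (∑ g₀) (∑ g₁) q₀ q₁ ⟩
    2 * v * sq (∑ g₀ + ∑ g₁) + 2 * v * (q₀ + q₁) ∎
    where
    open ≡-Reasoning
    sq : ℕ → ℕ
    sq a = a * a
    v = 2 ^ n
    g₀ g₁ : 𝔽₂^ n → ℕ
    g₀ x = g (false ∷ x)
    g₁ x = g (true ∷ x)
    q₀ = ∑ (λ x → g₀ x * g₀ x)
    q₁ = ∑ (λ x → g₁ x * g₁ x)
    p₀ p₁ m₀ m₁ m₁′ p₁′ : 𝔽₂^ n → ℕ
    p₀ b = ∑ (λ x → ⟦ on b false x ⟧ * g₀ x)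
    p₁ b = ∑ (λ x → ⟦ on b false x ⟧ * g₁ x)
    m₀ b = ∑ (λ x → ⟦ on b true x ⟧ * g₀ x)
    m₁ b = ∑ (λ x → ⟦ on b true x ⟧ * g₁ x)
    m₁′ b = ∑ (λ x → ⟦ on (true ∷ b) false (true ∷ x) ⟧ * g₁ x)
    p₁′ b = ∑ (λ x → ⟦ on (true ∷ b) true (true ∷ x) ⟧ * g₁ x)
    flip : ∀ c s → not (c xor not s) ≡ not (not c xor s)
    flip true  s = cong not (Bool.not-involutive s)
    flip false s = refl
    expand : ∀ p₀ p₁ m₀ m₁ →
      2 * ((p₀ + p₁) * (p₀ + p₁) + (m₀ + m₁) * (m₀ + m₁)) + 2 * ((p₀ + m₁) * (p₀ + m₁) + (m₀ + p₁) * (m₀ + p₁)) ≡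
      2 * (2 * (p₀ * p₀ + m₀ * m₀)) + 2 * (2 * (p₁ * p₁ + m₁ * m₁)) + 4 * ((p₀ + m₀) * (p₁ + m₁))
    expand = solve-∀
    collect : ∀ v s₀ s₁ q₀ q₁ →
      2 * (v * (s₀ * s₀) + v * q₀) + 2 * (v * (s₁ * s₁) + v * q₁) + v * (4 * (s₀ * s₁)) ≡
      2 * v * ((s₀ + s₁) * (s₀ + s₁)) + 2 * v * (q₀ + q₁)
    collect = solve-∀

  -- Gluing polynomials given on hyperplanes

  scale : ∀ {n} → 𝔽₂ → 𝔽₂^ n → 𝔽₂^ n
  scale true  e = e
  scale false e = 𝟎

  scale-xor : ∀ {n} s t (e : 𝔽₂^ n) → scale (s xor t) e ≡ scale s e ⊕ scale t e
  scale-xor false t     e = sym (⊕-identityˡ (scale t e))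
  scale-xor true  false e = sym (⊕-identityʳ e)
  scale-xor true  true  e = sym (⊕-same e)

  ·-scale : ∀ {n} (b : 𝔽₂^ n) s e → b · scale s e ≡ s ∧ (b · e)
  ·-scale b true  e = refl
  ·-scale b false e = ·-𝟎ʳ b

  -- When `b · e` is true, `π` projects along `e` onto the hyperplane b · x = c. Composing with it
  -- extends a function from the hyperplane to the cube without raising its order, doubles counts,
  -- and respects hyperplanes parallel to `e`.
  module Projection {n} (b : 𝔽₂^ n) (c : 𝔽₂) (e : 𝔽₂^ n) where

    π : 𝔽₂^ n → 𝔽₂^ n
    π x = x ⊕ scale (c xor (b · x)) e

    π-affine : ∀ x a → π (x ⊕ a) ≡ π x ⊕ (a ⊕ scale (b · a) e)
    π-affine x a = trans
      (cong (λ s → (x ⊕ a) ⊕ s) (trans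
        (cong (λ s → scale s e) (trans (cong (c xor_) (·-⊕ʳ b x a)) (sym (Bool.xor-assoc c (b · x) (b · a)))))
        (scale-xor (c xor (b · x)) (b · a) e)))
      (⊕-medial x a (scale (c xor (b · x)) e) (scale (b · a) e))

    Null-π : ∀ {k g} → Null k g → Null k (g ∘ π)
    Null-π = Null-∘ π (λ a → a ⊕ scale (b · a) e) π-affine

    π-fixes : ∀ {x} → b · x ≡ c → π x ≡ x
    π-fixes {x} bx = trans (cong (λ s → x ⊕ scale s e) (trans (cong (c xor_) bx) (Bool.xor-same c))) (⊕-identityʳ x)

    π-preserves : ∀ b′ → b′ · e ≡ false → ∀ x → b′ · π x ≡ b′ · x
    π-preserves b′ b′e x = trans (·-⊕ʳ b′ x _) (trans
      (cong ((b′ · x) xor_) (trans (·-scale b′ (c xor (b · x)) e) (trans (cong ((c xor (b · x)) ∧_) b′e) (Bool.∧-zeroʳ _))))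
      (Bool.xor-identityʳ _))

    module _ (be : b · e ≡ true) where

      π-on : ∀ x → b · π x ≡ c
      π-on x = trans (·-⊕ʳ b x _) (trans
        (cong ((b · x) xor_) (trans (·-scale b (c xor (b · x)) e) (trans (cong ((c xor (b · x)) ∧_) be) (Bool.∧-identityʳ _))))
        (solve 2 (λ s c → s :+ (c :+ s) := c) refl (b · x) c))

      ∑-π : ∀ φ → ∑ (λ x → φ (π x)) ≡ 2 * ∑ (λ x → ⟦ on b c x ⟧ * φ x)
      ∑-π φ = begin
        ∑ (λ x → φ (π x))                        ≡⟨ ∑-cong fibre ⟩
        ∑ (λ x → ψ x + ψ (x ⊕ e))                ≡⟨ ∑-+ ψ (λ x → ψ (x ⊕ e)) ⟩
        ∑ ψ + ∑ (λ x → ψ (x ⊕ e))                ≡⟨ cong (∑ ψ +_) (trans (∑-translate e ψ) (sym (+-identityʳ (∑ ψ)))) ⟩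
        2 * ∑ ψ                                  ∎
        where
        open ≡-Reasoning
        ψ : 𝔽₂^ n → ℕ
        ψ x = ⟦ on b c x ⟧ * φ x
        choose : ∀ x s → φ (x ⊕ scale s e) ≡ ⟦ not s ⟧ * φ x + ⟦ not (not s) ⟧ * φ (x ⊕ e)
        choose x false = trans (cong φ (⊕-identityʳ x)) (sym (trans (+-identityʳ _) (+-identityʳ _)))
        choose x true  = sym (+-identityʳ _)
        fibre : ∀ x → φ (π x) ≡ ψ x + ψ (x ⊕ e)
        fibre x = trans (choose x (c xor (b · x))) (cong (λ s → ψ x + ⟦ not s ⟧ * φ (x ⊕ e))
          (trans (not-xor c (b · x)) (cong (c xor_) (trans (Bool.xor-comm true (b · x)) (trans (cong ((b · x) xor_) (sym be)) (sym (·-⊕ʳ b x e)))))))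
          where
          not-xor : ∀ p q → not (p xor q) ≡ p xor not q
          not-xor false q = refl
          not-xor true  q = refl

  -- `D e g` has order one less and vanishes on the remaining hyperplanes, which are parallel to
  -- `e`; so it is zero by induction. Then `g` is invariant along `e`, and `x` or `x ⊕ e` lies on
  -- the first hyperplane.
  rigid : ∀ {n} (c : 𝔽₂^ n → 𝔽₂) {bs} → Independent bs → ∀ g → Null (length bs) g →
          All (λ b → ∀ x → b · x ≡ c b → g x ≡ false) bs → ∀ x → g x ≡ false
  rigid c [] g (zero null) [] = null
  rigid c {b ∷ bs} (extend e be ⟂e ind) g (suc null) (on-b ∷ on-bs) x with b · x Bool.≟ c b
  ... | yes bx = on-b x bx
  ... | no ¬bx = trans (xor≡false (rigid c ind (D e g) (null e) (All.zipWith step (⟂e , on-bs)) x))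
                       (on-b (x ⊕ e) (trans (·-⊕ʳ b x e) (trans (cong ((b · x) xor_) be) (complement ¬bx))))
    where
    complement : ∀ {p q} → p ≢ q → p xor true ≡ q
    complement {false} {false} p≢q = ⊥-elim (p≢q refl)
    complement {false} {true}  _   = refl
    complement {true}  {false} _   = refl
    complement {true}  {true}  p≢q = ⊥-elim (p≢q refl)
    step : ∀ {b′} → (b′ · e ≡ false) × (∀ x → b′ · x ≡ c b′ → g x ≡ false) → ∀ x → b′ · x ≡ c b′ → D e g x ≡ false
    step {b′} (b′e , on-b′) x b′x = cong₂ _xor_ (on-b′ x b′x)
      (on-b′ (x ⊕ e) (trans (·-⊕ʳ b′ x e) (trans (cong₂ _xor_ b′x b′e) (Bool.xor-identityʳ (c b′)))))

  -- The P b agree where their hyperplanes b · x = c b meet, because both are close to f there and distinct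
  -- polynomials of low degree are far apart. This allows gluing along one more hyperplane at a time.
  module Gluing {n} k (f : 𝔽₂^ n → 𝔽₂) (good c : 𝔽₂^ n → 𝔽₂) (P : 𝔽₂^ n → 𝔽₂^ n → 𝔽₂)
    (good-≢𝟎 : ∀ {b} → good b ≡ true → b ≢ 𝟎)
    (null : ∀ {b} → good b ≡ true → Null k (P b))
    (close : ∀ {b} → good b ≡ true → 8 * 2 ^ k * ∑ (λ x → ⟦ on b (c b) x ⟧ * ⟦ (f ⊞ P b) x ⟧) ≤ 2 ^ n)
    where

    error : 𝔽₂^ n → ℕ
    error b = ∑ (λ x → ⟦ on b (c b) x ⟧ * ⟦ (f ⊞ P b) x ⟧)

    -- After composition with the two projections the difference `g` lives on the whole cube, and
    -- its support on the intersection is counted four times. A nonzero `g` would need support 2 ·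
    -- 2ⁿ / 2ᵏ, but two errors of at most 2ⁿ / (8 · 2ᵏ) allow only 2ⁿ / 2ᵏ. `B.π` is applied last
    -- since it stays inside b′ · x = c b′.
    consistent : ∀ {b b′ e} → good b ≡ true → good b′ ≡ true → b · e ≡ true → b′ · e ≡ false →
                 ∀ {x} → b · x ≡ c b → b′ · x ≡ c b′ → P b x ≡ P b′ x
    consistent {b} {b′} {e} gb gb′ be b′e {x} bx b′x with nonzero-dual b′ | true? ((P b ⊞ P b′) x)
    ... | _                | inj₁ same   = xor≡false same
    ... | inj₁ b′≡𝟎        | inj₂ _      = ⊥-elim (good-≢𝟎 gb′ b′≡𝟎)
    ... | inj₂ (e′ , b′e′) | inj₂ differ = ⊥-elim (<-irrefl refl (begin-strict
      2 ^ n                  <⟨ m<m+n (2 ^ n) (m^n>0 2 n) ⟩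
      2 ^ n + 2 ^ n          ≡⟨ cong (2 ^ n +_) (sym (+-identityʳ (2 ^ n))) ⟩
      2 * 2 ^ n              ≤⟨ min-distance k (g ∘ B.π ∘ B′.π) (B′.Null-π (B.Null-π (Null-⊞ (null gb) (null gb′)))) x
                                  (trans (cong (g ∘ B.π) (B′.π-fixes b′x)) (trans (cong g (B.π-fixes bx)) differ)) ⟩
      2 ^ k * # (g ∘ B.π ∘ B′.π)                            ≡⟨ cong (2 ^ k *_) count ⟩
      2 ^ k * (2 * (2 * ∑ (λ x → ⟦ on b (c b) x ⟧ * (⟦ on b′ (c b′) x ⟧ * ⟦ g x ⟧))))
        ≤⟨ *-monoʳ-≤ (2 ^ k) (*-monoʳ-≤ 2 (*-monoʳ-≤ 2 (≤-trans (∑-mono pointwise) (≤-reflexive (∑-+ (λ x → ⟦ on b (c b) x ⟧ * ⟦ (f ⊞ P b) x ⟧) _))))) ⟩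
      2 ^ k * (2 * (2 * (error b + error b′)))              ≤⟨ halve (2 ^ k) (error b) (error b′) (close gb) (close gb′) ⟩
      2 ^ n                                                 ∎))
      where
      open ≤-Reasoning
      module B = Projection b (c b) e
      module B′ = Projection b′ (c b′) e′
      g = P b ⊞ P b′
      count : # (g ∘ B.π ∘ B′.π) ≡ 2 * (2 * ∑ (λ x → ⟦ on b (c b) x ⟧ * (⟦ on b′ (c b′) x ⟧ * ⟦ g x ⟧)))
      count = trans (B′.∑-π b′e′ (λ x → ⟦ g (B.π x) ⟧)) (cong (2 *_) (trans
        (∑-cong (λ x → cong (λ s → ⟦ not (c b′ xor s) ⟧ * ⟦ g (B.π x) ⟧) (sym (B.π-preserves b′ b′e x))))
        (B.∑-π be (λ x → ⟦ on b′ (c b′) x ⟧ * ⟦ g x ⟧))))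
      pointwise : ∀ x → ⟦ on b (c b) x ⟧ * (⟦ on b′ (c b′) x ⟧ * ⟦ g x ⟧) ≤
                        ⟦ on b (c b) x ⟧ * ⟦ (f ⊞ P b) x ⟧ + ⟦ on b′ (c b′) x ⟧ * ⟦ (f ⊞ P b′) x ⟧
      pointwise x = triangle (on b (c b) x) (on b′ (c b′) x) (f x) (P b x) (P b′ x)
        where
        triangle : ∀ p q r s t → ⟦ p ⟧ * (⟦ q ⟧ * ⟦ s xor t ⟧) ≤ ⟦ p ⟧ * ⟦ r xor s ⟧ + ⟦ q ⟧ * ⟦ r xor t ⟧
        triangle false q     r     s     t     = z≤n
        triangle true  false r     s     t     = z≤n
        triangle true  true  r     false false = z≤n
        triangle true  true  r     true  true  = z≤n
        triangle true  true  false true  false = ≤-refl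
        triangle true  true  true  true  false = ≤-refl
        triangle true  true  false false true  = ≤-refl
        triangle true  true  true  false true  = ≤-refl
      halve : ∀ t u u′ {v} → 8 * t * u ≤ v → 8 * t * u′ ≤ v → t * (2 * (2 * (u + u′))) ≤ v
      halve t u u′ {v} le le′ = *-cancelˡ-≤ 2 (≤-trans (≤-reflexive (arrange t u u′))
        (≤-trans (+-mono-≤ le le′) (≤-reflexive (cong (v +_) (sym (+-identityʳ v))))))
        where
        arrange : ∀ t u u′ → 2 * (t * (2 * (2 * (u + u′)))) ≡ 8 * t * u + 8 * t * u′
        arrange = solve-∀

    Agrees : (𝔽₂^ n → 𝔽₂) → 𝔽₂^ n → Set
    Agrees p b = ∀ x → b · x ≡ c b → p x ≡ P b x

    -- The correction is `P b ⊞ p` pulled back along the projection to the new hyperplane. On an old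
    -- hyperplane it vanishes: the projection lands in the intersection, where `p` equals the old
    -- polynomial and `consistent` equates it with `P b`.
    glue : ∀ {bs} → Independent bs → All (λ b → good b ≡ true) bs → ∃[ p ] (Null k p × All (Agrees p) bs)
    glue [] [] = (λ _ → false) , Null-≤ z≤n (zero (λ _ → refl)) , []
    glue {b ∷ bs} (extend e be ⟂e ind) (gb ∷ gbs) with glue ind gbs
    ... | p , null-p , agrees =
      p ⊞ ((P b ⊞ p) ∘ π)
      , Null-⊞ null-p (Null-π (Null-⊞ (null gb) null-p))
      , (λ x bx → trans (cong (λ y → p x xor (P b y xor p y)) (π-fixes bx))
          (solve 2 (λ s t → s :+ (t :+ s) := t) refl (p x) (P b x)))
      ∷ All.zipWith old (All.zip (⟂e , gbs) , agrees)
      where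
      open Projection b (c b) e
      old : ∀ {b′} → ((b′ · e ≡ false) × (good b′ ≡ true)) × Agrees p b′ → Agrees (p ⊞ ((P b ⊞ p) ∘ π)) b′
      old {b′} ((b′e , gb′) , agrees′) x b′x = trans
        (cong (p x xor_) (trans (cong (_xor p (π x)) (trans (consistent gb gb′ be b′e (π-on be x) b′πx) (sym (agrees′ (π x) b′πx))))
          (Bool.xor-same (p (π x)))))
        (trans (Bool.xor-identityʳ (p x)) (agrees′ x b′x))
        where
        b′πx : b′ · π x ≡ c b′
        b′πx = trans (π-preserves b′ b′e x) b′x

    -- Gluing once more with any further good `b` gives some `p′`, and `rigid` forces p′ = p because
    -- they already agree on `k` independent hyperplanes. So one `p` serves all good `b` outside the
    -- span.
    glue-unique : ∀ {bs} → Independent bs → length bs ≡ k → All (λ b → good b ≡ true) bs →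
                  ∃[ p ] (Null k p × (∀ {b e} → good b ≡ true → b · e ≡ true → bs ⟂ e → Agrees p b))
    glue-unique {bs} ind refl gbs with glue ind gbs
    ... | p , null-p , agrees = p , null-p , λ {b} {e} gb be ⟂e x bx → agree gb be ⟂e bx
      where
      agree : ∀ {b e} → good b ≡ true → b · e ≡ true → bs ⟂ e → ∀ {x} → b · x ≡ c b → p x ≡ P b x
      agree {b} {e} gb be ⟂e {x} bx = compare (glue (extend e be ⟂e ind) (gb ∷ gbs))
        where
        compare : ∃[ p′ ] (Null k p′ × All (Agrees p′) (b ∷ bs)) → p x ≡ P b x
        compare (p′ , null-p′ , agrees-b ∷ agrees′) = trans
          (xor≡false (rigid c ind (p ⊞ p′) (Null-⊞ null-p null-p′)
            (All.zipWith (λ {b′} (q , q′) y by → trans (cong₂ _xor_ (q y by) (q′ y by)) (Bool.xor-same (P b′ y))) (agrees , agrees′)) x))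
          (agrees-b x bx)

    outside : ∀ {bs} → Independent bs → 𝔽₂^ n → 𝔽₂
    outside ind b with dual ind b
    ... | inj₁ _ = false
    ... | inj₂ _ = true

    outside-dual : ∀ {bs} (ind : Independent bs) b → outside ind b ≡ true → ∃[ e ] (b · e ≡ true × bs ⟂ e)
    outside-dual ind b out with dual ind b
    ... | inj₂ found = found

    #good≤ : ∀ {bs} (ind : Independent bs) → # good ≤ # (λ b → good b ∧ outside ind b) + 2 ^ length bs
    #good≤ {bs} ind = begin
      # good                                        ≤⟨ ∑-mono (λ b → split (good b) (outside ind b)) ⟩
      ∑ (λ b → ⟦ good b ∧ outside ind b ⟧ + ⟦ not (outside ind b) ⟧)
        ≡⟨ ∑-+ (λ b → ⟦ good b ∧ outside ind b ⟧) (λ b → ⟦ not (outside ind b) ⟧) ⟩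
      # (λ b → good b ∧ outside ind b) + # (not ∘ outside ind)
        ≤⟨ +-monoʳ-≤ _ (≤-trans (#≤length (not ∘ outside ind) (span bs) covered) (≤-reflexive (length-span bs))) ⟩
      # (λ b → good b ∧ outside ind b) + 2 ^ length bs ∎
      where
      open ≤-Reasoning
      split : ∀ p q → ⟦ p ⟧ ≤ ⟦ p ∧ q ⟧ + ⟦ not q ⟧
      split false q     = z≤n
      split true  false = ≤-refl
      split true  true  = ≤-refl
      covered : ∀ b → not (outside ind b) ≡ true → b ∈ span bs
      covered b eq with dual ind b
      ... | inj₁ b∈ = b∈

    -- Greedy choice: `j` functionals span only 2ʲ elements, fewer than the good ones available.
    independent-good : ∀ j → 2 ^ j ≤ # good →
                       ∃[ bs ] (Independent bs × length bs ≡ j × All (λ b → good b ≡ true) bs)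
    independent-good zero    _    = [] , [] , refl , []
    independent-good (suc j) many with independent-good j (≤-trans (m≤m+n (2 ^ j) _) many)
    ... | bs , ind , refl , gbs with #-positive (λ b → good b ∧ outside ind b) (+-cancelʳ-< (2 ^ length bs) 0 _ (begin-strict
          2 ^ length bs        <⟨ m<m+n (2 ^ length bs) (m^n>0 2 (length bs)) ⟩
          2 ^ length bs + 2 ^ length bs
                               ≡⟨ cong (2 ^ length bs +_) (sym (+-identityʳ _)) ⟩
          2 ^ suc (length bs)  ≤⟨ many ⟩
          # good               ≤⟨ #good≤ ind ⟩
          # (λ b → good b ∧ outside ind b) + 2 ^ length bs ∎))
      where open ≤-Reasoning
    ...   | b , both with outside-dual ind b (∧-right (good b) both)
    ...     | e , be , ⟂e = b ∷ bs , extend e be ⟂e ind , refl , ∧-left both ∷ gbs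
      where
      ∧-left : ∀ {p q} → p ∧ q ≡ true → p ≡ true
      ∧-left {true} _ = refl

    -- If p were far from f, its error set would be unbalanced on too many hyperplanes for Parseval.
    locally-close⇒close : 17 * 2 ^ k ≤ # good → ∃[ p ] (Null k p × 2 * (2 ^ k * # (f ⊞ p)) ≤ 2 ^ n)
    locally-close⇒close many with independent-good k (≤-trans (m≤m+n (2 ^ k) _) many)
    ... | bs , ind , len , gbs with glue-unique ind len gbs
    ...   | p , null-p , agrees = p , null-p , ≮⇒≥ (λ far → <-irrefl refl (begin-strict
        2 ^ n * 8                                       ≡⟨ *-comm (2 ^ n) 8 ⟩
        8 * 2 ^ n                                       <⟨ *-monoʳ-< 8 far ⟩
        8 * (2 * (2 ^ k * E))                           ≡⟨ arrange (2 ^ k) E ⟩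
        16 * 2 ^ k * E                                  ≤⟨ *-monoˡ-≤ E many′ ⟩
        # good′ * E                                     ≤⟨ *-cancelʳ-≤ _ _ E {{≢-nonZero (positive far)}} (bound far) ⟩
        2 ^ n * 8                                       ∎))
      where
      open ≤-Reasoning
      E = # (f ⊞ p)
      good′ : 𝔽₂^ n → 𝔽₂
      good′ b = good b ∧ outside ind b
      positive : 2 ^ n < 2 * (2 ^ k * E) → E ≢ 0
      positive far E≡0 = n≮0 (subst (2 ^ n <_) (trans (cong (λ e → 2 * (2 ^ k * e)) E≡0) (cong (2 *_) (*-zeroʳ (2 ^ k)))) far)
      arrange : ∀ t e → 8 * (2 * (t * e)) ≡ 16 * t * e
      arrange = solve-∀
      -- One of the 17 multiples of 2ᵏ pays for the span of the `k` chosen functionals, on which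
      -- `glue-unique` is silent.
      many′ : 16 * 2 ^ k ≤ # good′
      many′ = +-cancelʳ-≤ (2 ^ k) _ _ (≤-trans (≤-reflexive (seventeen (2 ^ k)))
        (≤-trans many (subst (λ l → # good ≤ # good′ + 2 ^ l) len (#good≤ ind))))
        where
        seventeen : ∀ t → 16 * t + t ≡ 17 * t
        seventeen = solve-∀
      e₀ e₁ : 𝔽₂^ n → ℕ
      e₀ b = ∑ (λ x → ⟦ on b false x ⟧ * ⟦ (f ⊞ p) x ⟧)
      e₁ b = ∑ (λ x → ⟦ on b true x ⟧ * ⟦ (f ⊞ p) x ⟧)
      eᶜ : 𝔽₂ → 𝔽₂^ n → ℕ
      eᶜ s b = ∑ (λ x → ⟦ on b s x ⟧ * ⟦ (f ⊞ p) x ⟧)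
      -- On this side `p` agrees with `P b`, so the error is at most 2ⁿ / (8 · 2ᵏ), a quarter of the
      -- lower bound 2ⁿ / (2 · 2ᵏ) that `far` gives for `E`.
      small : 2 ^ n < 2 * (2 ^ k * E) → ∀ b → good′ b ≡ true → 4 * eᶜ (c b) b ≤ E
      small far b both with good b in gb
      ... | true with outside-dual ind b both
      ...   | e , be , ⟂e = <⇒≤ (*-cancelˡ-< (2 * 2 ^ k) _ _ (begin-strict
        2 * 2 ^ k * (4 * eᶜ (c b) b)    ≡⟨ eight (2 ^ k) (eᶜ (c b) b) ⟩
        8 * 2 ^ k * eᶜ (c b) b          ≡⟨ cong (8 * 2 ^ k *_) (∑-cong transfer) ⟩
        8 * 2 ^ k * error b             ≤⟨ close gb ⟩
        2 ^ n                           <⟨ far ⟩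
        2 * (2 ^ k * E)                 ≡⟨ sym (*-assoc 2 (2 ^ k) E) ⟩
        2 * 2 ^ k * E                   ∎))
        where
        eight : ∀ t u → 2 * t * (4 * u) ≡ 8 * t * u
        eight = solve-∀
        transfer : ∀ x → ⟦ on b (c b) x ⟧ * ⟦ f x xor p x ⟧ ≡ ⟦ on b (c b) x ⟧ * ⟦ f x xor P b x ⟧
        transfer x with c b xor (b · x) in eq
        ... | true  = refl
        ... | false = cong (λ s → 1 * ⟦ f x xor s ⟧) (agrees gb be ⟂e x (sym (xor≡false eq)))
      -- With at most a quarter on one side the larger square alone is 9/16 of s², while `balanced`
      -- guarantees 8/16 in general. This excess of 1/16 is what each good functional contributes.
      unbalanced : ∀ u w s → u + w ≡ s → 4 * u ≤ s → 9 * (s * s) ≤ 16 * (u * u + w * w)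
      unbalanced u w s sum 4u≤s = begin
        9 * (s * s)                   ≡⟨ nine s ⟩
        (3 * s) * (3 * s)             ≤⟨ *-mono-≤ 3s≤4w 3s≤4w ⟩
        (4 * w) * (4 * w)             ≡⟨ sixteen w ⟩
        16 * (w * w)                  ≤⟨ *-monoʳ-≤ 16 (m≤n+m (w * w) (u * u)) ⟩
        16 * (u * u + w * w)          ∎
        where
        nine : ∀ s → 9 * (s * s) ≡ (3 * s) * (3 * s)
        nine = solve-∀
        sixteen : ∀ w → (4 * w) * (4 * w) ≡ 16 * (w * w)
        sixteen = solve-∀
        3s≤4w : 3 * s ≤ 4 * w
        3s≤4w = ≤-cert 0 4u≤s (trans (sym (*-distribˡ-+ 4 w u)) (trans (cong (4 *_) (trans (+-comm w u) sum)) (four s)))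
          where
          four : ∀ s → 4 * s ≡ 3 * s + s + 0
          four = solve-∀
      balanced : ∀ u w s → u + w ≡ s → 8 * (s * s) ≤ 16 * (u * u + w * w)
      balanced u w s refl with ≤-total u w
      ... | inj₁ u≤w = subst (λ w → 8 * ((u + w) * (u + w)) ≤ 16 * (u * u + w * w)) (m+[n∸m]≡n u≤w) (convex u (w ∸ u))
        where
        convex : ∀ u v → 8 * ((u + (u + v)) * (u + (u + v))) ≤ 16 * (u * u + (u + v) * (u + v))
        convex u v = ≤-trans (m≤m+n _ (8 * (v * v))) (≤-reflexive (identity u v))
          where
          identity : ∀ u v → 8 * ((u + (u + v)) * (u + (u + v))) + 8 * (v * v) ≡ 16 * (u * u + (u + v) * (u + v))
          identity = solve-∀
      ... | inj₂ w≤u = subst (λ u → 8 * ((u + w) * (u + w)) ≤ 16 * (u * u + w * w)) (m+[n∸m]≡n w≤u) (convex w (u ∸ w))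
        where
        convex : ∀ w v → 8 * (((w + v) + w) * ((w + v) + w)) ≤ 16 * ((w + v) * (w + v) + w * w)
        convex w v = ≤-trans (m≤m+n _ (8 * (v * v))) (≤-reflexive (identity w v))
          where
          identity : ∀ w v → 8 * (((w + v) + w) * ((w + v) + w)) + 8 * (v * v) ≡ 16 * ((w + v) * (w + v) + w * w)
          identity = solve-∀
      pointwise : 2 ^ n < 2 * (2 ^ k * E) → ∀ b → 8 * (E * E) + E * E * ⟦ good′ b ⟧ ≤ 8 * (2 * (e₀ b * e₀ b + e₁ b * e₁ b))
      pointwise far b = ≤-trans (split (good′ b) refl) (≤-reflexive (*-assoc 8 2 (e₀ b * e₀ b + e₁ b * e₁ b)))
        where
        split : ∀ s → good′ b ≡ s → 8 * (E * E) + E * E * ⟦ s ⟧ ≤ 16 * (e₀ b * e₀ b + e₁ b * e₁ b)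
        split false _  = ≤-trans (≤-reflexive (trans (cong (8 * (E * E) +_) (*-zeroʳ (E * E))) (+-identityʳ _)))
                           (balanced (e₀ b) (e₁ b) E (∑-on b (λ x → ⟦ (f ⊞ p) x ⟧)))
        split true  gb = ≤-trans (≤-reflexive (trans (cong (8 * (E * E) +_) (*-identityʳ (E * E))) (+-comm _ (E * E)))) (side (c b) (small far b gb))
          where
          side : ∀ s → 4 * eᶜ s b ≤ E → 9 * (E * E) ≤ 16 * (e₀ b * e₀ b + e₁ b * e₁ b)
          side false le = unbalanced (e₀ b) (e₁ b) E (∑-on b (λ x → ⟦ (f ⊞ p) x ⟧)) le
          side true  le = ≤-trans (unbalanced (e₁ b) (e₀ b) E (trans (+-comm (e₁ b) (e₀ b)) (∑-on b (λ x → ⟦ (f ⊞ p) x ⟧))) le)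
            (≤-reflexive (cong (16 *_) (+-comm (e₁ b * e₁ b) (e₀ b * e₀ b))))
      bound : 2 ^ n < 2 * (2 ^ k * E) → # good′ * E * E ≤ 2 ^ n * 8 * E
      bound far = +-cancelˡ-≤ (2 ^ n * (8 * (E * E))) _ _ (begin
        2 ^ n * (8 * (E * E)) + # good′ * E * E
          ≡⟨ cong₂ _+_ (sym (∑-const n (8 * (E * E)))) (trans (*-assoc (# good′) E E) (trans (*-comm (# good′) (E * E)) (sym (∑-* (E * E) (λ b → ⟦ good′ b ⟧))))) ⟩
        ∑ {n} (λ _ → 8 * (E * E)) + ∑ (λ b → E * E * ⟦ good′ b ⟧)
          ≡⟨ sym (∑-+ {n} (λ _ → 8 * (E * E)) (λ b → E * E * ⟦ good′ b ⟧)) ⟩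
        ∑ (λ b → 8 * (E * E) + E * E * ⟦ good′ b ⟧)
          ≤⟨ ∑-mono (pointwise far) ⟩
        ∑ (λ b → 8 * (2 * (e₀ b * e₀ b + e₁ b * e₁ b)))
          ≡⟨ trans (∑-* 8 (λ b → 2 * (e₀ b * e₀ b + e₁ b * e₁ b))) (cong (8 *_) (parseval (λ x → ⟦ (f ⊞ p) x ⟧))) ⟩
        8 * (2 ^ n * (E * E) + 2 ^ n * ∑ (λ x → ⟦ (f ⊞ p) x ⟧ * ⟦ (f ⊞ p) x ⟧))
          ≡⟨ cong (λ q → 8 * (2 ^ n * (E * E) + 2 ^ n * q)) (∑-cong (λ x → ⟦⟧² ((f ⊞ p) x))) ⟩
        8 * (2 ^ n * (E * E) + 2 ^ n * E)
          ≡⟨ collect (2 ^ n) E ⟩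
        2 ^ n * (8 * (E * E)) + 2 ^ n * 8 * E ∎)
        where
        collect : ∀ v e → 8 * (v * (e * e) + v * e) ≡ v * (8 * (e * e)) + v * 8 * e
        collect = solve-∀

  -- Probabilities

  ∑ᴸ : ∀ {X : Set} → List X → (X → ℕ) → ℕ
  ∑ᴸ []       φ = 0
  ∑ᴸ (x ∷ xs) φ = φ x + ∑ᴸ xs φ

  ∑ᴸ-++ : ∀ {X : Set} (xs ys : List X) φ → ∑ᴸ (xs ++ ys) φ ≡ ∑ᴸ xs φ + ∑ᴸ ys φ
  ∑ᴸ-++ []       ys φ = refl
  ∑ᴸ-++ (x ∷ xs) ys φ = trans (cong (φ x +_) (∑ᴸ-++ xs ys φ)) (sym (+-assoc (φ x) (∑ᴸ xs φ) (∑ᴸ ys φ)))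

  ∑ᴸ-map : ∀ {X Y : Set} (g : X → Y) xs φ → ∑ᴸ (map g xs) φ ≡ ∑ᴸ xs (φ ∘ g)
  ∑ᴸ-map g []       φ = refl
  ∑ᴸ-map g (x ∷ xs) φ = cong (φ (g x) +_) (∑ᴸ-map g xs φ)

  ∑ᴸ-cong : ∀ {X : Set} (xs : List X) {φ ψ} → (∀ x → φ x ≡ ψ x) → ∑ᴸ xs φ ≡ ∑ᴸ xs ψ
  ∑ᴸ-cong []       eq = refl
  ∑ᴸ-cong (x ∷ xs) eq = cong₂ _+_ (eq x) (∑ᴸ-cong xs eq)

  length-filter : ∀ {X : Set} {P : Pred X 0ℓ} (P? : Decidable P) xs →
                  length (filter P? xs) ≡ ∑ᴸ xs (λ x → ⟦ does (P? x) ⟧)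
  length-filter P? []       = refl
  length-filter P? (x ∷ xs) with does (P? x)
  ... | true  = cong suc (length-filter P? xs)
  ... | false = length-filter P? xs

  ∑ᴸ-cube : ∀ {n} (φ : 𝔽₂^ n → ℕ) → ∑ᴸ (toList (cube n)) φ ≡ ∑ φ
  ∑ᴸ-cube {zero}  φ = +-identityʳ (φ [])
  ∑ᴸ-cube {suc n} φ = trans
    (∑ᴸ-++ (map (false ∷_) xs) (map (true ∷_) xs ++ []) φ)
    (cong₂ _+_ (trans (∑ᴸ-map (false ∷_) xs φ) (∑ᴸ-cube (λ x → φ (false ∷ x))))
      (trans (cong (λ ys → ∑ᴸ ys φ) (List.++-identityʳ (map (true ∷_) xs)))
        (trans (∑ᴸ-map (true ∷_) xs φ) (∑ᴸ-cube (λ x → φ (true ∷ x))))))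
    where xs = toList (cube n)

  ∑ᴸ-concatMap : ∀ {X Y : Set} (F : X → List⁺ Y) xs φ →
                 ∑ᴸ (toList (List⁺.concatMap F xs)) φ ≡ ∑ᴸ (toList xs) (λ x → ∑ᴸ (toList (F x)) φ)
  ∑ᴸ-concatMap F (x ∷ xs) φ = trans (∑ᴸ-++ (toList (F x)) (concat (map toList (map F xs))) φ) (cong (∑ᴸ (toList (F x)) φ +_) (go xs))
    where
    go : ∀ xs → ∑ᴸ (concat (map toList (map F xs))) φ ≡ ∑ᴸ xs (λ x → ∑ᴸ (toList (F x)) φ)
    go []       = refl
    go (x ∷ xs) = trans (∑ᴸ-++ (toList (F x)) (concat (map toList (map F xs))) φ) (cong (∑ᴸ (toList (F x)) φ +_) (go xs))

  ∑ᴸ-tuples : ∀ {n} k (φ : Vec (𝔽₂^ n) (suc k) → ℕ) →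
              ∑ᴸ (toList (tuples (cube n) (suc k))) φ ≡ ∑ (λ x → ∑ᴸ (toList (tuples (cube n) k)) (λ as → φ (x ∷ as)))
  ∑ᴸ-tuples {n} k φ = trans (∑ᴸ-concatMap (λ a → List⁺.map (a ∷_) (tuples (cube n) k)) (cube n) φ)
    (trans (∑ᴸ-cong (toList (cube n)) (λ a → ∑ᴸ-map (a ∷_) (toList (tuples (cube n) k)) φ))
      (∑ᴸ-cube (λ x → ∑ᴸ (toList (tuples (cube n) k)) (λ as → φ (x ∷ as)))))

  length-tuples : ∀ n k → ∑ᴸ (toList (tuples (cube n) k)) (λ _ → 1) ≡ (2 ^ n) ^ k
  length-tuples n zero    = refl
  length-tuples n (suc k) = trans (∑ᴸ-tuples k (λ _ → 1))
    (trans (∑-const n _) (cong (2 ^ n *_) (length-tuples n k)))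

  length-∑ᴸ : ∀ {X : Set} (xs : List X) → length xs ≡ ∑ᴸ xs (λ _ → 1)
  length-∑ᴸ []       = refl
  length-∑ᴸ (x ∷ xs) = cong suc (length-∑ᴸ xs)

  xorᴸ : ∀ {X : Set} → List X → (X → 𝔽₂) → 𝔽₂
  xorᴸ xs g = foldr _xor_ false (map g xs)

  xorᴸ-++ : ∀ {X : Set} (xs ys : List X) g → xorᴸ (xs ++ ys) g ≡ xorᴸ xs g xor xorᴸ ys g
  xorᴸ-++ []       ys g = refl
  xorᴸ-++ (x ∷ xs) ys g = trans (cong (g x xor_) (xorᴸ-++ xs ys g)) (sym (Bool.xor-assoc (g x) (xorᴸ xs g) (xorᴸ ys g)))

  xorᴸ-map : ∀ {X Y : Set} (h : X → Y) xs g → xorᴸ (map h xs) g ≡ xorᴸ xs (g ∘ h)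
  xorᴸ-map h xs g = cong (foldr _xor_ false) (sym (List.map-∘ xs))

  xorᴸ-xor : ∀ {X : Set} (xs : List X) g h → xorᴸ xs g xor xorᴸ xs h ≡ xorᴸ xs (λ x → g x xor h x)
  xorᴸ-xor []       g h = refl
  xorᴸ-xor (x ∷ xs) g h = trans
    (solve 4 (λ a b c d → (a :+ b) :+ (c :+ d) := (a :+ c) :+ (b :+ d)) refl (g x) (xorᴸ xs g) (h x) (xorᴸ xs h))
    (cong ((g x xor h x) xor_) (xorᴸ-xor xs g h))

  derivative-∷ : ∀ {n k} (f : 𝔽₂^ n → 𝔽₂) a (as : Vec (𝔽₂^ n) k) x → derivative f (a ∷ as) x ≡ derivative (D a f) as x
  derivative-∷ {n} {k} f a as x = begin
    xorᴸ (map (false ∷_) Js ++ map (true ∷_) Js ++ []) term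
      ≡⟨ xorᴸ-++ (map (false ∷_) Js) (map (true ∷_) Js ++ []) term ⟩
    xorᴸ (map (false ∷_) Js) term xor xorᴸ (map (true ∷_) Js ++ []) term
      ≡⟨ cong₂ (λ p ys → p xor xorᴸ ys term) (xorᴸ-map (false ∷_) Js term) (List.++-identityʳ (map (true ∷_) Js)) ⟩
    xorᴸ Js (term ∘ (false ∷_)) xor xorᴸ (map (true ∷_) Js) term
      ≡⟨ cong (xorᴸ Js (term ∘ (false ∷_)) xor_) (xorᴸ-map (true ∷_) Js term) ⟩
    xorᴸ Js (term ∘ (false ∷_)) xor xorᴸ Js (term ∘ (true ∷_))
      ≡⟨ xorᴸ-xor Js (term ∘ (false ∷_)) (term ∘ (true ∷_)) ⟩
    xorᴸ Js (λ J → f (x ⊕ subsetSum J as) xor f (x ⊕ (a ⊕ subsetSum J as)))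
      ≡⟨ cong (foldr _xor_ false) (List.map-cong (λ J → cong (λ y → f (x ⊕ subsetSum J as) xor f y)
           (trans (cong (x ⊕_) (⊕-comm a (subsetSum J as))) (sym (⊕-assoc x (subsetSum J as) a)))) Js) ⟩
    xorᴸ Js (λ J → D a f (x ⊕ subsetSum J as)) ∎
    where
    open ≡-Reasoning
    Js = toList (cube k)
    term : Subset (suc k) → 𝔽₂
    term J = f (x ⊕ subsetSum J (a ∷ as))

  R≡∑derivative : ∀ {n} k (f : 𝔽₂^ n → 𝔽₂) →
                  ∑ (λ x → ∑ᴸ (toList (tuples (cube n) k)) (λ as → ⟦ derivative f as x ⟧)) ≡ R k f
  R≡∑derivative zero f = ∑-cong (λ x → trans (+-identityʳ _)
    (cong ⟦_⟧ (trans (Bool.xor-identityʳ _) (cong f (⊕-identityʳ x)))))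
  R≡∑derivative {n} (suc k) f = begin
    ∑ (λ x → ∑ᴸ (toList (tuples (cube n) (suc k))) (λ as → ⟦ derivative f as x ⟧))
      ≡⟨ ∑-cong (λ x → ∑ᴸ-tuples k (λ as → ⟦ derivative f as x ⟧)) ⟩
    ∑ (λ x → ∑ (λ a → ∑ᴸ (toList (tuples (cube n) k)) (λ as → ⟦ derivative f (a ∷ as) x ⟧)))
      ≡⟨ ∑-swap (λ x a → ∑ᴸ (toList (tuples (cube n) k)) (λ as → ⟦ derivative f (a ∷ as) x ⟧)) ⟩
    ∑ (λ a → ∑ (λ x → ∑ᴸ (toList (tuples (cube n) k)) (λ as → ⟦ derivative f (a ∷ as) x ⟧)))
      ≡⟨ ∑-cong (λ a → trans
           (∑-cong (λ x → ∑ᴸ-cong (toList (tuples (cube n) k)) (λ as → cong ⟦_⟧ (derivative-∷ f a as x))))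
           (R≡∑derivative k (D a f))) ⟩
    ∑ (λ a → R k (D a f)) ∎
    where open ≡-Reasoning

  opaque
    ι : ℕ → ℚ
    ι a = ℤ.+ a ℚ./ 1

    toℚᵘ-frac : ∀ a m → ℚ.toℚᵘ (ℤ.+ a ℚ./ suc m) ℚᵘ.≃ ℚᵘ.mkℚᵘ (ℤ.+ a) m
    toℚᵘ-frac a m = ℚ.toℚᵘ-fromℚᵘ (ℚᵘ.mkℚᵘ (ℤ.+ a) m)

    /-ι : ∀ a N .{{_ : NonZero N}} → (ℤ.+ a ℚ./ N) ℚ.* ι N ≡ ι a
    /-ι a (suc m) = ℚ.toℚᵘ-injective (ℚᵘ.≃-trans (ℚ.toℚᵘ-homo-* (ℤ.+ a ℚ./ suc m) (ι (suc m)))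
      (ℚᵘ.≃-trans (ℚᵘ.*-cong (toℚᵘ-frac a m) (toℚᵘ-frac (suc m) 0))
        (ℚᵘ.≃-trans (ℚᵘ.*≡* (trans (ℤ.*-identityʳ _) (cong (λ s → ℤ.+ a ℤ.* ℤ.+ s) (sym (*-identityʳ (suc m))))))
          (ℚᵘ.≃-sym (toℚᵘ-frac a 0)))))

    ι-/ : ∀ a → ι a ≡ ℤ.+ a ℚ./ 1
    ι-/ a = refl

    ι-+ : ∀ a b → ι (a + b) ≡ ι a ℚ.+ ι b
    ι-+ a b = ℚ.toℚᵘ-injective (ℚᵘ.≃-trans (toℚᵘ-frac (a + b) 0)
      (ℚᵘ.≃-trans (ℚᵘ.*≡* (cong (ℤ._* ℤ.+ 1) (trans (ℤ.pos-+ a b) (sym (cong₂ ℤ._+_ (ℤ.*-identityʳ (ℤ.+ a)) (ℤ.*-identityʳ (ℤ.+ b)))))))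
        (ℚᵘ.≃-sym (ℚᵘ.≃-trans (ℚ.toℚᵘ-homo-+ (ι a) (ι b)) (ℚᵘ.+-cong (toℚᵘ-frac a 0) (toℚᵘ-frac b 0))))))

    ι-* : ∀ a b → ι (a * b) ≡ ι a ℚ.* ι b
    ι-* a b = ℚ.toℚᵘ-injective (ℚᵘ.≃-trans (toℚᵘ-frac (a * b) 0)
      (ℚᵘ.≃-trans (ℚᵘ.*≡* (cong (ℤ._* ℤ.+ 1) (ℤ.pos-* a b)))
        (ℚᵘ.≃-sym (ℚᵘ.≃-trans (ℚ.toℚᵘ-homo-* (ι a) (ι b)) (ℚᵘ.*-cong (toℚᵘ-frac a 0) (toℚᵘ-frac b 0))))))

    ι-mono-≤ : ∀ {a b} → a ≤ b → ι a ℚ.≤ ι b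
    ι-mono-≤ {a} {b} a≤b = ℚ.toℚᵘ-cancel-≤ (ℚᵘ.≤-respˡ-≃ (ℚᵘ.≃-sym (toℚᵘ-frac a 0))
      (ℚᵘ.≤-respʳ-≃ (ℚᵘ.≃-sym (toℚᵘ-frac b 0)) (ℚᵘ.*≤* (ℤ.*-monoʳ-≤-nonNeg (ℤ.+ 1) (ℤ.+≤+ a≤b)))))

    ι-mono-< : ∀ {a b} → a < b → ι a ℚ.< ι b
    ι-mono-< {a} {b} a<b = ℚ.toℚᵘ-cancel-< (ℚᵘ.<-respˡ-≃ (ℚᵘ.≃-sym (toℚᵘ-frac a 0))
      (ℚᵘ.<-respʳ-≃ (ℚᵘ.≃-sym (toℚᵘ-frac b 0)) (ℚᵘ.*<* (ℤ.*-monoʳ-<-pos (ℤ.+ 1) (ℤ.+<+ a<b)))))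

    ι-cancel-≤ : ∀ {a b} → ι a ℚ.≤ ι b → a ≤ b
    ι-cancel-≤ ιa≤ιb = ≮⇒≥ (λ b<a → ℚ.<-irrefl refl (ℚ.<-≤-trans (ι-mono-< b<a) ιa≤ιb))

    ι-cancel-< : ∀ {a b} → ι a ℚ.< ι b → a < b
    ι-cancel-< ιa<ιb = ≰⇒> (λ b≤a → ℚ.<-irrefl refl (ℚ.<-≤-trans ιa<ιb (ι-mono-≤ b≤a)))

    ι-pos : ∀ N .{{_ : NonZero N}} → ℚ.Positive (ι N)
    ι-pos (suc m) = ℚ.positive (ι-mono-< {0} {suc m} (s≤s z≤n))

  Pr-count : ∀ {Ω : Set} {P : Pred Ω 0ℓ} (ω : List⁺ Ω) (P? : Decidable P) →
             Pr ω P? ℚ.* ι (∑ᴸ (toList ω) (λ _ → 1)) ≡ ι (∑ᴸ (toList ω) (λ x → ⟦ does (P? x) ⟧))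
  Pr-count (x ∷ xs) P? = trans
    (cong₂ (λ a N → (ℤ.+ a ℚ./ suc (length xs)) ℚ.* ι N) (length-filter P? (x ∷ xs)) (sym (length-∑ᴸ (x ∷ xs))))
    (/-ι (∑ᴸ (x ∷ xs) (λ y → ⟦ does (P? y) ⟧)) (suc (length xs)))

  dist-# : ∀ {n} (f g : 𝔽₂^ n → 𝔽₂) → dist f g ℚ.* ι (2 ^ n) ≡ ι (# (f ⊞ g))
  dist-# {n} f g = trans (cong (λ N → dist f g ℚ.* ι N) (sym (trans (∑ᴸ-cube {n} (λ _ → 1)) (#-true n))))
    (trans (Pr-count (cube n) (λ x → ¬? (f x Bool.≟ g x)))
      (cong ι (trans (∑ᴸ-cube (λ x → ⟦ does (¬? (f x Bool.≟ g x)) ⟧)) (∑-cong (λ x → cong ⟦_⟧ (≢-xor (f x) (g x)))))))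
    where
    ≢-xor : ∀ p q → does (¬? (p Bool.≟ q)) ≡ p xor q
    ≢-xor false false = refl
    ≢-xor false true  = refl
    ≢-xor true  false = refl
    ≢-xor true  true  = refl

  rejects-R : ∀ {n} k (f : 𝔽₂^ n → 𝔽₂) → Pr[rejects] k f ℚ.* ι ((2 ^ n) ^ suc k) ≡ ι (R k f)
  rejects-R {n} k f = trans (cong (λ N → Pr[rejects] k f ℚ.* ι N) (sym (length-tuples n (suc k))))
    (trans (Pr-count (tuples (cube n) (suc k)) (λ t → ¬? (accepts? k f t)))
      (cong ι (trans (∑ᴸ-tuples k (λ t → ⟦ does (¬? (accepts? k f t)) ⟧))
        (trans (∑-cong (λ x → ∑ᴸ-cong (toList (tuples (cube n) k)) (λ as → cong ⟦_⟧ (≢false (derivative f as x)))))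
          (R≡∑derivative k f)))))
    where
    ≢false : ∀ p → does (¬? (p Bool.≟ false)) ≡ p
    ≢false false = refl
    ≢false true  = refl

  accepts+rejects : ∀ {n} k (f : 𝔽₂^ n → 𝔽₂) → Pr[accepts] k f ℚ.+ Pr[rejects] k f ≡ 1ℚ
  accepts+rejects {n} k f = ℚ.≤-antisym (cancel (ℚ.≤-reflexive scaled)) (cancel (ℚ.≤-reflexive (sym scaled)))
    where
    ω = tuples (cube n) (suc k)
    N = (2 ^ n) ^ suc k
    instance
      N≢0 : NonZero N
      N≢0 = m^n≢0 (2 ^ n) (suc k) {{m^n≢0 2 n}}
    cancel : ∀ {p q} → p ℚ.* ι N ℚ.≤ q ℚ.* ι N → p ℚ.≤ q
    cancel = ℚ.*-cancelʳ-≤-pos (ι N) {{ι-pos N}}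
    ∑ᴸ-+ : ∀ {X : Set} (xs : List X) φ ψ → ∑ᴸ xs φ + ∑ᴸ xs ψ ≡ ∑ᴸ xs (λ x → φ x + ψ x)
    ∑ᴸ-+ []       φ ψ = refl
    ∑ᴸ-+ (x ∷ xs) φ ψ = trans (medial (φ x) (∑ᴸ xs φ) (ψ x) (∑ᴸ xs ψ)) (cong (φ x + ψ x +_) (∑ᴸ-+ xs φ ψ))
      where
      medial : ∀ a b c d → a + b + (c + d) ≡ a + c + (b + d)
      medial = solve-∀
    one : ∀ t → ⟦ does (accepts? k f t) ⟧ + ⟦ does (¬? (accepts? k f t)) ⟧ ≡ 1
    one t with does (accepts? k f t)
    ... | true  = refl
    ... | false = refl
    scaled : (Pr[accepts] k f ℚ.+ Pr[rejects] k f) ℚ.* ι N ≡ 1ℚ ℚ.* ι N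
    scaled = trans (cong (λ M → (Pr[accepts] k f ℚ.+ Pr[rejects] k f) ℚ.* ι M) (sym (length-tuples n (suc k))))
      (trans (ℚ.*-distribʳ-+ (ι (∑ᴸ (toList ω) (λ _ → 1))) (Pr[accepts] k f) (Pr[rejects] k f))
        (trans (cong₂ ℚ._+_ (Pr-count ω (accepts? k f)) (Pr-count ω (λ t → ¬? (accepts? k f t))))
          (trans (sym (ι-+ (∑ᴸ (toList ω) (λ t → ⟦ does (accepts? k f t) ⟧)) _))
            (trans (cong ι (trans (∑ᴸ-+ (toList ω) (λ t → ⟦ does (accepts? k f t) ⟧) _)
                     (trans (∑ᴸ-cong (toList ω) one) (length-tuples n (suc k)))))
              (sym (ℚ.*-identityˡ (ι N)))))))

  Nearest : ∀ {n} → ℕ → (𝔽₂^ n → 𝔽₂) → Set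
  Nearest {n} d f = ∃[ p ] (Null (suc d) p × (∀ q → Null (suc d) q → # (f ⊞ p) ≤ # (f ⊞ q)) × δ d f ℚ.* ι (2 ^ n) ≡ ι (# (f ⊞ p)))

  opaque
    nearest : ∀ {n} d (f : 𝔽₂^ n → 𝔽₂) → Nearest d f
    nearest {n} d f = build (δ-attained d f)
      where
      instance
        2^n≢0 : NonZero (2 ^ n)
        2^n≢0 = m^n≢0 2 n
      build : ∃[ p ] (deg p ≤ d × δ d f ≡ dist f p) → Nearest d f
      build (p , deg≤d , δ≡) = p , deg≤⇒Null p deg≤d , minimal , scaled
        where
        scaled : δ d f ℚ.* ι (2 ^ n) ≡ ι (# (f ⊞ p))
        scaled = trans (cong (ℚ._* ι (2 ^ n)) δ≡) (dist-# f p)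
        minimal : ∀ q → Null (suc d) q → # (f ⊞ p) ≤ # (f ⊞ q)
        minimal q null = ι-cancel-≤ (subst₂ ℚ._≤_ scaled (dist-# f q)
          (ℚ.*-monoʳ-≤-nonNeg (ι (2 ^ n)) {{ℚ.pos⇒nonNeg (ι (2 ^ n)) {{ι-pos (2 ^ n)}}}} (δ-minimal d f q (Null⇒deg≤ q null))))

  -- Induction on the dimension

  #-⊞-self : ∀ {n} (f : 𝔽₂^ n → 𝔽₂) → # (f ⊞ f) ≡ 0
  #-⊞-self f = #-false (λ x → Bool.xor-same (f x))

  *-^ : ∀ a b m → (a * b) ^ m ≡ a ^ m * b ^ m
  *-^ a b zero    = refl
  *-^ a b (suc m) = trans (cong (a * b *_) (*-^ a b m)) (exchange a b (a ^ m) (b ^ m))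
    where
    exchange : ∀ a b p q → a * b * (p * q) ≡ a * p * (b * q)
    exchange = solve-∀

  ≈ᵇ-true : ∀ {n} {x y : 𝔽₂^ n} → x ≡ y → x ≈ᵇ y ≡ true
  ≈ᵇ-true {x = x} refl = ≈ᵇ-refl x

  does-true : ∀ {X : Set} (X? : Dec X) → does X? ≡ true → X
  does-true (yes x) _ = x

  does-false : ∀ {X : Set} (X? : Dec X) → does X? ≡ false → ¬ X
  does-false (no ¬x) _ = ¬x

  module Induction (d : ℕ) where

    k T : ℕ
    k = suc d
    T = 2 ^ k

    err : ∀ {n} → (𝔽₂^ n → 𝔽₂) → ℕ
    err f = # (f ⊞ proj₁ (nearest d f))

    closeᵇ : ∀ {n} → (𝔽₂^ n → 𝔽₂) → Bool
    closeᵇ {n} f = does (4 * (T * err f) ≤? 2 ^ n)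

    closeᵇ-true : ∀ {n} (f : 𝔽₂^ n → 𝔽₂) → closeᵇ f ≡ true → 4 * (T * err f) ≤ 2 ^ n
    closeᵇ-true {n} f = does-true (4 * (T * err f) ≤? 2 ^ n)

    closeᵇ-false : ∀ {n} (f : 𝔽₂^ n → 𝔽₂) → closeᵇ f ≡ false → 2 ^ n < 4 * (T * err f)
    closeᵇ-false {n} f eq = ≰⇒> (does-false (4 * (T * err f) ≤? 2 ^ n) eq)

    err≤ : ∀ {n} (f p : 𝔽₂^ n → 𝔽₂) → Null k p → err f ≤ # (f ⊞ p)
    err≤ f p = proj₁ (proj₂ (proj₂ (nearest d f))) p

    null-nearest : ∀ {n} (f : 𝔽₂^ n → 𝔽₂) → Null k (proj₁ (nearest d f))
    null-nearest f = proj₁ (proj₂ (nearest d f))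

    far⇒nonNull : ∀ {n} (f : 𝔽₂^ n → 𝔽₂) → 2 ^ n < 4 * (T * err f) → ¬ Null k f
    far⇒nonNull {n} f far null = n≮0 (<-≤-trans far (≤-trans
      (*-monoʳ-≤ 4 (*-monoʳ-≤ T (≤-trans (err≤ f f null) (≤-reflexive (#-⊞-self f)))))
      (≤-reflexive (cong (4 *_) (*-zeroʳ T)))))

    -- The second summand on the left absorbs the loss of each dimension of the induction, a factor
    -- 1 - O (T / 2ⁿ).
    Rejected : ∀ {n} → (𝔽₂^ n → 𝔽₂) → Set
    Rejected {n} f = (2 ^ n) ^ suc k * (2 ^ n + 36 * T) ≤ 512 * 2 ^ n * R k f

    -- Every function satisfies `Null (suc n)`, so `R-lower` applies with 2ᵐ = 2ⁿ / 2ᵈ. As 2ⁿ + 36 T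
    -- ≤ 108 T here, a constant of 432 is enough; this case governs the size of 512.
    small-dimension : ∀ {n} (f : 𝔽₂^ n → 𝔽₂) → 2 ^ n ≤ 72 * T → 2 ^ n < 4 * (T * err f) → Rejected f
    small-dimension {n} f v≤64T far with null-or-nonNull k f
    ... | inj₁ null    = ⊥-elim (far⇒nonNull f far null)
    ... | inj₂ nonNull = arrange (2 ^ d) (2 ^ (n ∸ d)) (2 ^ n) ((2 ^ n) ^ suc k) (R k f)
      (trans (sym (^-distribˡ-+-* 2 (n ∸ d) d)) (cong (2 ^_) (m∸n+n≡m (<⇒≤ d<n)))) v≤64T
      (R-lower d (n ∸ d) f (Null-≤ (s≤s (m≤n+m∸n n d)) (Null-suc-dim f)) nonNull)
      where
      d<n : d < n
      d<n = ≰⇒> (λ n≤d → far⇒nonNull f far (Null-≤ (s≤s n≤d) (Null-suc-dim f)))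
      arrange : ∀ y t v w r → t * y ≡ v → v ≤ 72 * (2 * y) → 2 * (2 * y + 2) * w ≤ 4 * (2 * y) * t * r →
                w * (v + 36 * (2 * y)) ≤ 512 * v * r
      arrange y t v w r refl small le = ≤-cert (80 * (t * y) * r + 216 * w)
        (+-mono-≤ (*-monoʳ-≤ w small) (*-monoʳ-≤ 54 le)) (identity y t w r)
        where
        identity : ∀ y t w r → 512 * (t * y) * r + (w * (t * y) + 54 * (2 * (2 * y + 2) * w)) ≡
          w * (t * y + 36 * (2 * y)) + (w * (72 * (2 * y)) + 54 * (4 * (2 * y) * t * r)) + (80 * (t * y) * r + 216 * w)
        identity = solve-∀

    -- `p` is within the range of `#≤R`, yet no polynomial is within half that range, so at least an
    -- eighth of the parallelepipeds reject. Adding `p` does not change `R`.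
    near-but-far : ∀ {n} (f p : 𝔽₂^ n → 𝔽₂) → 36 * T ≤ 2 ^ n → 2 ^ n < 4 * (T * err f) →
                   Null k p → 2 * (T * # (f ⊞ p)) ≤ 2 ^ n → Rejected f
    near-but-far {n} f p 36T≤v far null near = arrange T (2 ^ n) ((2 ^ n) ^ k) (# (f ⊞ p)) (R k f) 36T≤v
      (≤-trans (<⇒≤ far) (*-monoʳ-≤ 4 (*-monoʳ-≤ T (err≤ f p null))))
      (subst (λ r → T * (2 ^ n) ^ k * # (f ⊞ p) ≤ 2 * r) (R-⊞ f null) (#≤R k (f ⊞ p) near))
      where
      arrange : ∀ t v w e r → 36 * t ≤ v → v ≤ 4 * (t * e) → t * w * e ≤ 2 * r → v * w * (v + 36 * t) ≤ 512 * v * r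
      arrange t v w e r le₁ le₂ le₃ = ≤-cert (496 * v * r)
        (+-mono-≤ (+-mono-≤ (*-monoʳ-≤ (v * w) le₁) (*-monoʳ-≤ (2 * (v * w)) le₂)) (*-monoʳ-≤ (8 * v) le₃)) (identity t v w e r)
        where
        identity : ∀ t v w e r → 512 * v * r + (v * w * (36 * t) + 2 * (v * w) * v + 8 * v * (t * w * e)) ≡
          v * w * (v + 36 * t) + (v * w * v + 2 * (v * w) * (4 * (t * e)) + 8 * v * (2 * r)) + 496 * v * r
        identity = solve-∀

    module Step {n} (f : 𝔽₂^ (suc n) → 𝔽₂) (36T≤v : 36 * T ≤ 2 ^ n) (far : 2 ^ suc n < 4 * (T * err f))
      (hypothesis : ∀ (g : 𝔽₂^ n → 𝔽₂) → 2 ^ n < 4 * (T * err g) → Rejected g) where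

      -- A functional is good when one of its two hyperplanes carries a close polynomial. The side
      -- is itself a Boolean: `c b` is true exactly when the side `true` is close, and for a good
      -- `b` the side `false` is close otherwise.
      good c : 𝔽₂^ (suc n) → 𝔽₂
      good b = not (𝟎 ≈ᵇ b) ∧ (closeᵇ (f ∘ embed b false) ∨ closeᵇ (f ∘ embed b true))
      c b = closeᵇ (f ∘ embed b true)

      P : 𝔽₂^ (suc n) → 𝔽₂^ (suc n) → 𝔽₂
      P b = proj₁ (nearest d (f ∘ embed b (c b))) ∘ project b

      good-≢𝟎 : ∀ {b} → good b ≡ true → b ≢ 𝟎
      good-≢𝟎 {b} gb b≡𝟎 with trans (sym gb) (cong (λ s → not s ∧ (closeᵇ (f ∘ embed b false) ∨ closeᵇ (f ∘ embed b true))) (≈ᵇ-true (sym b≡𝟎)))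
      ... | ()

      good-close : ∀ {b} → good b ≡ true → closeᵇ (f ∘ embed b (c b)) ≡ true
      good-close {b} gb = choose (λ s → closeᵇ (f ∘ embed b s)) (∧-right (not (𝟎 ≈ᵇ b)) gb)
        where
        choose : ∀ (h : Bool → Bool) → h false ∨ h true ≡ true → h (h true) ≡ true
        choose h eq with h true in h₁
        ... | true  = h₁
        ... | false = trans (sym (Bool.∨-identityʳ (h false))) eq

      close : ∀ {b} → good b ≡ true → 8 * T * ∑ (λ x → ⟦ on b (c b) x ⟧ * ⟦ (f ⊞ P b) x ⟧) ≤ 2 ^ suc n
      close {b} gb = ≤-trans
        (≤-reflexive (trans (cong (8 * T *_) (#-project b (c b) (good-≢𝟎 gb) f _)) (arrange T (err (f ∘ embed b (c b))))))
        (*-monoʳ-≤ 2 (closeᵇ-true (f ∘ embed b (c b)) (good-close gb)))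
        where
        arrange : ∀ t e → 8 * t * e ≡ 2 * (4 * (t * e))
        arrange = solve-∀

      open Gluing k f good c P good-≢𝟎 (λ {b} _ → Null-project b (null-nearest (f ∘ embed b (c b)))) close

      many-good : 17 * T ≤ # good → Rejected f
      many-good many = conclude (locally-close⇒close many)
        where
        conclude : ∃[ p ] (Null k p × 2 * (T * # (f ⊞ p)) ≤ 2 ^ suc n) → Rejected f
        conclude (p , null , near) = near-but-far f p (≤-trans 36T≤v (m≤m+n (2 ^ n) _)) far null near

      bad : 𝔽₂^ (suc n) → 𝔽₂
      bad b = not (𝟎 ≈ᵇ b) ∧ not (closeᵇ (f ∘ embed b false) ∨ closeᵇ (f ∘ embed b true))

      #bad : 2 ^ suc n ≤ # bad + # good + 1
      #bad = begin
        2 ^ suc n                                             ≡⟨ sym (#-true (suc n)) ⟩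
        # {suc n} (const true)                                ≤⟨ ∑-mono (λ b → cover (𝟎 ≈ᵇ b) (closeᵇ (f ∘ embed b false) ∨ closeᵇ (f ∘ embed b true))) ⟩
        ∑ (λ b → ⟦ bad b ⟧ + ⟦ good b ⟧ + ⟦ 𝟎 ≈ᵇ b ⟧)         ≡⟨ ∑-+ (λ b → ⟦ bad b ⟧ + ⟦ good b ⟧) (λ b → ⟦ 𝟎 ≈ᵇ b ⟧) ⟩
        ∑ (λ b → ⟦ bad b ⟧ + ⟦ good b ⟧) + # (𝟎 {suc n} ≈ᵇ_)  ≡⟨ cong₂ _+_ (∑-+ (λ b → ⟦ bad b ⟧) (λ b → ⟦ good b ⟧)) (#-≈ᵇ (𝟎 {suc n})) ⟩
        # bad + # good + 1                                    ∎
        where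
        open ≤-Reasoning
        cover : ∀ z s → 1 ≤ ⟦ not z ∧ not s ⟧ + ⟦ not z ∧ s ⟧ + ⟦ z ⟧
        cover true  s     = ≤-refl
        cover false true  = ≤-refl
        cover false false = ≤-refl

      w′ : ℕ
      w′ = (2 ^ n) ^ suc k

      -- Both hyperplanes of a bad functional are far, and `R∥` sums over the two, hence the factor
      -- 2.
      bad-rejects : ∀ b → 2 * (w′ * (2 ^ n + 36 * T)) * ⟦ bad b ⟧ ≤ 512 * 2 ^ n * R∥ b k f
      bad-rejects b with 𝟎 ≈ᵇ b in zero? | closeᵇ (f ∘ embed b false) in far₀ | closeᵇ (f ∘ embed b true) in far₁
      ... | true  | _     | _     = ≤-trans (≤-reflexive (*-zeroʳ (2 * (w′ * (2 ^ n + 36 * T))))) z≤n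
      ... | false | true  | _     = ≤-trans (≤-reflexive (*-zeroʳ (2 * (w′ * (2 ^ n + 36 * T))))) z≤n
      ... | false | false | true  = ≤-trans (≤-reflexive (*-zeroʳ (2 * (w′ * (2 ^ n + 36 * T))))) z≤n
      ... | false | false | false = begin
        2 * h * 1                                        ≡⟨ double h ⟩
        h + h
          ≤⟨ +-mono-≤ (hypothesis (f ∘ embed b false) (closeᵇ-false (f ∘ embed b false) far₀))
                      (hypothesis (f ∘ embed b true) (closeᵇ-false (f ∘ embed b true) far₁)) ⟩
        512 * 2 ^ n * R k (f ∘ embed b false) + 512 * 2 ^ n * R k (f ∘ embed b true)
          ≡⟨ sym (*-distribˡ-+ (512 * 2 ^ n) (R k (f ∘ embed b false)) (R k (f ∘ embed b true))) ⟩
        512 * 2 ^ n * (R k (f ∘ embed b false) + R k (f ∘ embed b true))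
          ≡⟨ cong (512 * 2 ^ n *_) (R-embed b b≢𝟎 k f) ⟩
        512 * 2 ^ n * R∥ b k f                           ∎
        where
        open ≤-Reasoning
        h = w′ * (2 ^ n + 36 * T)
        double : ∀ h → 2 * h * 1 ≡ h + h
        double = solve-∀
        b≢𝟎 : b ≢ 𝟎
        b≢𝟎 b≡𝟎 with trans (sym zero?) (≈ᵇ-true (sym b≡𝟎))
        ... | ()

      -- Of 2 · 2ⁿ functionals at most 17 T are good, and the zero functional is charged as one more
      -- T. With x = T / 2ⁿ ≤ 1/36 this loss is covered by (1 + 36 x) (1 - 9 x) ≥ 1 + 18 x, which
      -- explains 36 in `Rejected` and the cut at 72 T.
      few-good : # good ≤ 17 * T → Rejected f
      few-good few = arrange (2 ^ n) T w′ ((2 ^ suc n) ^ suc k) (# bad) (# good) (R k f) (∑ (λ b → R∥ b k f))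
        (m^n≢0 2 n) (m^n>0 2 k) 36T≤v few power #bad
        (subst₂ _≤_ (∑-* (2 * (w′ * (2 ^ n + 36 * T))) (λ b → ⟦ bad b ⟧)) (∑-* (512 * 2 ^ n) (λ b → R∥ b k f)) (∑-mono bad-rejects))
        (∑-R∥ k f)
        where
        power : (2 ^ suc n) ^ suc k ≡ 2 * T * w′
        power = *-^ 2 (2 ^ n) (suc k)
        arrange : ∀ v t w′ w m g r s → NonZero v → 1 ≤ t → 36 * t ≤ v → g ≤ 17 * t → w ≡ 2 * t * w′ → 2 * v ≤ m + g + 1 →
                  2 * (w′ * (v + 36 * t)) * m ≤ 512 * v * s → t * s ≤ 2 * v * r → w * (2 * v + 36 * t) ≤ 512 * (2 * v) * r
        arrange v t w′ w m g r s v≢0 1≤t 36t≤v g≤17t refl count le avg =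
          *-cancelˡ-≤ v {{v≢0}} (≤-trans scaled (≤-trans (≤-reflexive (regroup v t w′ m)) (≤-trans (*-monoʳ-≤ t le)
            (≤-trans (≤-reflexive (commute v t s)) (≤-trans (*-monoʳ-≤ (512 * v) avg) (≤-reflexive (collect v r)))))))
          where
          scaled : v * (2 * t * w′ * (2 * v + 36 * t)) ≤ 2 * t * w′ * ((v + 36 * t) * m)
          scaled = ≤-trans (≤-reflexive (front v t w′)) (*-monoʳ-≤ (2 * t * w′) (≤-cert 0
            (+-mono-≤ (*-monoʳ-≤ (v + 36 * t) (≤-trans count (≤-trans (+-mono-≤ (+-monoʳ-≤ m g≤17t) 1≤t) (≤-reflexive (eighteen m t)))))
                      (*-monoʳ-≤ (18 * t) 36t≤v)) (identity v t m)))
            where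
            front : ∀ v t w′ → v * (2 * t * w′ * (2 * v + 36 * t)) ≡ 2 * t * w′ * (v * (2 * v + 36 * t))
            front = solve-∀
            eighteen : ∀ m t → m + 17 * t + t ≡ m + 18 * t
            eighteen = solve-∀
            identity : ∀ v t m → (v + 36 * t) * m + ((v + 36 * t) * (2 * v) + 18 * t * (36 * t)) ≡
                                 v * (2 * v + 36 * t) + ((v + 36 * t) * (m + 18 * t) + 18 * t * v) + 0
            identity = solve-∀
          regroup : ∀ v t w′ m → 2 * t * w′ * ((v + 36 * t) * m) ≡ t * (2 * (w′ * (v + 36 * t)) * m)
          regroup = solve-∀
          commute : ∀ v t s → t * (512 * v * s) ≡ 512 * v * (t * s)
          commute = solve-∀
          collect : ∀ v r → 512 * v * (2 * v * r) ≡ v * (512 * (2 * v) * r)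
          collect = solve-∀

      rejected : Rejected f
      rejected with ≤-total (17 * T) (# good)
      ... | inj₁ many = many-good many
      ... | inj₂ few  = few-good few

    far⇒rejected : ∀ n (f : 𝔽₂^ n → 𝔽₂) → 2 ^ n < 4 * (T * err f) → Rejected f
    far⇒rejected zero f far = small-dimension f (≤-trans (m^n>0 2 k) (m≤m+n T _)) far
    far⇒rejected (suc n) f far with ≤-total (2 ^ suc n) (72 * T)
    ... | inj₁ small = small-dimension f small far
    ... | inj₂ large = Step.rejected f (*-cancelˡ-≤ 2 (≤-trans (≤-reflexive (sym (*-assoc 2 36 T))) large)) far (far⇒rejected n)

    R≤dist : ∀ {n} (f p : 𝔽₂^ n → 𝔽₂) → Null k p → R k f ≤ T * (2 ^ n) ^ k * # (f ⊞ p)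
    R≤dist f p null = ≤-trans (≤-reflexive (sym (R-⊞ f null))) (R≤# k (f ⊞ p))

    -- A far function is rejected with probability at least 1 / 512, so `few` leaves only close
    -- ones, which meet the hypothesis of `#≤R` with a factor 2 to spare.
    err≤R : ∀ {n} (f : 𝔽₂^ n → 𝔽₂) → 512 * R k f < (2 ^ n) ^ suc k → T * (2 ^ n) ^ k * err f ≤ 2 * R k f
    err≤R {n} f few with <-≤-connex (2 ^ n) (4 * (T * err f))
    ... | inj₂ close = subst (λ r → T * (2 ^ n) ^ k * err f ≤ 2 * r) (R-⊞ f (null-nearest f))
      (#≤R k (f ⊞ proj₁ (nearest d f)) (≤-trans (*-monoˡ-≤ (T * err f) {2} {4} (s≤s (s≤s z≤n))) close))
    ... | inj₁ far   = ⊥-elim (<-irrefl refl (begin-strict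
      2 ^ n * (512 * R k f)                  <⟨ *-monoʳ-< (2 ^ n) {{m^n≢0 2 n}} few ⟩
      2 ^ n * (2 ^ n) ^ suc k                ≡⟨ *-comm (2 ^ n) _ ⟩
      (2 ^ n) ^ suc k * 2 ^ n                ≤⟨ *-monoʳ-≤ ((2 ^ n) ^ suc k) (m≤m+n (2 ^ n) _) ⟩
      (2 ^ n) ^ suc k * (2 ^ n + 36 * T)     ≤⟨ far⇒rejected n f far ⟩
      512 * 2 ^ n * R k f                    ≡⟨ trans (cong (_* R k f) (*-comm 512 (2 ^ n))) (*-assoc (2 ^ n) 512 (R k f)) ⟩
      2 ^ n * (512 * R k f)                  ∎))
      where open ≤-Reasoning

-- From counts to rational probabilities and the real norm.

module Analysis where

  open Combinatorics using (R; ι; ι-/; ι-+; ι-*; ι-mono-≤; ι-cancel-<; ι-pos; rejects-R; accepts+rejects; nearest; module Induction)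
  open import Data.Rational.Base using (_+_; _*_; _-_; -_; _≤_; _<_; ∣_∣; _/_; Positive; positive; nonNegative)
  open import Data.Rational.Properties
  open import Defs using (𝔽₂; 𝔽₂^_; _^_; δ; Pr[accepts]; Pr[rejects]; lower; width; root-nonneg; root-power; seq; ‖_‖U^_)
  open +-*-Solver using (solve; _:=_; _:+_; _:*_; _:-_; :-_; con)

  -- As with `≤-cert`, an inequality is certified by exhibiting its difference as a sum of
  -- nonnegative terms, which leaves a ring identity.
  slack : ∀ {a b} s → 0ℚ ≤ s → b ≡ a + s → a ≤ b
  slack {a} {b} s 0≤s eq = subst₂ _≤_ (+-identityʳ a) (sym eq) (+-monoʳ-≤ a 0≤s)

  0≤* : ∀ {a b} → 0ℚ ≤ a → 0ℚ ≤ b → 0ℚ ≤ a * b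
  0≤* {a} {b} 0≤a 0≤b = subst (_≤ a * b) (*-zeroˡ b) (*-monoʳ-≤-nonNeg b {{nonNegative 0≤b}} 0≤a)

  0≤+ : ∀ {a b} → 0ℚ ≤ a → 0ℚ ≤ b → 0ℚ ≤ a + b
  0≤+ {a} {b} 0≤a 0≤b = subst (_≤ a + b) (+-identityʳ 0ℚ) (+-mono-≤ 0≤a 0≤b)

  0≤diff : ∀ {a b} → a ≤ b → 0ℚ ≤ b - a
  0≤diff {a} {b} a≤b = subst (_≤ b - a) (+-inverseʳ a) (+-monoˡ-≤ (- a) a≤b)

  0≤^ : ∀ {a} → 0ℚ ≤ a → ∀ m → 0ℚ ≤ a ^ m
  0≤^ 0≤a zero    = nonNegative⁻¹ 1ℚ
  0≤^ 0≤a (suc m) = 0≤* 0≤a (0≤^ 0≤a m)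

  0≤ι : ∀ m → 0ℚ ≤ ι m
  0≤ι m = subst (_≤ ι m) (ι-/ 0) (ι-mono-≤ ℕ.z≤n)

  0≤½ : 0ℚ ≤ ½
  0≤½ = from-yes (0ℚ ≤? ½)

  ι-suc : ∀ m → ι (suc m) ≡ 1ℚ + ι m
  ι-suc m = trans (ι-+ 1 m) (cong (_+ ι m) (ι-/ 1))

  ι2* : ∀ r → ι 2 * r ≡ r + r
  ι2* r = trans (cong (_* r) (ι-/ 2)) (solve 1 (λ r → con (1ℚ + 1ℚ) :* r := r :+ r) refl r)

  bernoulli : ∀ {x} → 0ℚ ≤ x → ∀ m → 1ℚ - ι m * (1ℚ - x) ≤ x ^ m
  bernoulli {x} 0≤x zero = ≤-reflexive (trans (cong (λ i → 1ℚ - i * (1ℚ - x)) (ι-/ 0))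
    (solve 1 (λ x → con 1ℚ :- con 0ℚ :* (con 1ℚ :- x) := con 1ℚ) refl x))
  bernoulli {x} 0≤x (suc m) = ≤-trans
    (slack (ι m * ((1ℚ - x) * (1ℚ - x))) (0≤* (0≤ι m) (0≤square (1ℚ - x)))
      (trans (expand x (ι m)) (cong (λ i → (1ℚ - i * (1ℚ - x)) + ι m * ((1ℚ - x) * (1ℚ - x))) (sym (ι-suc m)))))
    (*-monoˡ-≤-nonNeg x {{nonNegative 0≤x}} (bernoulli 0≤x m))
    where
    expand : ∀ x i → x * (1ℚ - i * (1ℚ - x)) ≡ (1ℚ - (1ℚ + i) * (1ℚ - x)) + i * ((1ℚ - x) * (1ℚ - x))
    expand = solve 2 (λ x i → x :* (con 1ℚ :- i :* (con 1ℚ :- x)) :=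
      (con 1ℚ :- (con 1ℚ :+ i) :* (con 1ℚ :- x)) :+ i :* ((con 1ℚ :- x) :* (con 1ℚ :- x))) refl
    0≤square : ∀ y → 0ℚ ≤ y * y
    0≤square y with ≤-total 0ℚ y
    ... | inj₁ 0≤y = 0≤* 0≤y 0≤y
    ... | inj₂ y≤0 = subst (0ℚ ≤_) (solve 1 (λ y → (:- y) :* (:- y) := y :* y) refl y)
                       (0≤* (neg-antimono-≤ y≤0) (neg-antimono-≤ y≤0))

  -- Bernoulli reversed: raising the exponent adds a slack of ½ (1 - x) (1 - m (1 - x)), nonnegative
  -- as long as m (1 - x) ≤ 1.
  power-upper : ∀ {x} → 0ℚ ≤ x → x ≤ 1ℚ → ∀ m → ι m * (1ℚ - x) ≤ 1ℚ → x ^ m ≤ 1ℚ - ½ * (ι m * (1ℚ - x))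
  power-upper {x} 0≤x x≤1 zero _ = ≤-reflexive (sym (trans (cong (λ i → 1ℚ - ½ * (i * (1ℚ - x))) (ι-/ 0))
    (solve 1 (λ x → con 1ℚ :- con ½ :* (con 0ℚ :* (con 1ℚ :- x)) := con 1ℚ) refl x)))
  power-upper {x} 0≤x x≤1 (suc m) small = ≤-trans
    (*-monoˡ-≤-nonNeg x {{nonNegative 0≤x}} (power-upper 0≤x x≤1 m small′))
    (slack (½ * ((1ℚ - x) * (1ℚ - ι m * (1ℚ - x)))) (0≤* 0≤½ (0≤* 0≤y (0≤diff small′)))
      (trans (cong (λ i → 1ℚ - ½ * (i * (1ℚ - x))) (ι-suc m)) (expand x (ι m))))
    where
    0≤y : 0ℚ ≤ 1ℚ - x
    0≤y = 0≤diff x≤1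
    small′ : ι m * (1ℚ - x) ≤ 1ℚ
    small′ = ≤-trans (slack (1ℚ - x) 0≤y (trans (cong (_* (1ℚ - x)) (ι-suc m))
      (solve 2 (λ i y → (con 1ℚ :+ i) :* y := i :* y :+ y) refl (ι m) (1ℚ - x)))) small
    expand : ∀ x i → 1ℚ - ½ * ((1ℚ + i) * (1ℚ - x)) ≡
                     x * (1ℚ - ½ * (i * (1ℚ - x))) + ½ * ((1ℚ - x) * (1ℚ - i * (1ℚ - x)))
    expand = solve 2 (λ x i → con 1ℚ :- con ½ :* ((con 1ℚ :+ i) :* (con 1ℚ :- x)) :=
      x :* (con 1ℚ :- con ½ :* (i :* (con 1ℚ :- x))) :+ con ½ :* ((con 1ℚ :- x) :* (con 1ℚ :- i :* (con 1ℚ :- x)))) refl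

  -- Distance, rejection probability and the gap whose root is the norm.

  module _ (d : ℕ) {n} (f : 𝔽₂^ n → 𝔽₂) where

    open Induction d using (k; T; err; R≤dist; err≤R; null-nearest)

    ρ : ℚ
    ρ = Pr[rejects] k f

    private
      V W N : ℕ
      V = 2 ℕ.^ n
      W = V ℕ.^ k
      N = V ℕ.^ suc k
      instance
        V≢0 : ℕ.NonZero V
        V≢0 = ℕ.m^n≢0 2 n
        N≢0 : ℕ.NonZero N
        N≢0 = ℕ.m^n≢0 V (suc k)

      cancel : ∀ {a b} → a * ι N ≤ b * ι N → a ≤ b
      cancel = *-cancelʳ-≤-pos (ι N) {{ι-pos N}}

      ρN : ρ * ι N ≡ ι (R k f)
      ρN = rejects-R k f

      δN : ι T * δ d f * ι N ≡ ι (T ℕ.* W ℕ.* err f)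
      δN = trans (cong (ι T * δ d f *_) (ι-* V W))
        (trans (solve 4 (λ t δ v w → t :* δ :* (v :* w) := t :* w :* (δ :* v)) refl (ι T) (δ d f) (ι V) (ι W))
          (trans (cong (ι T * ι W *_) (proj₂ (proj₂ (proj₂ (nearest d f)))))
            (trans (cong (_* ι (err f)) (sym (ι-* T W))) (sym (ι-* (T ℕ.* W) (err f))))))

    ρ≤δ : ρ ≤ ι T * δ d f
    ρ≤δ = cancel (subst₂ _≤_ (sym ρN) (sym δN) (ι-mono-≤ (R≤dist f _ (null-nearest f))))

    δ≤ρ : ι 512 * ρ < 1ℚ → ι T * δ d f ≤ ρ + ρ
    δ≤ρ small = subst (ι T * δ d f ≤_) (ι2* ρ) (cancel (subst₂ _≤_ (sym δN) (trans (ι-* 2 (R k f)) (trans (cong (ι 2 *_) (sym ρN)) (sym (*-assoc (ι 2) ρ (ι N)))))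
      (ι-mono-≤ (err≤R f (ι-cancel-< (subst₂ _<_
        (trans (*-assoc (ι 512) ρ (ι N)) (trans (cong (ι 512 *_) ρN) (sym (ι-* 512 (R k f))))) (*-identityˡ (ι N))
        (*-monoˡ-<-pos (ι N) {{ι-pos N}} small)))))))

    0≤δ : 0ℚ ≤ δ d f
    0≤δ = *-cancelʳ-≤-pos (ι V) {{ι-pos V}} (subst₂ _≤_ (sym (*-zeroˡ (ι V))) (sym (proj₂ (proj₂ (proj₂ (nearest d f))))) (0≤ι (err f)))

    gap : ℚ
    gap = Pr[accepts] k f - ρ

    gap≡ : gap ≡ 1ℚ - (ρ + ρ)
    gap≡ = trans (solve 2 (λ a r → a :- r := (a :+ r) :- (r :+ r)) refl (Pr[accepts] k f) ρ)
      (cong (_- (ρ + ρ)) (accepts+rejects k f))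

  -- Bisection never leaves 0, as powers of nonnegative numbers are nonnegative. A negative gap
  -- would thus make the norm 0; so the hypothesis that the norm is near 1 yields the nonnegativity
  -- that `root-power` asks for.
  root-negative : ∀ m p → p < 0ℚ → ∀ j → lower m p j ≡ 0ℚ
  root-negative m p p<0 zero    = refl
  root-negative m p p<0 (suc j) with (lower m p j + width p (suc j)) ^ m ≤? p
  ... | no  _  = root-negative m p p<0 j
  ... | yes le = ⊥-elim (<-irrefl refl (<-≤-trans (≤-<-trans le p<0)
    (0≤^ (0≤+ (root-nonneg m p j) (0≤* (0≤+ (nonNegative⁻¹ 1ℚ) (0≤∣p∣ p)) (0≤^ 0≤½ (suc j)))) m)))

  ι2^*½^ : ∀ d → ι (2 ℕ.^ d) * ½ ^ d ≡ 1ℚ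
  ι2^*½^ zero    = trans (cong (_* 1ℚ) (ι-/ 1)) refl
  ι2^*½^ (suc d) = trans (cong (_* (½ * ½ ^ d)) (ι-* 2 (2 ℕ.^ d)))
    (trans (cong (_* (½ * ½ ^ d)) (ι2* (ι (2 ℕ.^ d))))
      (trans (solve 2 (λ a b → (a :+ a) :* (con ½ :* b) := a :* b) refl (ι (2 ℕ.^ d)) (½ ^ d)) (ι2^*½^ d)))

  ½^≤1 : ∀ d → ½ ^ d ≤ 1ℚ
  ½^≤1 d = subst₂ _≤_ (*-identityˡ (½ ^ d)) (ι2^*½^ d)
    (*-monoʳ-≤-nonNeg (½ ^ d) {{nonNegative (0≤^ 0≤½ d)}} (subst (_≤ ι (2 ℕ.^ d)) (ι-/ 1) (ι-mono-≤ (ℕ.m^n>0 2 d))))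

  0<½^ : ∀ d → 0ℚ < ½ ^ d
  0<½^ zero    = positive⁻¹ 1ℚ
  0<½^ (suc d) = subst (_< ½ * ½ ^ d) (*-zeroʳ ½) (*-monoʳ-<-pos ½ (0<½^ d))

  ≤∣∣ : ∀ p → p ≤ ∣ p ∣
  ≤∣∣ p with ≤-total 0ℚ p
  ... | inj₁ 0≤p = ≤-reflexive (sym (0≤p⇒∣p∣≡p 0≤p))
  ... | inj₂ p≤0 = ≤-trans p≤0 (0≤∣p∣ p)

  -- `few-rejects` needs 512 ρ < 1. Bernoulli gives 2 ρ ≤ 4 ε₀ plus an approximation error, taken to
  -- be ε₀, and 256 · 5 / 2048 < 1.
  ε₀ : ℚ
  ε₀ = ℤ.+ 1 / 2048

  -- `large` is the hypothesis of the theorem with the order on the reals unfolded; the argument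
  -- then runs on the rational approximations `s j`.
  module Norm (d : ℕ) {n} (f : 𝔽₂^ n → 𝔽₂)
    (large : ∀ {e} → 0ℚ < e → ∃[ N ] (∀ j → N ℕ.≤ j → 1ℚ - ε₀ * ½ ^ d ≤ seq (‖ f ‖U^ suc d) j + e)) where

    private
      T = 2 ℕ.^ suc d
      τ h r p : ℚ
      τ = ι T
      h = ½ ^ d
      r = ρ d f
      p = gap d f
      s : ℕ → ℚ
      s = seq (‖ f ‖U^ suc d)

      τh≡2 : τ * h ≡ 1ℚ + 1ℚ
      τh≡2 = trans (cong (_* h) (trans (ι-* 2 (2 ℕ.^ d)) (ι2* (ι (2 ℕ.^ d)))))
        (trans (*-distribʳ-+ h (ι (2 ℕ.^ d)) (ι (2 ℕ.^ d))) (cong₂ _+_ (ι2^*½^ d) (ι2^*½^ d)))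

      1≤τ : 1ℚ ≤ τ
      1≤τ = subst (_≤ τ) (ι-/ 1) (ι-mono-≤ (ℕ.m^n>0 2 (suc d)))

      instance
        τ-pos : Positive τ
        τ-pos = ι-pos T {{ℕ.m^n≢0 2 (suc d)}}

      e≤τe : ∀ {e} → 0ℚ ≤ e → e ≤ τ * e
      e≤τe {e} 0≤e = subst (_≤ τ * e) (*-identityˡ e) (*-monoʳ-≤-nonNeg e {{nonNegative 0≤e}} 1≤τ)

      0≤s : ∀ j → 0ℚ ≤ s j
      0≤s = root-nonneg T p

      0≤p : 0ℚ ≤ p
      -- Tolerance ½ suffices because 1 - ε₀ exceeds ½.
      0≤p = ≮⇒≥ (λ p<0 → <-irrefl refl (<-≤-trans (from-yes (½ <? 1ℚ - ε₀)) (≤-trans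
        (slack (ε₀ * (1ℚ - h)) (0≤* (from-yes (0ℚ ≤? ε₀)) (0≤diff (½^≤1 d)))
          (solve 2 (λ e h → con 1ℚ :- e :* h := (con 1ℚ :- e) :+ e :* (con 1ℚ :- h)) refl ε₀ h))
        (subst (λ t → 1ℚ - ε₀ * h ≤ t + ½) (root-negative T p p<0 N) (proj₂ (large {½} (positive⁻¹ ½)) N ℕ.≤-refl)))))
        where N = proj₁ (large {½} (positive⁻¹ ½))

      bound-near : ∀ {e} j → ∣ s j ^ T - p ∣ < e → (s j ^ T ≤ p + e) × (p ≤ s j ^ T + e)
      bound-near {e} j near =
          slack (e - (s j ^ T - p)) (0≤diff (≤-trans (≤∣∣ _) (<⇒≤ near)))
            (solve 3 (λ a p e → p :+ e := a :+ (e :- (a :- p))) refl (s j ^ T) p e)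
        , slack (e - (- (s j ^ T - p))) (0≤diff (≤-trans (≤∣∣ _) (≤-trans (≤-reflexive (∣-p∣≡∣p∣ (s j ^ T - p))) (<⇒≤ near))))
            (solve 3 (λ a p e → a :+ e := p :+ (e :- (:- (a :- p)))) refl (s j ^ T) p e)

      near : ∀ {e} → 0ℚ < e → ∃[ N ] (∀ j → N ℕ.≤ j → (s j ^ T ≤ p + e) × (p ≤ s j ^ T + e))
      near 0<e = let N , close = root-power T p (ℕ.m^n>0 2 (suc d)) 0≤p 0<e
                 in N , λ j N≤j → bound-near j (close j N≤j)

      2r≤ : ∀ {e} j → s j ^ T ≤ p + e → r + r ≤ τ * (1ℚ - s j) + e
      2r≤ {e} j close = slack _ (0≤+ (0≤diff (bernoulli (0≤s j) T)) (0≤diff (subst (λ p → s j ^ T ≤ p + e) (gap≡ d f) close)))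
        (solve 5 (λ t y a r e → t :* y :+ e := (r :+ r) :+ ((a :- (con 1ℚ :- t :* y)) :+ (((con 1ℚ :- (r :+ r)) :+ e) :- a)))
          refl τ (1ℚ - s j) (s j ^ T) r e)

      0<ε₀h : 0ℚ < ε₀ * h
      0<ε₀h = subst (_< ε₀ * h) (*-zeroʳ ε₀) (*-monoʳ-<-pos ε₀ (0<½^ d))

      4ε₀ : ℚ
      4ε₀ = ε₀ * ((1ℚ + 1ℚ) + (1ℚ + 1ℚ))

      deficit : ∃[ N ] (∀ j → N ℕ.≤ j → τ * (1ℚ - s j) ≤ 4ε₀)
      -- The tolerance equals the permitted deficit ε₀ / 2ᵈ; their sum is twice that, and `τh≡2`
      -- turns it into 4 ε₀.
      deficit = proj₁ (large 0<ε₀h) , λ j N≤j → ≤-trans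
        (*-monoˡ-≤-nonNeg τ {{pos⇒nonNeg τ}} (slack {b = ε₀ * h + ε₀ * h} _ (0≤diff (proj₂ (large 0<ε₀h) j N≤j))
          (solve 2 (λ g s → g :+ g := (con 1ℚ :- s) :+ ((s :+ g) :- (con 1ℚ :- g))) refl (ε₀ * h) (s j))))
        (≤-reflexive (trans
          (solve 3 (λ e t h → t :* (e :* h :+ e :* h) := e :* (t :* h :+ t :* h)) refl ε₀ τ h)
          (cong (λ t → ε₀ * (t + t)) τh≡2)))

      few-rejects : ι 512 * r < 1ℚ
      few-rejects = ≤-<-trans
        (≤-reflexive (trans (cong (_* r) (ι-/ 512))
          (solve 1 (λ r → con (ℤ.+ 512 / 1) :* r := con (ℤ.+ 256 / 1) :* (r :+ r)) refl r)))
        (≤-<-trans (*-monoˡ-≤-nonNeg (ℤ.+ 256 / 1) (≤-trans (2r≤ j (proj₁ (proj₂ (near 0<ε₀) j (ℕ.m≤m⊔n N₁ N₂))))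
            (+-monoˡ-≤ ε₀ (proj₂ deficit j (ℕ.m≤n⊔m N₁ N₂)))))
          (from-yes ((ℤ.+ 256 / 1) * (4ε₀ + ε₀) <? 1ℚ)))
        where
        0<ε₀ : 0ℚ < ε₀
        0<ε₀ = positive⁻¹ ε₀
        N₁ = proj₁ (near 0<ε₀)
        N₂ = proj₁ deficit
        j  = N₁ ℕ.⊔ N₂

    -- 2ᵏ δ ≤ 2 ρ ≤ 2ᵏ (1 - s) + e: the factor 2 lost in the second moment is the 2 in gap = 1 - 2
    -- ρ, so C = 1.
    δ≤deficit : ∀ {e} → 0ℚ < e → ∃[ N ] (∀ j → N ℕ.≤ j → δ d f ≤ 1ℚ * (1ℚ - s j) + e)
    δ≤deficit {e} 0<e = proj₁ (near 0<e) , λ j N≤j → *-cancelˡ-≤-pos τ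
      (≤-trans (δ≤ρ d f few-rejects) (≤-trans (2r≤ j (proj₁ (proj₂ (near 0<e) j N≤j)))
        (≤-trans (+-monoʳ-≤ (τ * (1ℚ - s j)) (e≤τe (<⇒≤ 0<e)))
          (≤-reflexive (solve 3 (λ t y e → t :* y :+ t :* e := t :* (con 1ℚ :* y :+ e)) refl τ (1ℚ - s j) e)))))

    -- ½ 2ᵏ (1 - s) ≤ 1 - sᵀ ≤ 2 ρ + e ≤ 2 · 2ᵏ δ + e, with T = 2ᵏ; hence c = 1/4.
    deficit≤δ : ∀ {e} → 0ℚ < e → ∃[ N ] (∀ j → N ℕ.≤ j → ½ * ½ * (1ℚ - s j) ≤ δ d f + e)
    deficit≤δ {e} 0<e = N₁ ℕ.⊔ N₂ , λ j N≤j → bound j (≤-total 1ℚ (s j))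
        (proj₂ (proj₂ (near 0<e) j (ℕ.m⊔n≤o⇒m≤o N₁ N₂ N≤j))) (proj₂ deficit j (ℕ.m⊔n≤o⇒n≤o N₁ N₂ N≤j))
      where
      N₁ = proj₁ (near 0<e)
      N₂ = proj₁ deficit
      bound : ∀ j → _ → p ≤ s j ^ T + e → τ * (1ℚ - s j) ≤ 4ε₀ → ½ * ½ * (1ℚ - s j) ≤ δ d f + e
      -- `power-upper` asks for s ≤ 1; beyond 1 the left side is nonpositive and `0≤δ` suffices.
      bound j (inj₁ 1≤s) _ _ = slack _ (0≤+ (0≤+ (0≤δ d f) (<⇒≤ 0<e)) (0≤* (from-yes (0ℚ ≤? ½ * ½)) (0≤diff 1≤s)))
        (solve 3 (λ s δ e → δ :+ e := con (½ * ½) :* (con 1ℚ :- s) :+ ((δ :+ e) :+ con (½ * ½) :* (s :- con 1ℚ)))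
          refl (s j) (δ d f) e)
      bound j (inj₂ s≤1) close small = *-cancelˡ-≤-pos τ (slack _
        (0≤+ (0≤+ (0≤* 0≤½ (0≤diff (power-upper (0≤s j) s≤1 T (≤-trans small (from-yes (4ε₀ ≤? 1ℚ))))))
                  (0≤* 0≤½ (0≤diff (subst (_≤ s j ^ T + e) (gap≡ d f) close))))
             (0≤+ (0≤diff (ρ≤δ d f)) (0≤+ (0≤diff (e≤τe (<⇒≤ 0<e))) (0≤* 0≤½ (<⇒≤ 0<e)))))
        (solve 6 (λ t y a r e δ → t :* (δ :+ e) := t :* (con (½ * ½) :* y) :+
            ((con ½ :* ((con 1ℚ :- con ½ :* (t :* y)) :- a) :+ con ½ :* ((a :+ e) :- (con 1ℚ :- (r :+ r))))
             :+ ((t :* δ :- r) :+ ((t :* e :- e) :+ con ½ :* e))))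
          refl τ (1ℚ - s j) (s j ^ T) r e (δ d f)))

open import Defs
open import Data.Nat using (_≥_)

0<fromℚ : ∀ {q} → 0ℚ ℚ.< q → 0ℝ < fromℚ q
0<fromℚ {q} 0<q = q , 0<q , 0 , λ _ _ → ℚ.≤-reflexive (ℚ.+-identityˡ q)

fromℚ-mono-≤ : ∀ {p q} → p ℚ.≤ q → fromℚ p ≤ fromℚ q
fromℚ-mono-≤ {p} {q} p≤q 0<e = 0 , λ _ _ → subst (ℚ._≤ q ℚ.+ _) (ℚ.+-identityʳ p) (ℚ.+-mono-≤ p≤q (ℚ.<⇒≤ 0<e))

theorem2 : ∃[ ε ] ∃[ c ] ∃[ C ]
    ( 0ℝ < ε × 0ℝ < c × c ≤ C
    × ( (d n : ℕ) → n ≥ 1 → (f : 𝔽₂^ n → 𝔽₂) →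
    1ℝ - ε * fromℚ (½ ^ d) ≤ ‖ f ‖U^ (suc d) →
    ( c * (1ℝ - ‖ f ‖U^ (suc d)) ≤ fromℚ (δ d f)
    × fromℚ (δ d f) ≤ C * (1ℝ - ‖ f ‖U^ (suc d)) ) ) )
theorem2 = fromℚ Analysis.ε₀ , fromℚ (½ ℚ.* ½) , fromℚ 1ℚ
  , 0<fromℚ (ℚ.positive⁻¹ Analysis.ε₀) , 0<fromℚ (ℚ.positive⁻¹ (½ ℚ.* ½)) , fromℚ-mono-≤ (from-yes (½ ℚ.* ½ ℚ.≤? 1ℚ))
  , λ d n _ f large → Analysis.Norm.deficit≤δ d f large , Analysis.Norm.δ≤deficit d f large
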